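{- The complexity measures $\mathsf{disc}$ and $\mathsf{D}^\times$ are incomparable, in the following sense (asymptotics as $n\to\infty$): 1. There is a family of functions $f_n\colon\{0,1\}^n\to\{0,1\}$ such that $\mathsf{disc}(f_n)=O(\log n)$ while $\mathsf{D}^\times(f_n)=\Theta(n)$. 2. There is a family of functions $f_n\colon\{0,1\}^n\to\{0,1\}$ such that $\mathsf{disc}(f_n)=\Theta(n)$ while $\mathsf{D}^\times(f_n)=O(1)$.
   Context: Inner products are over $\mathbb{F}_2$: $\langle a,x\rangle=\sum_i a_ix_i \bmod 2$. A deterministic parity decision tree $T$ on $\{0,1\}^n$ is a rooted binary tree in which every internal node is labelled by a vector $a\in\{0,1\}^n$ (the query $\langle a,x\rangle$) and has two children, one for each outcome in $\{0,1\}$, and every leaf is labelled by an output bit; $T(x)$ is the label of the leaf reached on input $x$. The depth of $T$ is the maximum number of queries on a root-to-leaf path. For $f\colon\{0,1\}^n\to\{0,1\}$ and a probability distribution $\mu$ on $\{0,1\}^n$, $\mathsf{D}_\epsilon(f,\mu)$ is the least depth of a deterministic parity decision tree $T$ with $\Pr_{x\sim\mu}[T(x)\ne f(x)]\le\epsilon$. A distribution on $\{0,1\}^n$ is product if it is a product of $n$ independent Bernoulli distributions. $\mathsf{D}^\times(f)=\max_{\mu\text{ product}}\mathsf{D}_{1/3}(f,\mu)$. For an affine subspace $S\subseteq\{0,1\}^n=\mathbb{F}_2^n$, let $\mathsf{bias}(f,\mu,S)=\left|\sum_{x\in S}(-1)^{f(x)}\mu(x)\right|$. Let $\mathsf{disc}(f,\mu)=-\log_2\max_{S}\mathsf{bias}(f,\mu,S)$,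 the maximum over all affine subspaces $S$ of $\{0,1\}^n$, and $\mathsf{disc}(f)=\max_\mu\mathsf{disc}(f,\mu)$ over all probability distributions $\mu$ on $\{0,1\}^n$. -}

module Defs where

open import Algebra.Bundles using (CommutativeRing; Semiring)
open import Algebra.Structures using (IsCommutativeRing)
import Algebra.Definitions.RawSemiring as RawSemiringDefs
open import Data.Bool.Base using (Bool; true; false; if_then_else_; _∧_; _xor_)
open import Data.Fin.Base using (Fin)
open import Data.Nat.Base as ℕ using (ℕ; zero; suc)
open import Data.Product.Base using (Σ; ∃; ∃-syntax; _×_)
open import Data.Vec.Base using (Vec; []; _∷_; foldr′; zipWith; replicate; lookup)
open import Level using (0ℓ)
open import Relation.Binary.PropositionalEquality using (_≡_; _≢_)
open import Relation.Binary.Structures using (IsDecTotalOrder)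
import Relation.Binary.Construct.NonStrictToStrict as ToStrict
open import Relation.Nullary.Decidable.Core using (does)

-- The classical real numbers, given by their axioms.  They are determined up
-- to isomorphism, except that x ⁻¹ at x = 0 and sup A for A empty or unbounded
-- above are arbitrary.
record CompleteOrderedField : Set₁ where
  infixl 7 _*_
  infixl 6 _+_
  infix  8 -_
  infix  9 _⁻¹
  infix  4 _≤_
  field
    Carrier           : Set
    _+_ _*_           : Carrier → Carrier → Carrier
    -_ _⁻¹            : Carrier → Carrier
    0# 1#             : Carrier
    _≤_               : Carrier → Carrier → Set
    sup               : (Carrier → Set) → Carrier
    isCommutativeRing : IsCommutativeRing _≡_ _+_ _*_ -_ 0# 1#
    0≢1               : 0# ≢ 1#
    *-inverseʳ        : ∀ x → x ≢ 0# → x * x ⁻¹ ≡ 1#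
    isDecTotalOrder   : IsDecTotalOrder _≡_ _≤_
    +-monoˡ-≤         : ∀ z {x y} → x ≤ y → x + z ≤ y + z
    *-nonNeg          : ∀ {x y} → 0# ≤ x → 0# ≤ y → 0# ≤ x * y

  IsUpperBound : (Carrier → Set) → Carrier → Set
  IsUpperBound A b = ∀ a → A a → a ≤ b

  field
    sup-upper : ∀ A → ∃ A → ∃ (IsUpperBound A) → IsUpperBound A (sup A)
    sup-least : ∀ A → ∃ A → ∃ (IsUpperBound A) →
                ∀ b → IsUpperBound A b → sup A ≤ b

  commutativeRing : CommutativeRing 0ℓ 0ℓ
  commutativeRing = record { isCommutativeRing = isCommutativeRing }

  open CommutativeRing commutativeRing public using (_-_; semiring)
  open RawSemiringDefs (Semiring.rawSemiring semiring) public using (_^_; product) renaming (_×_ to _·_)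
  open IsDecTotalOrder isDecTotalOrder public using (_≤?_)
  open ToStrict _≡_ _≤_ public using (_<_)

  fromℕ : ℕ → Carrier
  fromℕ n = n · 1#

  ∣_∣ : Carrier → Carrier
  ∣ x ∣ = if does (0# ≤? x) then x else - x

  inf : (Carrier → Set) → Carrier
  inf A = - sup (λ y → A (- y))

  -- For x > 0, the supremum of all rationals (a - b) / q with 2 ^ (a - b) ≤ x ^ q.
  log₂ : Carrier → Carrier
  log₂ x = sup λ y → ∃[ a ] ∃[ b ] ∃[ q ]
    q ℕ.> 0 ×
    fromℕ q * y ≡ fromℕ a - fromℕ b ×
    fromℕ 2 ^ a ≤ x ^ q * fromℕ 2 ^ b

  infix 4 _=O_ _=Ω_ _=Θ_

  _=O_ _=Ω_ _=Θ_ : (ℕ → Carrier) → (ℕ → Carrier) → Set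
  g =O h = ∃[ C ] ∃[ N ] ∀ n → n ℕ.≥ N → ∣ g n ∣ ≤ C * ∣ h n ∣
  g =Ω h = ∃[ c ] (0# < c) × ∃[ N ] ∀ n → n ℕ.≥ N → c * ∣ h n ∣ ≤ ∣ g n ∣
  g =Θ h = g =O h × g =Ω h

-- 𝔽₂ is Bool with addition _xor_ and multiplication _∧_.
Cube : ℕ → Set
Cube n = Vec Bool n

infixl 6 _⊕_

_⊕_ : ∀ {n} → Cube n → Cube n → Cube n
_⊕_ = zipWith _xor_

⟨_,_⟩ : ∀ {n} → Cube n → Cube n → Bool
⟨ a , x ⟩ = foldr′ _xor_ false (zipWith _∧_ a x)

data ParityTree (n : ℕ) : Set where
  leaf  : Bool → ParityTree n
  query : (a : Cube n) (t₀ t₁ : ParityTree n) → ParityTree n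

eval : ∀ {n} → ParityTree n → Cube n → Bool
eval (leaf b)        x = b
eval (query a t₀ t₁) x = if ⟨ a , x ⟩ then eval t₁ x else eval t₀ x

depth : ∀ {n} → ParityTree n → ℕ
depth (leaf b)        = 0
depth (query a t₀ t₁) = suc (depth t₀ ℕ.⊔ depth t₁)

-- Over 𝔽₂, closure under scalar multiplication is automatic.
record IsLinearSubspace {n} (V : Cube n → Bool) : Set where
  field
    0∈       : V (replicate n false) ≡ true
    ⊕-closed : ∀ x y → V x ≡ true → V y ≡ true → V (x ⊕ y) ≡ true

-- S = a + V; note that - a = a.
IsAffineSubspace : ∀ {n} → (Cube n → Bool) → Set
IsAffineSubspace {n} S =
  ∃[ V ] IsLinearSubspace V × ∃[ a ] (∀ (x : Cube n) → S x ≡ V (x ⊕ a))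

module Measures (ℝ : CompleteOrderedField) where
  open CompleteOrderedField ℝ public

  ∑ : ∀ {n} → (Cube n → Carrier) → Carrier
  ∑ {zero}  g = g []
  ∑ {suc n} g = ∑ (λ x → g (false ∷ x)) + ∑ (λ x → g (true ∷ x))

  record Distribution (n : ℕ) : Set where
    field
      mass   : Cube n → Carrier
      nonNeg : ∀ x → 0# ≤ mass x
      total  : ∑ mass ≡ 1#

  open Distribution public

  Pr : ∀ {n} → Distribution n → (Cube n → Bool) → Carrier
  Pr μ E = ∑ λ x → if E x then mass μ x else 0#

  IsProduct : ∀ {n} → Distribution n → Set
  IsProduct {n} μ = Σ (Fin n → Carrier) λ p →
    (∀ i → 0# ≤ p i × p i ≤ 1#) ×
    (∀ x → mass μ x ≡ product (λ i → if lookup x i then p i else 1# - p i))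

  -- Extrema are written with sup and inf.  Here and in disc they are attained:
  -- each is over a finite set of values or, for the distributions in disc,
  -- over a compact simplex.
  D : ∀ {n} → Carrier → (Cube n → Bool) → Distribution n → Carrier
  D {n} ε f μ = inf λ d → Σ (ParityTree n) λ T →
    Pr μ (λ x → eval T x xor f x) ≤ ε × d ≡ fromℕ (depth T)

  D× : ∀ {n} → (Cube n → Bool) → Carrier
  D× {n} f = sup λ d → Σ (Distribution n) λ μ →
    IsProduct μ × d ≡ D (fromℕ 3 ⁻¹) f μ

  bias : ∀ {n} → (Cube n → Bool) → Distribution n → (Cube n → Bool) → Carrier
  bias f μ S = ∣ ∑ (λ x → if S x then (if f x then - 1# else 1#) * mass μ x else 0#) ∣

  maxBias : ∀ {n} → (Cube n → Bool) → Distribution n → Carrier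
  maxBias f μ = sup λ b → ∃[ S ] IsAffineSubspace S × b ≡ bias f μ S

  discUnder : ∀ {n} → (Cube n → Bool) → Distribution n → Carrier
  discUnder f μ = - log₂ (maxBias f μ)

  disc : ∀ {n} → (Cube n → Bool) → Carrier
  disc {n} f = sup λ d → Σ (Distribution n) λ μ → d ≡ discUnder f μ

{-# OPTIONS --safe #-}

-- First family: the majority of the majorities of consecutive triples of bits. Twice the sum of
-- the signs of the inner majorities is a sum of O(n) signed characters, so under every
-- distribution some character, hence some hyperplane, has bias Ω(1/n). For the lower bound on
-- parity trees under the uniform distribution, reveal two bits of a triple occurring in a query:
-- with probability 1/2 they agree, the third bit is then irrelevant to the function and the
-- answer to the query can be charged to it. So a query costs about two revealed triples on
-- average. The square of the running sum grows linearly in the number of revealed triples, and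
-- the advantage at a leaf is bounded by a survival probability of a simple random walk.
--
-- Second family: the inner product function, guarded by the test that the input consists of two
-- identical copies.  On the uniform distribution over repeated inputs it is a bent function, and a
-- bound on all characters passes to all affine subspaces.  Under a product distribution the two
-- copies are independent, so outside a single point z the repeated inputs have mass at most 1/4,
-- and four parities test for z with error 1/16.
module Submission where

open import Defs
open import Algebra.Bundles using (CommutativeRing)
import Algebra.Properties.Monoid.Mult as MonoidMult
import Algebra.Properties.Ring as RingProperties
import Algebra.Properties.Semiring.Mult as SemiringMult
import Algebra.Solver.Ring as RingSolver
import Algebra.Solver.Ring.AlmostCommutativeRing as ACR
open import Data.Bool.Base using (Bool; true; false; if_then_else_; _∧_; _xor_; not)
import Data.Bool.Properties as Boolₚ
open import Data.Empty using (⊥-elim)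
open import Data.Fin.Base as Fin using (Fin)
open import Data.Integer.Base as ℤ using (ℤ; -[1+_])
import Data.Integer.Properties as ℤₚ
open import Data.List.Base as List using (List; []; _∷_; length)
import Data.List.Properties as Listₚ
open import Data.Maybe.Base using (Maybe; just; nothing)
open import Data.Nat.Base as ℕ using (ℕ; zero; suc; s≤s; z≤n)
import Data.Nat.Properties as ℕₚ
import Data.Nat.Tactic.RingSolver as NatSolver
open import Data.Product.Base using (Σ; ∃; ∃-syntax; _×_; _,_; proj₁; proj₂)
open import Data.Sum.Base using (_⊎_; inj₁; inj₂)
open import Data.Vec.Base using (Vec; []; _∷_; replicate; lookup; insertAt; removeAt; zipWith)
open import Function.Base using (_∘_)
open import Relation.Binary.PropositionalEquality using (_≡_; _≢_; refl; sym; trans; cong; cong₂; subst; subst₂; module ≡-Reasoning)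
open import Relation.Binary.Structures using (IsDecTotalOrder)
open import Relation.Nullary.Decidable.Core using (yes; no)

-- For the first family the obstacle is that a single parity may involve every bit, so counting the
-- bits that a tree has read gives no bound. A bit that is irrelevant to the function removes it:
-- once the rest of the input is fixed, the answer to a query containing that bit is a fair coin,
-- and the bit can be eliminated by solving the query for it. This turns linear queries into affine
-- ones, hence trees with affine labels. Error 1/3 forces correlation at least 1/3, whereas the
-- potential argument bounds it by 1/4 plus a term of order (1 + depth) / h², with h² about the
-- number of triples; the gap between 1/3 and 1/4 makes the depth linear.
--
-- For the second family, the inner product alone would be hard already under the uniform
-- distribution, which is product. The guard keeps it hard only for distributions that correlate the
-- two copies. The error budget there is 1/4 for repeated inputs and 1/16 for the point test, in
-- total 5/16 and thus below 1/3.

-- Arithmetic of the ordered field, a ring solver, and bounds on `log₂`.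

module RealArithmetic (ℝ : CompleteOrderedField) where
  open Measures ℝ public
  open CommutativeRing commutativeRing public
    using (+-comm; +-assoc; +-identityˡ; +-identityʳ; *-comm; *-assoc; *-identityˡ; 
           zeroˡ; zeroʳ; distribˡ; distribʳ; -‿inverseʳ)
  open IsDecTotalOrder isDecTotalOrder public
    using () renaming (refl to ≤-refl; trans to ≤-trans; antisym to ≤-antisym; total to ≤-total; reflexive to ≤-reflexive)

  private
    module R = CommutativeRing commutativeRing
    module RP = RingProperties R.ring
    module MM = MonoidMult R.+-monoid
    module SM = SemiringMult R.semiring

  fromℕ-+ : ∀ m n → fromℕ (m ℕ.+ n) ≡ fromℕ m + fromℕ n
  fromℕ-+ = MM.×-homo-+ 1#

  fromℕ-* : ∀ m n → fromℕ (m ℕ.* n) ≡ fromℕ m * fromℕ n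
  fromℕ-* = SM.×1-homo-*

  fromℕ-1 : fromℕ 1 ≡ 1#
  fromℕ-1 = +-identityʳ 1#

  private
    -- Integers serve as solver coefficients because their equality test computes; the order of an
    -- abstract field decides equality but does not reduce.
    fromℤ : ℤ → Carrier
    fromℤ (ℤ.+ n)    = fromℕ n
    fromℤ -[1+ n ] = - fromℕ (suc n)

    cancel-1 : ∀ x y → x - y ≡ (1# + x) - (1# + y)
    cancel-1 x y = begin
      x - y                          ≡⟨ cong (_- y) (sym (+-identityʳ x)) ⟩
      (x + 0#) - y                   ≡⟨ cong (λ z → (x + z) - y) (sym (-‿inverseʳ 1#)) ⟩
      (x + (1# - 1#)) - y            ≡⟨ cong (_- y) (trans (sym (+-assoc x 1# (- 1#))) (cong (_- 1#) (+-comm x 1#))) ⟩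
      ((1# + x) - 1#) - y            ≡⟨ +-assoc (1# + x) (- 1#) (- y) ⟩
      (1# + x) + (- 1# - y)          ≡⟨ cong (_+_ (1# + x)) (RP.-‿+-comm 1# y) ⟩
      (1# + x) - (1# + y)            ∎
      where open ≡-Reasoning

    fromℤ-⊖ : ∀ m n → fromℤ (m ℤ.⊖ n) ≡ fromℕ m - fromℕ n
    fromℤ-⊖ m zero = sym (trans (cong (_+_ (fromℕ m)) RP.-0#≈0#) (+-identityʳ _))
    fromℤ-⊖ zero (suc n) = sym (+-identityˡ _)
    fromℤ-⊖ (suc m) (suc n) =
      trans (cong fromℤ (ℤₚ.[1+m]⊖[1+n]≡m⊖n m n)) (trans (fromℤ-⊖ m n) (cancel-1 _ _))

    fromℤ-+ : ∀ i j → fromℤ (i ℤ.+ j) ≡ fromℤ i + fromℤ j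
    fromℤ-+ (ℤ.+ m)    (ℤ.+ n)    = fromℕ-+ m n
    fromℤ-+ (ℤ.+ m)    -[1+ n ] = fromℤ-⊖ m (suc n)
    fromℤ-+ -[1+ m ] (ℤ.+ n)    = trans (fromℤ-⊖ n (suc m)) (+-comm _ _)
    fromℤ-+ -[1+ m ] -[1+ n ] = trans (cong (λ k → - fromℕ (suc k)) (sym (ℕₚ.+-suc m n)))
      (trans (cong -_ (fromℕ-+ (suc m) (suc n))) (sym (RP.-‿+-comm _ _)))

    fromℤ-neg : ∀ i → fromℤ (ℤ.- i) ≡ - fromℤ i
    fromℤ-neg (ℤ.+ zero)  = sym RP.-0#≈0#
    fromℤ-neg (ℤ.+ suc n) = refl
    fromℤ-neg -[1+ n ]  = sym (RP.-‿involutive _)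

    fromℤ-*⁺ : ∀ m j → fromℤ (ℤ.+ m ℤ.* j) ≡ fromℕ m * fromℤ j
    fromℤ-*⁺ zero    j = trans (cong fromℤ (ℤₚ.*-zeroˡ j)) (sym (zeroˡ _))
    fromℤ-*⁺ (suc m) j = begin
      fromℤ (ℤ.+ suc m ℤ.* j)             ≡⟨ cong fromℤ (ℤₚ.suc-* (ℤ.+ m) j) ⟩
      fromℤ (j ℤ.+ ℤ.+ m ℤ.* j)           ≡⟨ fromℤ-+ j (ℤ.+ m ℤ.* j) ⟩
      fromℤ j + fromℤ (ℤ.+ m ℤ.* j)       ≡⟨ cong₂ _+_ (sym (*-identityˡ _)) (fromℤ-*⁺ m j) ⟩
      1# * fromℤ j + fromℕ m * fromℤ j  ≡⟨ sym (distribʳ _ _ _) ⟩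
      fromℕ (suc m) * fromℤ j           ∎
      where open ≡-Reasoning

    fromℤ-* : ∀ i j → fromℤ (i ℤ.* j) ≡ fromℤ i * fromℤ j
    fromℤ-* (ℤ.+ m)    j = fromℤ-*⁺ m j
    fromℤ-* -[1+ m ] j = begin
      fromℤ (ℤ.- (ℤ.+ suc m) ℤ.* j)    ≡⟨ cong fromℤ (sym (ℤₚ.neg-distribˡ-* (ℤ.+ suc m) j)) ⟩
      fromℤ (ℤ.- (ℤ.+ suc m ℤ.* j))    ≡⟨ fromℤ-neg (ℤ.+ suc m ℤ.* j) ⟩
      - fromℤ (ℤ.+ suc m ℤ.* j)        ≡⟨ cong -_ (fromℤ-*⁺ (suc m) j) ⟩
      - (fromℕ (suc m) * fromℤ j)    ≡⟨ RP.-‿distribˡ-* _ _ ⟩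
      - fromℕ (suc m) * fromℤ j      ∎
      where open ≡-Reasoning

    -- Agrees with fromℤ, but sends + 1 to 1# definitionally, so that the solver
    -- constant con (ℤ.+ 1) matches 1#.
    ⟦_⟧ : ℤ → Carrier
    ⟦ ℤ.+ 1 ⟧ = 1#
    ⟦ i   ⟧ = fromℤ i

    ⟦⟧≡fromℤ : ∀ i → ⟦ i ⟧ ≡ fromℤ i
    ⟦⟧≡fromℤ (ℤ.+ 0)           = refl
    ⟦⟧≡fromℤ (ℤ.+ 1)           = sym fromℕ-1
    ⟦⟧≡fromℤ (ℤ.+ suc (suc n)) = refl
    ⟦⟧≡fromℤ -[1+ n ]        = refl

    morphism : ℤ.+-*-rawRing ACR.-Raw-AlmostCommutative⟶ ACR.fromCommutativeRing commutativeRing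
    morphism = record
      { ⟦_⟧    = ⟦_⟧
      ; +-homo = λ i j → lift₂ _+_ (i ℤ.+ j) (fromℤ-+ i j) (⟦⟧≡fromℤ i) (⟦⟧≡fromℤ j)
      ; *-homo = λ i j → lift₂ _*_ (i ℤ.* j) (fromℤ-* i j) (⟦⟧≡fromℤ i) (⟦⟧≡fromℤ j)
      ; -‿homo = λ i → trans (⟦⟧≡fromℤ (ℤ.- i)) (trans (fromℤ-neg i) (cong -_ (sym (⟦⟧≡fromℤ i))))
      ; 0-homo = refl
      ; 1-homo = refl
      }
      where
      lift₂ : (_∙_ : Carrier → Carrier → Carrier) → ∀ {x y a b} k → fromℤ k ≡ x ∙ y → a ≡ x → b ≡ y → ⟦ k ⟧ ≡ a ∙ b
      lift₂ _∙_ k e p q = trans (⟦⟧≡fromℤ k) (trans e (sym (cong₂ _∙_ p q)))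

    coeff≟ : ∀ i j → Maybe (⟦ i ⟧ ≡ ⟦ j ⟧)
    coeff≟ i j with i ℤₚ.≟ j
    ... | yes e = just (cong ⟦_⟧ e)
    ... | no  _ = nothing

  open RingSolver ℤ.+-*-rawRing (ACR.fromCommutativeRing commutativeRing) morphism coeff≟ public
    using (solve; _:=_; _:+_; _:*_; _:-_; :-_; con)

  x≤y⇒0≤y-x : ∀ {x y} → x ≤ y → 0# ≤ y - x
  x≤y⇒0≤y-x {x} {y} p = subst (_≤ y - x) (-‿inverseʳ x) (+-monoˡ-≤ (- x) p)

  ≤-by : ∀ {x y} d → 0# ≤ d → y ≡ x + d → x ≤ y
  ≤-by {x} {y} d p e = subst₂ _≤_ (+-identityˡ x) (trans (+-comm d x) (sym e)) (+-monoˡ-≤ x p)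

  0≤+ : ∀ {x y} → 0# ≤ x → 0# ≤ y → 0# ≤ x + y
  0≤+ {x} {y} p q = ≤-trans q (≤-by x p (+-comm x y))

  +-mono-≤ : ∀ {a b c d} → a ≤ b → c ≤ d → a + c ≤ b + d
  +-mono-≤ {a} {b} {c} {d} p q = ≤-by ((b - a) + (d - c)) (0≤+ (x≤y⇒0≤y-x p) (x≤y⇒0≤y-x q))
    (solve 4 (λ a b c d → b :+ d := (a :+ c) :+ ((b :- a) :+ (d :- c))) refl a b c d)

  *-monoˡ-≤ : ∀ {c x y} → 0# ≤ c → x ≤ y → c * x ≤ c * y
  *-monoˡ-≤ {c} {x} {y} p q = ≤-by (c * (y - x)) (*-nonNeg p (x≤y⇒0≤y-x q))
    (solve 3 (λ c x y → c :* y := c :* x :+ c :* (y :- x)) refl c x y)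

  *-mono-≤ : ∀ {a b c d} → 0# ≤ a → 0# ≤ d → a ≤ b → c ≤ d → a * c ≤ b * d
  *-mono-≤ {a} {b} {c} {d} p q r s = ≤-trans (*-monoˡ-≤ p s)
    (subst₂ _≤_ (*-comm d a) (*-comm d b) (*-monoˡ-≤ q r))

  neg-mono-≤ : ∀ {x y} → x ≤ y → - y ≤ - x
  neg-mono-≤ {x} {y} p = ≤-by (y - x) (x≤y⇒0≤y-x p) (solve 2 (λ x y → :- x := (:- y) :+ (y :- x)) refl x y)

  0≤-neg : ∀ {x} → x ≤ 0# → 0# ≤ - x
  0≤-neg {x} p = ≤-by (0# - x) (x≤y⇒0≤y-x p) (solve 1 (λ x → :- x := con (ℤ.+ 0) :+ (con (ℤ.+ 0) :- x)) refl x)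

  0≤x² : ∀ x → 0# ≤ x * x
  0≤x² x with ≤-total 0# x
  ... | inj₁ p = *-nonNeg p p
  ... | inj₂ p = subst (0# ≤_) (solve 1 (λ x → (:- x) :* (:- x) := x :* x) refl x) (*-nonNeg (0≤-neg p) (0≤-neg p))

  0≤1 : 0# ≤ 1#
  0≤1 = subst (0# ≤_) (*-identityˡ 1#) (0≤x² 1#)

  0≤fromℕ : ∀ n → 0# ≤ fromℕ n
  0≤fromℕ zero    = ≤-refl
  0≤fromℕ (suc n) = 0≤+ 0≤1 (0≤fromℕ n)

  fromℕ-mono-≤ : ∀ {m n} → m ℕ.≤ n → fromℕ m ≤ fromℕ n
  fromℕ-mono-≤ {_}     {n}     z≤n     = 0≤fromℕ n
  fromℕ-mono-≤ {suc m} {suc n} (s≤s p) = +-mono-≤ ≤-refl (fromℕ-mono-≤ {m} {n} p)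

  1+n≰0 : ∀ n → fromℕ (suc n) ≤ 0# → ∀ {A : Set} → A
  1+n≰0 n p = ⊥-elim (0≢1 (≤-antisym 0≤1 (≤-trans (≤-by (fromℕ n) (0≤fromℕ n) refl) p)))

  fromℕ-suc≢0 : ∀ n → fromℕ (suc n) ≢ 0#
  fromℕ-suc≢0 n e = 1+n≰0 n (≤-reflexive e)

  fromℕ-cancel-≤ : ∀ {m n} → fromℕ m ≤ fromℕ n → m ℕ.≤ n
  fromℕ-cancel-≤ {zero}          p = z≤n
  fromℕ-cancel-≤ {suc m} {zero}  p = 1+n≰0 m p
  fromℕ-cancel-≤ {suc m} {suc n} p = s≤s (fromℕ-cancel-≤ (≤-by (fromℕ (suc n) - fromℕ (suc m)) (x≤y⇒0≤y-x p)
    (solve 2 (λ m n → n := m :+ ((con (ℤ.+ 1) :+ n) :- (con (ℤ.+ 1) :+ m))) refl (fromℕ m) (fromℕ n))))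

  *-cancelˡ-≡ : ∀ {c x y} → c ≢ 0# → c * x ≡ c * y → x ≡ y
  *-cancelˡ-≡ {c} {x} {y} c≢0 e = trans (sym (undo x)) (trans (cong (c ⁻¹ *_) e) (undo y))
    where
    undo : ∀ z → c ⁻¹ * (c * z) ≡ z
    undo z = begin
      c ⁻¹ * (c * z)  ≡⟨ solve 3 (λ c i z → i :* (c :* z) := (c :* i) :* z) refl c (c ⁻¹) z ⟩
      (c * c ⁻¹) * z  ≡⟨ cong (_* z) (*-inverseʳ c c≢0) ⟩
      1# * z          ≡⟨ *-identityˡ z ⟩
      z               ∎
      where open ≡-Reasoning

  *-cancelˡ-≤ : ∀ {c x y} → 0# ≤ c → c ≢ 0# → c * x ≤ c * y → x ≤ y
  *-cancelˡ-≤ {c} {x} {y} p c≢0 q with ≤-total x y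
  ... | inj₁ r = r
  ... | inj₂ r = ≤-reflexive (*-cancelˡ-≡ c≢0 (≤-antisym q (*-monoˡ-≤ p r)))

  fromℕ-suc-cancelˡ-≤ : ∀ n {x y} → fromℕ (suc n) * x ≤ fromℕ (suc n) * y → x ≤ y
  fromℕ-suc-cancelˡ-≤ n = *-cancelˡ-≤ (0≤fromℕ (suc n)) (fromℕ-suc≢0 n)

  n*n⁻¹≡1 : ∀ n → fromℕ (suc n) * fromℕ (suc n) ⁻¹ ≡ 1#
  n*n⁻¹≡1 n = *-inverseʳ _ (fromℕ-suc≢0 n)

  0≤n⁻¹ : ∀ n → 0# ≤ fromℕ (suc n) ⁻¹
  0≤n⁻¹ n = fromℕ-suc-cancelˡ-≤ n (subst₂ _≤_ (sym (zeroʳ _)) (sym (n*n⁻¹≡1 n)) 0≤1)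

  0<n⁻¹ : ∀ n → 0# < fromℕ (suc n) ⁻¹
  0<n⁻¹ n = 0≤n⁻¹ n , λ e → 0≢1 (trans (sym (zeroʳ _)) (trans (cong (fromℕ (suc n) *_) e) (n*n⁻¹≡1 n)))

  n⁻¹*-≤ : ∀ n {x y} → x ≤ fromℕ (suc n) * y → fromℕ (suc n) ⁻¹ * x ≤ y
  n⁻¹*-≤ n {x} {y} p = fromℕ-suc-cancelˡ-≤ n (≤-trans (≤-reflexive
    (trans (sym (*-assoc _ _ _)) (trans (cong (_* x) (n*n⁻¹≡1 n)) (*-identityˡ x)))) p)

  x≤∣x∣ : ∀ x → x ≤ ∣ x ∣
  x≤∣x∣ x with 0# ≤? x
  ... | yes p = ≤-refl
  ... | no ¬p with ≤-total 0# x
  ...   | inj₁ p = ⊥-elim (¬p p)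
  ...   | inj₂ p = ≤-trans p (0≤-neg p)

  -x≤∣x∣ : ∀ x → - x ≤ ∣ x ∣
  -x≤∣x∣ x with 0# ≤? x
  ... | yes p = ≤-trans (subst (- x ≤_) (solve 0 (:- con (ℤ.+ 0) := con (ℤ.+ 0)) refl) (neg-mono-≤ p)) p
  ... | no ¬p = ≤-refl

  ∣x∣≤ : ∀ {x b} → x ≤ b → - x ≤ b → ∣ x ∣ ≤ b
  ∣x∣≤ {x} p q with 0# ≤? x
  ... | yes _ = p
  ... | no  _ = q

  0≤∣x∣ : ∀ x → 0# ≤ ∣ x ∣
  0≤∣x∣ x with 0# ≤? x
  ... | yes p = p
  ... | no ¬p with ≤-total 0# x
  ...   | inj₁ p = ⊥-elim (¬p p)
  ...   | inj₂ p = 0≤-neg p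

  0≤x⇒∣x∣≡x : ∀ {x} → 0# ≤ x → ∣ x ∣ ≡ x
  0≤x⇒∣x∣≡x {x} p = ≤-antisym (∣x∣≤ ≤-refl (≤-trans (≤-trans (neg-mono-≤ p) (≤-reflexive (solve 0 (:- con (ℤ.+ 0) := con (ℤ.+ 0)) refl))) p)) (x≤∣x∣ x)

  -∣_∣≤ : ∀ {x b} → ∣ x ∣ ≤ b → - x ≤ b
  -∣_∣≤ {x} p = ≤-trans (-x≤∣x∣ x) p

  2^_ : ℕ → Carrier
  2^ n = fromℕ 2 ^ n

  x^[m+n] : ∀ x m n → x ^ (m ℕ.+ n) ≡ x ^ m * x ^ n
  x^[m+n] x zero    n = sym (*-identityˡ _)
  x^[m+n] x (suc m) n = trans (cong (x *_) (x^[m+n] x m n)) (sym (*-assoc _ _ _))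

  [xy]^n : ∀ x y n → (x * y) ^ n ≡ x ^ n * y ^ n
  [xy]^n x y zero    = sym (*-identityˡ 1#)
  [xy]^n x y (suc n) = trans (cong ((x * y) *_) ([xy]^n x y n))
    (solve 4 (λ x y p q → (x :* y) :* (p :* q) := (x :* p) :* (y :* q)) refl x y (x ^ n) (y ^ n))

  x^[mn] : ∀ x m n → (x ^ m) ^ n ≡ x ^ (n ℕ.* m)
  x^[mn] x m zero    = refl
  x^[mn] x m (suc n) = trans (cong (x ^ m *_) (x^[mn] x m n)) (sym (x^[m+n] x m (n ℕ.* m)))

  0≤x^n : ∀ {x} → 0# ≤ x → ∀ n → 0# ≤ x ^ n
  0≤x^n p zero    = 0≤1
  0≤x^n p (suc n) = *-nonNeg p (0≤x^n p n)

  ^-monoˡ-≤ : ∀ {x y} → 0# ≤ x → x ≤ y → ∀ n → x ^ n ≤ y ^ n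
  ^-monoˡ-≤ p q zero    = ≤-refl
  ^-monoˡ-≤ p q (suc n) = *-mono-≤ p (0≤x^n (≤-trans p q) n) q (^-monoˡ-≤ p q n)

  0≤2^ : ∀ n → 0# ≤ 2^ n
  0≤2^ = 0≤x^n (0≤fromℕ 2)

  2^-fromℕ : ∀ n → 2^ n ≡ fromℕ (2 ℕ.^ n)
  2^-fromℕ zero    = sym fromℕ-1
  2^-fromℕ (suc n) = trans (cong (fromℕ 2 *_) (2^-fromℕ n)) (sym (fromℕ-* 2 (2 ℕ.^ n)))

  2^-cancel-≤ : ∀ {m n} → 2^ m ≤ 2^ n → m ℕ.≤ n
  2^-cancel-≤ {m} {n} p with m ℕₚ.≤? n
  ... | yes q = q
  ... | no ¬q = ⊥-elim (ℕₚ.<⇒≱ (ℕₚ.^-monoʳ-< 2 (s≤s (s≤s z≤n)) (ℕₚ.≰⇒> ¬q))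
    (fromℕ-cancel-≤ (subst₂ _≤_ (2^-fromℕ m) (2^-fromℕ n) p)))

  log₂-set : Carrier → Carrier → Set
  log₂-set x y = ∃[ a ] ∃[ b ] ∃[ q ] q ℕ.> 0 × fromℕ q * y ≡ fromℕ a - fromℕ b × 2^ a ≤ x ^ q * 2^ b

  -- Raise `x * 2^ m ≤ 2^ k` to the power `q` and multiply by the inequality defining membership.
  -- The power of `x` drops out and leaves two powers of two, whose exponents compare as natural
  -- numbers.
  log₂-set-upper : ∀ {x} m k → 0# ≤ x → x * 2^ m ≤ 2^ k → IsUpperBound (log₂-set x) (fromℕ k - fromℕ m)
  log₂-set-upper {x} m k 0≤x h y (a , b , suc q′ , _ , e , p) = fromℕ-suc-cancelˡ-≤ q′
    (≤-by (fromℕ (q ℕ.* k ℕ.+ b) - fromℕ (a ℕ.+ q ℕ.* m)) (x≤y⇒0≤y-x (fromℕ-mono-≤ exponents)) (begin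
      fromℕ q * (fromℕ k - fromℕ m)
        ≡⟨ solve 5 (λ q k m a b → q :* (k :- m) := (a :- b) :+ ((q :* k :+ b) :- (a :+ q :* m))) refl (fromℕ q) (fromℕ k) (fromℕ m) (fromℕ a) (fromℕ b) ⟩
      (fromℕ a - fromℕ b) + ((fromℕ q * fromℕ k + fromℕ b) - (fromℕ a + fromℕ q * fromℕ m))
        ≡⟨ cong₂ _+_ (sym e) (cong₂ _-_ (sym (trans (fromℕ-+ (q ℕ.* k) b) (cong (_+ fromℕ b) (fromℕ-* q k))))
             (sym (trans (fromℕ-+ a (q ℕ.* m)) (cong (fromℕ a +_) (fromℕ-* q m))))) ⟩
      fromℕ q * y + (fromℕ (q ℕ.* k ℕ.+ b) - fromℕ (a ℕ.+ q ℕ.* m)) ∎))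
    where
    open ≡-Reasoning
    q = suc q′
    exponents : a ℕ.+ q ℕ.* m ℕ.≤ q ℕ.* k ℕ.+ b
    exponents = 2^-cancel-≤ (≤-trans
      (subst (_≤ (x ^ q * 2^ b) * 2^ (q ℕ.* m)) (sym (x^[m+n] _ a (q ℕ.* m)))
        (*-mono-≤ (0≤2^ a) (0≤2^ (q ℕ.* m)) p ≤-refl))
      (subst₂ _≤_
        (begin
          2^ b * (x * 2^ m) ^ q           ≡⟨ cong (2^ b *_) ([xy]^n x (2^ m) q) ⟩
          2^ b * (x ^ q * (2^ m) ^ q)     ≡⟨ cong (λ z → 2^ b * (x ^ q * z)) (x^[mn] _ m q) ⟩
          2^ b * (x ^ q * 2^ (q ℕ.* m))   ≡⟨ solve 3 (λ u v w → u :* (v :* w) := (v :* u) :* w) refl (2^ b) (x ^ q) (2^ (q ℕ.* m)) ⟩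
          (x ^ q * 2^ b) * 2^ (q ℕ.* m)   ∎)
        (begin
          2^ b * (2^ k) ^ q               ≡⟨ cong (2^ b *_) (x^[mn] _ k q) ⟩
          2^ b * 2^ (q ℕ.* k)             ≡⟨ *-comm _ _ ⟩
          2^ (q ℕ.* k) * 2^ b             ≡⟨ sym (x^[m+n] _ (q ℕ.* k) b) ⟩
          2^ (q ℕ.* k ℕ.+ b)              ∎)
        (*-monoˡ-≤ (0≤2^ b) (^-monoˡ-≤ (*-nonNeg 0≤x (0≤2^ m)) h q))))

  log₂-set-element : ∀ {x} a b → 2^ a ≤ x * 2^ b → log₂-set x (fromℕ a - fromℕ b)
  log₂-set-element {x} a b p = a , b , 1 , s≤s z≤n ,
    trans (cong (_* (fromℕ a - fromℕ b)) fromℕ-1) (*-identityˡ _) ,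
    subst (λ z → 2^ a ≤ z * 2^ b) (solve 1 (λ x → x := x :* con (ℤ.+ 1)) refl x) p

  -- The axioms determine `sup` only on nonempty bounded sets, so each one-sided estimate of `log₂`
  -- takes two inequalities: one supplies an element of the set and the other an upper bound.
  log₂-≤ : ∀ {x} m k a b → 0# ≤ x → 2^ a ≤ x * 2^ b → x * 2^ m ≤ 2^ k → log₂ x ≤ fromℕ k - fromℕ m
  log₂-≤ {x} m k a b 0≤x lower upper = sup-least (log₂-set x)
    (_ , log₂-set-element a b lower) (_ , log₂-set-upper m k 0≤x upper) _ (log₂-set-upper m k 0≤x upper)

  log₂-≥ : ∀ {x} m k a b → 0# ≤ x → 2^ a ≤ x * 2^ b → x * 2^ m ≤ 2^ k → fromℕ a - fromℕ b ≤ log₂ x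
  log₂-≥ {x} m k a b 0≤x lower upper = sup-upper (log₂-set x)
    (_ , log₂-set-element a b lower) (_ , log₂-set-upper m k 0≤x upper) _ (log₂-set-element a b lower)

-- Linear algebra over the field with two elements, and trees that read the whole input.

private variable n : ℕ

𝟎 : Cube n
𝟎 = replicate _ false

⊕-comm : (x y : Cube n) → x ⊕ y ≡ y ⊕ x
⊕-comm []      []      = refl
⊕-comm (a ∷ x) (b ∷ y) = cong₂ _∷_ (Boolₚ.xor-comm a b) (⊕-comm x y)

⊕-assoc : (x y z : Cube n) → (x ⊕ y) ⊕ z ≡ x ⊕ (y ⊕ z)
⊕-assoc []      []      []      = refl
⊕-assoc (a ∷ x) (b ∷ y) (c ∷ z) = cong₂ _∷_ (Boolₚ.xor-assoc a b c) (⊕-assoc x y z)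

⊕-identityʳ : (x : Cube n) → x ⊕ 𝟎 ≡ x
⊕-identityʳ []          = refl
⊕-identityʳ (false ∷ x) = cong (_ ∷_) (⊕-identityʳ x)
⊕-identityʳ (true ∷ x)  = cong (_ ∷_) (⊕-identityʳ x)

⊕-self : (x : Cube n) → x ⊕ x ≡ 𝟎
⊕-self []          = refl
⊕-self (false ∷ x) = cong (_ ∷_) (⊕-self x)
⊕-self (true ∷ x)  = cong (_ ∷_) (⊕-self x)

⊕-cancelʳ : (x y : Cube n) → (x ⊕ y) ⊕ y ≡ x
⊕-cancelʳ x y = trans (⊕-assoc x y y) (trans (cong (x ⊕_) (⊕-self y)) (⊕-identityʳ x))

⟨𝟎,_⟩ : (x : Cube n) → ⟨ 𝟎 , x ⟩ ≡ false
⟨𝟎, []    ⟩ = refl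
⟨𝟎, _ ∷ x ⟩ = ⟨𝟎, x ⟩

⟨_,𝟎⟩ : (a : Cube n) → ⟨ a , 𝟎 ⟩ ≡ false
⟨ []        ,𝟎⟩ = refl
⟨ false ∷ a ,𝟎⟩ = ⟨ a ,𝟎⟩
⟨ true ∷ a  ,𝟎⟩ = ⟨ a ,𝟎⟩

xor-interchange : ∀ a b c d → (a xor b) xor (c xor d) ≡ (a xor c) xor (b xor d)
xor-interchange false false c d = refl
xor-interchange false true  false d = refl
xor-interchange false true  true  d = refl
xor-interchange true  false c d = Boolₚ.not-distribˡ-xor c d
xor-interchange true  true  false d = sym (Boolₚ.not-involutive d)
xor-interchange true  true  true  d = refl

⟨,⟩-⊕ʳ : (a x y : Cube n) → ⟨ a , x ⊕ y ⟩ ≡ ⟨ a , x ⟩ xor ⟨ a , y ⟩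
⟨,⟩-⊕ʳ []      []      []      = refl
⟨,⟩-⊕ʳ (a ∷ as) (x ∷ xs) (y ∷ ys) = trans
  (cong₂ _xor_ (Boolₚ.∧-distribˡ-xor a x y) (⟨,⟩-⊕ʳ as xs ys))
  (xor-interchange (a ∧ x) (a ∧ y) ⟨ as , xs ⟩ ⟨ as , ys ⟩)

find : (P : Cube n → Bool) → (∃[ x ] P x ≡ true) ⊎ (∀ x → P x ≡ false)
find {zero} P with P [] in e
... | true  = inj₁ ([] , e)
... | false = inj₂ λ { [] → e }
find {suc n} P with find (P ∘ (false ∷_)) | find (P ∘ (true ∷_))
... | inj₁ (x , e) | _            = inj₁ (_ , e)
... | inj₂ _       | inj₁ (x , e) = inj₁ (_ , e)
... | inj₂ p       | inj₂ q       = inj₂ λ { (false ∷ x) → p x ; (true ∷ x) → q x }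

true-iff : ∀ {a b : Bool} → (a ≡ true → b ≡ true) → (b ≡ true → a ≡ true) → a ≡ b
true-iff {false} {false} p q = refl
true-iff {false} {true}  p q = q refl
true-iff {true}  {b}     p q = sym (p refl)

-- Reading the coordinates one after another makes the set of depths in `D` nonempty, so that its
-- infimum is specified, and bounds `D` by `n`.
fullTree : (f : Cube n → Bool) → ∃[ T ] depth T ℕ.≤ n × (∀ x → eval T x ≡ f x)
fullTree {zero} f = leaf (f []) , z≤n , λ { [] → refl }
fullTree {suc n} f = query (true ∷ 𝟎) (lift T₀) (lift T₁)
    , s≤s (ℕₚ.⊔-lub (subst (ℕ._≤ n) (sym (depth-lift T₀)) d₀) (subst (ℕ._≤ n) (sym (depth-lift T₁)) d₁))
    , correct
  where
  lift : ParityTree n → ParityTree (suc n)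
  lift (leaf b)        = leaf b
  lift (query a t₀ t₁) = query (false ∷ a) (lift t₀) (lift t₁)

  depth-lift : ∀ t → depth (lift t) ≡ depth t
  depth-lift (leaf b)        = refl
  depth-lift (query a t₀ t₁) = cong₂ (λ k l → suc (k ℕ.⊔ l)) (depth-lift t₀) (depth-lift t₁)

  eval-lift : ∀ t b x → eval (lift t) (b ∷ x) ≡ eval t x
  eval-lift (leaf _)        b x = refl
  eval-lift (query a t₀ t₁) b x rewrite eval-lift t₀ b x | eval-lift t₁ b x = refl

  IH₀ = fullTree (f ∘ (false ∷_))
  IH₁ = fullTree (f ∘ (true ∷_))
  T₀ = proj₁ IH₀
  T₁ = proj₁ IH₁
  d₀ = proj₁ (proj₂ IH₀)
  d₁ = proj₁ (proj₂ IH₁)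

  correct : ∀ x → eval (query (true ∷ 𝟎) (lift T₀) (lift T₁)) x ≡ f x
  correct (false ∷ x) rewrite ⟨𝟎, x ⟩ = trans (eval-lift T₀ false x) (proj₂ (proj₂ IH₀) x)
  correct (true ∷ x)  rewrite ⟨𝟎, x ⟩ = trans (eval-lift T₁ true x) (proj₂ (proj₂ IH₁) x)

-- Sums over the cube, sign characters, and the simplest affine subspaces.

module Sums (ℝ : CompleteOrderedField) where
  open RealArithmetic ℝ public

  ∑-cong : ∀ {n} {g h : Cube n → Carrier} → (∀ x → g x ≡ h x) → ∑ g ≡ ∑ h
  ∑-cong {zero}  e = e []
  ∑-cong {suc n} e = cong₂ _+_ (∑-cong (e ∘ (false ∷_))) (∑-cong (e ∘ (true ∷_)))

  ∑-mono : ∀ {n} {g h : Cube n → Carrier} → (∀ x → g x ≤ h x) → ∑ g ≤ ∑ h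
  ∑-mono {zero}  e = e []
  ∑-mono {suc n} e = +-mono-≤ (∑-mono (e ∘ (false ∷_))) (∑-mono (e ∘ (true ∷_)))

  ∑-+ : ∀ {n} (g h : Cube n → Carrier) → ∑ (λ x → g x + h x) ≡ ∑ g + ∑ h
  ∑-+ {zero}  g h = refl
  ∑-+ {suc n} g h = trans (cong₂ _+_ (∑-+ (g ∘ (false ∷_)) (h ∘ (false ∷_))) (∑-+ (g ∘ (true ∷_)) (h ∘ (true ∷_))))
    (solve 4 (λ a b c d → (a :+ b) :+ (c :+ d) := (a :+ c) :+ (b :+ d)) refl _ _ _ _)

  ∑-*ˡ : ∀ {n} c (g : Cube n → Carrier) → ∑ (λ x → c * g x) ≡ c * ∑ g
  ∑-*ˡ {zero}  c g = refl
  ∑-*ˡ {suc n} c g = trans (cong₂ _+_ (∑-*ˡ c (g ∘ (false ∷_))) (∑-*ˡ c (g ∘ (true ∷_)))) (sym (distribˡ c _ _))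

  ∑-0 : ∀ {n} {g : Cube n → Carrier} → (∀ x → g x ≡ 0#) → ∑ g ≡ 0#
  ∑-0 {zero}  e = e []
  ∑-0 {suc n} e = trans (cong₂ _+_ (∑-0 (e ∘ (false ∷_))) (∑-0 (e ∘ (true ∷_)))) (+-identityˡ 0#)

  ∑-nonNeg : ∀ {n} {g : Cube n → Carrier} → (∀ x → 0# ≤ g x) → 0# ≤ ∑ g
  ∑-nonNeg {zero}  e = e []
  ∑-nonNeg {suc n} e = 0≤+ (∑-nonNeg (e ∘ (false ∷_))) (∑-nonNeg (e ∘ (true ∷_)))

  ∑-neg : ∀ {n} (g : Cube n → Carrier) → ∑ (λ x → - g x) ≡ - ∑ g
  ∑-neg {zero}  g = refl
  ∑-neg {suc n} g = trans (cong₂ _+_ (∑-neg (g ∘ (false ∷_))) (∑-neg (g ∘ (true ∷_))))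
    (solve 2 (λ a b → (:- a) :+ (:- b) := :- (a :+ b)) refl _ _)

  ∑-shift : ∀ {n} (a : Cube n) (g : Cube n → Carrier) → ∑ (λ x → g (x ⊕ a)) ≡ ∑ g
  ∑-shift []          g = refl
  ∑-shift (false ∷ a) g = cong₂ _+_ (∑-shift a (g ∘ (false ∷_))) (∑-shift a (g ∘ (true ∷_)))
  ∑-shift (true ∷ a)  g = trans (+-comm _ _) (cong₂ _+_ (∑-shift a (g ∘ (false ∷_))) (∑-shift a (g ∘ (true ∷_))))

  ∑-const : ∀ {n} c → ∑ {n} (λ _ → c) ≡ 2^ n * c
  ∑-const {zero}  c = sym (*-identityˡ c)
  ∑-const {suc n} c = trans (cong₂ _+_ (∑-const {n} c) (∑-const {n} c))
    (solve 2 (λ p c → p :* c :+ p :* c := (con (ℤ.+ 2) :* p) :* c) refl (2^ n) c)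

  ∑-singleton : ∀ {n} (x : Cube n) (g : Cube n → Carrier) → (∀ y → y ≢ x → g y ≡ 0#) → ∑ g ≡ g x
  ∑-singleton []          g e = refl
  ∑-singleton (false ∷ x) g e = trans (cong₂ _+_ (∑-singleton x _ λ y y≢x → e _ λ { refl → y≢x refl }) (∑-0 λ y → e (true ∷ y) λ ()))
    (+-identityʳ _)
  ∑-singleton (true ∷ x)  g e = trans (cong₂ _+_ (∑-0 λ y → e (false ∷ y) λ ()) (∑-singleton x _ λ y y≢x → e _ λ { refl → y≢x refl }))
    (+-identityˡ _)

  infixr 5 _∣_
  _∣_ : ∀ {n} → (Cube n → Bool) → (Cube n → Carrier) → Cube n → Carrier
  (S ∣ g) x = if S x then g x else 0#

  ∣-nonNeg : ∀ {n} (S : Cube n → Bool) {g : Cube n → Carrier} → (∀ x → 0# ≤ g x) → ∀ x → 0# ≤ (S ∣ g) x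
  ∣-nonNeg S p x with S x
  ... | true  = p x
  ... | false = ≤-refl

  ∣-≤ : ∀ {n} (S : Cube n → Bool) {g : Cube n → Carrier} → (∀ x → 0# ≤ g x) → ∀ x → (S ∣ g) x ≤ g x
  ∣-≤ S p x with S x
  ... | true  = ≤-refl
  ... | false = p x

  argmax : ∀ {n} (g : Cube n → Carrier) → ∃[ x ] ∀ y → g y ≤ g x
  argmax {zero}  g = [] , λ { [] → ≤-refl }
  argmax {suc n} g with argmax (g ∘ (false ∷_)) | argmax (g ∘ (true ∷_))
  ... | x , p | y , q with ≤-total (g (false ∷ x)) (g (true ∷ y))
  ...   | inj₁ r = true ∷ y  , λ { (false ∷ z) → ≤-trans (p z) r ; (true ∷ z) → q z }
  ...   | inj₂ r = false ∷ x , λ { (false ∷ z) → p z ; (true ∷ z) → ≤-trans (q z) r }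

  sg : Bool → Carrier
  sg b = if b then - 1# else 1#

  sg-xor : ∀ a b → sg (a xor b) ≡ sg a * sg b
  sg-xor false b     = sym (*-identityˡ _)
  sg-xor true  false = sym (solve 0 ((:- con (ℤ.+ 1)) :* con (ℤ.+ 1) := :- con (ℤ.+ 1)) refl)
  sg-xor true  true  = sym (solve 0 ((:- con (ℤ.+ 1)) :* (:- con (ℤ.+ 1)) := con (ℤ.+ 1)) refl)

  sg-not : ∀ a → sg (not a) ≡ - sg a
  sg-not false = refl
  sg-not true  = solve 0 (con (ℤ.+ 1) := :- (:- con (ℤ.+ 1))) refl

  sg² : ∀ a → sg a * sg a ≡ 1#
  sg² false = *-identityˡ _
  sg² true  = solve 0 ((:- con (ℤ.+ 1)) :* (:- con (ℤ.+ 1)) := con (ℤ.+ 1)) refl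

  ∣sg*x∣ : ∀ b x {M} → ∣ x ∣ ≤ M → ∣ sg b * x ∣ ≤ M
  ∣sg*x∣ false x {M} p = subst (λ z → ∣ z ∣ ≤ M) (sym (*-identityˡ x)) p
  ∣sg*x∣ true  x {M} p = ∣x∣≤ (subst (_≤ M) (solve 1 (λ x → :- x := (:- con (ℤ.+ 1)) :* x) refl x) (-∣_∣≤ p))
    (subst (_≤ M) (solve 1 (λ x → x := :- ((:- con (ℤ.+ 1)) :* x)) refl x) (≤-trans (x≤∣x∣ x) p))

  χ : ∀ {n} → Cube n → Cube n → Carrier
  χ a x = sg ⟨ a , x ⟩

isZero : ∀ {n} → Cube n → Bool
isZero []      = true
isZero (b ∷ x) = not b ∧ isZero x

isZero⇒≡𝟎 : ∀ {n} (x : Cube n) → isZero x ≡ true → x ≡ 𝟎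
isZero⇒≡𝟎 []          e = refl
isZero⇒≡𝟎 (false ∷ x) e = cong (false ∷_) (isZero⇒≡𝟎 x e)

isZero-𝟎 : ∀ n → isZero (𝟎 {n}) ≡ true
isZero-𝟎 zero    = refl
isZero-𝟎 (suc n) = isZero-𝟎 n

point : ∀ {n} → Cube n → Cube n → Bool
point x y = isZero (y ⊕ x)

point-self : ∀ {n} (x : Cube n) → point x x ≡ true
point-self {n} x = trans (cong isZero (⊕-self x)) (isZero-𝟎 n)

point⇒≡ : ∀ {n} (x y : Cube n) → point x y ≡ true → y ≡ x
point⇒≡ x y e = begin
  y            ≡⟨ sym (⊕-cancelʳ y x) ⟩
  (y ⊕ x) ⊕ x  ≡⟨ cong (_⊕ x) (isZero⇒≡𝟎 (y ⊕ x) e) ⟩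
  𝟎 ⊕ x        ≡⟨ ⊕-comm 𝟎 x ⟩
  x ⊕ 𝟎        ≡⟨ ⊕-identityʳ x ⟩
  x            ∎
  where open ≡-Reasoning

point-≢ : ∀ {n} (x y : Cube n) → y ≢ x → point x y ≡ false
point-≢ x y y≢x with point x y in e
... | true  = ⊥-elim (y≢x (point⇒≡ x y e))
... | false = refl

point-affine : ∀ {n} (x : Cube n) → IsAffineSubspace (point x)
point-affine {n} x = isZero , record { 0∈ = isZero-𝟎 n ; ⊕-closed = closed } , x , λ _ → refl
  where
  closed : ∀ y z → isZero y ≡ true → isZero z ≡ true → isZero (y ⊕ z) ≡ true
  closed y z p q = trans (cong isZero (trans (cong₂ _⊕_ (isZero⇒≡𝟎 y p) (isZero⇒≡𝟎 z q)) (⊕-self 𝟎))) (isZero-𝟎 n)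

everything-affine : ∀ {n} → IsAffineSubspace {n} (λ _ → true)
everything-affine = (λ _ → true) , record { 0∈ = refl ; ⊕-closed = λ _ _ _ _ → refl } , 𝟎 , λ _ → refl

kernel-affine : ∀ {n} (a : Cube n) → IsAffineSubspace (λ x → not ⟨ a , x ⟩)
kernel-affine a = (λ x → not ⟨ a , x ⟩)
  , record { 0∈ = cong not ⟨ a ,𝟎⟩ ; ⊕-closed = λ x y p q → trans (cong not (⟨,⟩-⊕ʳ a x y)) (closed ⟨ a , x ⟩ ⟨ a , y ⟩ p q) }
  , 𝟎 , λ x → cong (λ z → not ⟨ a , z ⟩) (sym (⊕-identityʳ x))
  where
  closed : ∀ b c → not b ≡ true → not c ≡ true → not (b xor c) ≡ true
  closed false false p q = refl

-- From characters to affine subspaces, and general bounds on `disc` and `D×`.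

module DiscrepancyAndDepth (ℝ : CompleteOrderedField) where
  open Sums ℝ public

  -- Splitting off a coordinate either kills one half of the subspace, which averages two
  -- characters, or folds one half onto the other by a shift, which extends each character
  -- of the smaller cube to a character of the larger one up to sign.
  linear-sum-≤ : ∀ {n} (V : Cube n → Bool) → IsLinearSubspace V → (g : Cube n → Carrier) → ∀ {M} →
    (∀ a → ∣ ∑ (λ x → χ a x * g x) ∣ ≤ M) → ∣ ∑ (V ∣ g) ∣ ≤ M
  linear-sum-≤ {zero} V lin g {M} h = subst (λ z → ∣ z ∣ ≤ M) (trans (*-identityˡ _) (sym V[]-true)) (h [])
    where
    V[]-true : (V ∣ g) [] ≡ g []
    V[]-true rewrite IsLinearSubspace.0∈ lin = refl
  linear-sum-≤ {suc n} V lin g {M} h with find (V ∘ (true ∷_))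
  ... | inj₁ (u , u∈) = subst (λ z → ∣ z ∣ ≤ M) folded (linear-sum-≤ V₀ V₀-lin g′ h′)
    where
    open IsLinearSubspace lin
    V₀ = V ∘ (false ∷_)
    V₀-lin = record { 0∈ = 0∈ ; ⊕-closed = λ x y → ⊕-closed (false ∷ x) (false ∷ y) }

    g′ : Cube n → Carrier
    g′ x = g (false ∷ x) + g (true ∷ (x ⊕ u))

    V₁≡ : ∀ x → V (true ∷ (x ⊕ u)) ≡ V₀ x
    V₁≡ x = true-iff (λ p → subst (λ z → V₀ z ≡ true) (⊕-cancelʳ x u) (⊕-closed _ _ p u∈))
                     (λ p → ⊕-closed _ _ p u∈)

    split : ∀ x → (V₀ ∣ g′) x ≡ (V ∣ g) (false ∷ x) + (V ∣ g) (true ∷ (x ⊕ u))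
    split x rewrite V₁≡ x with V₀ x
    ... | true  = refl
    ... | false = sym (+-identityˡ 0#)

    folded : ∑ (V₀ ∣ g′) ≡ ∑ (V ∣ g)
    folded = trans (∑-cong split) (trans (∑-+ {n} _ _) (cong (∑ ((V ∣ g) ∘ (false ∷_)) +_) (∑-shift u ((V ∣ g) ∘ (true ∷_)))))

    h′ : ∀ a → ∣ ∑ (λ x → χ a x * g′ x) ∣ ≤ M
    -- The first coordinate `⟨ a , u ⟩` makes the extended character equal to one at `true ∷ u`, so
    -- it takes equal values on the two points that are folded together.
    h′ a = subst (λ z → ∣ z ∣ ≤ M) eq (h (⟨ a , u ⟩ ∷ a))
      where
      sign : ∀ x → χ (⟨ a , u ⟩ ∷ a) (true ∷ (x ⊕ u)) ≡ χ a x
      sign x = cong sg (trans (cong₂ _xor_ (Boolₚ.∧-identityʳ ⟨ a , u ⟩) (⟨,⟩-⊕ʳ a x u)) (cancel ⟨ a , u ⟩ ⟨ a , x ⟩))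
        where
        cancel : ∀ b c → b xor (c xor b) ≡ c
        cancel false c     = Boolₚ.xor-identityʳ c
        cancel true  false = refl
        cancel true  true  = refl
      sign₀ : ∀ x → χ (⟨ a , u ⟩ ∷ a) (false ∷ x) ≡ χ a x
      sign₀ x = cong (λ z → sg (z xor ⟨ a , x ⟩)) (Boolₚ.∧-zeroʳ ⟨ a , u ⟩)
      eq : ∑ (λ x → χ (⟨ a , u ⟩ ∷ a) x * g x) ≡ ∑ (λ x → χ a x * g′ x)
      eq = begin
        ∑ (λ x → χ (⟨ a , u ⟩ ∷ a) x * g x)
          ≡⟨ cong (∑ (λ x → χ (⟨ a , u ⟩ ∷ a) (false ∷ x) * g (false ∷ x)) +_) (sym (∑-shift u _)) ⟩
        ∑ (λ x → χ (⟨ a , u ⟩ ∷ a) (false ∷ x) * g (false ∷ x)) + ∑ (λ x → χ (⟨ a , u ⟩ ∷ a) (true ∷ (x ⊕ u)) * g (true ∷ (x ⊕ u)))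
          ≡⟨ sym (∑-+ {n} _ _) ⟩
        ∑ (λ x → χ (⟨ a , u ⟩ ∷ a) (false ∷ x) * g (false ∷ x) + χ (⟨ a , u ⟩ ∷ a) (true ∷ (x ⊕ u)) * g (true ∷ (x ⊕ u)))
          ≡⟨ ∑-cong (λ x → trans (cong₂ (λ s t → s * _ + t * _) (sign₀ x) (sign x)) (sym (distribˡ _ _ _))) ⟩
        ∑ (λ x → χ a x * g′ x) ∎
        where open ≡-Reasoning
  ... | inj₂ empty = subst (λ z → ∣ z ∣ ≤ M) (sym half) (linear-sum-≤ V₀ V₀-lin (g ∘ (false ∷_)) h′)
    where
    open IsLinearSubspace lin
    V₀ = V ∘ (false ∷_)
    V₀-lin = record { 0∈ = 0∈ ; ⊕-closed = λ x y → ⊕-closed (false ∷ x) (false ∷ y) }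

    vanish : ∀ x → (V ∣ g) (true ∷ x) ≡ 0#
    vanish x rewrite empty x = refl

    half : ∑ (V ∣ g) ≡ ∑ (V₀ ∣ (g ∘ (false ∷_)))
    half = trans (cong (∑ ((V ∣ g) ∘ (false ∷_)) +_) (∑-0 vanish)) (+-identityʳ _)

    h′ : ∀ a → ∣ ∑ (λ x → χ a x * g (false ∷ x)) ∣ ≤ M
    h′ a = ∣x∣≤
      (fromℕ-suc-cancelˡ-≤ 1 (subst (_≤ fromℕ 2 * M) plus (bound (x≤∣x∣ _) (x≤∣x∣ _))))
      (fromℕ-suc-cancelˡ-≤ 1 (subst (_≤ fromℕ 2 * M) minus (bound (-x≤∣x∣ _) (-x≤∣x∣ _))))
      where
      P N : Carrier
      P = ∑ (λ x → χ a x * g (false ∷ x))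
      N = ∑ (λ x → χ a x * g (true ∷ x))
      Q₀ Q₁ : Carrier
      Q₀ = ∑ (λ x → χ (false ∷ a) x * g x)
      Q₁ = ∑ (λ x → χ (true ∷ a) x * g x)
      Q₁≡ : Q₁ ≡ P - N
      Q₁≡ = cong (P +_) (trans (∑-cong (λ x → trans (cong (_* g (true ∷ x)) (sg-not ⟨ a , x ⟩))
        (solve 2 (λ s t → (:- s) :* t := :- (s :* t)) refl (χ a x) (g (true ∷ x))))) (∑-neg {n} _))
      bound : ∀ {p q} → p ≤ ∣ Q₀ ∣ → q ≤ ∣ Q₁ ∣ → p + q ≤ fromℕ 2 * M
      bound p q = subst (_ ≤_) (solve 1 (λ m → m :+ m := con (ℤ.+ 2) :* m) refl M)
        (+-mono-≤ (≤-trans p (h (false ∷ a))) (≤-trans q (h (true ∷ a))))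
      plus : Q₀ + Q₁ ≡ fromℕ 2 * P
      plus = trans (cong (Q₀ +_) Q₁≡) (solve 2 (λ p n → (p :+ n) :+ (p :- n) := con (ℤ.+ 2) :* p) refl P N)
      minus : - Q₀ + - Q₁ ≡ fromℕ 2 * - P
      minus = trans (cong (λ z → - Q₀ + - z) Q₁≡) (solve 2 (λ p n → (:- (p :+ n)) :+ (:- (p :- n)) := con (ℤ.+ 2) :* (:- p)) refl P N)

  -- Translating `g` by `a` multiplies its sum against `χ b` by the sign `χ b a`. The bound on all
  -- character sums therefore survives, and the linear case applies.
  affine-sum-≤ : ∀ {n} (S : Cube n → Bool) → IsAffineSubspace S → (g : Cube n → Carrier) → ∀ {M} →
    (∀ a → ∣ ∑ (λ x → χ a x * g x) ∣ ≤ M) → ∣ ∑ (S ∣ g) ∣ ≤ M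
  affine-sum-≤ {n} S (V , lin , a , S≡) g {M} h = subst (λ z → ∣ z ∣ ≤ M) shifted
    (linear-sum-≤ V lin (λ x → g (x ⊕ a)) λ b → subst (λ z → ∣ z ∣ ≤ M) (twist b)
      (∣sg*x∣ ⟨ b , a ⟩ _ (h b)))
    where
    shifted : ∑ (V ∣ (λ x → g (x ⊕ a))) ≡ ∑ (S ∣ g)
    shifted = trans (∑-cong (λ x → cong (λ s → if s then g (x ⊕ a) else 0#)
      (sym (trans (S≡ (x ⊕ a)) (cong V (⊕-cancelʳ x a)))))) (∑-shift a (S ∣ g))
    twist : ∀ b → sg ⟨ b , a ⟩ * ∑ (λ x → χ b x * g x) ≡ ∑ (λ x → χ b x * g (x ⊕ a))
    twist b = begin
      sg ⟨ b , a ⟩ * ∑ (λ x → χ b x * g x)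
        ≡⟨ cong (sg ⟨ b , a ⟩ *_) (sym (∑-shift a _)) ⟩
      sg ⟨ b , a ⟩ * ∑ (λ x → χ b (x ⊕ a) * g (x ⊕ a))
        ≡⟨ sym (∑-*ˡ {n} _ _) ⟩
      ∑ (λ x → sg ⟨ b , a ⟩ * (χ b (x ⊕ a) * g (x ⊕ a)))
        ≡⟨ ∑-cong (λ x → trans (cong (λ s → sg ⟨ b , a ⟩ * (s * g (x ⊕ a))) (trans (cong sg (⟨,⟩-⊕ʳ b x a)) (sg-xor ⟨ b , x ⟩ ⟨ b , a ⟩)))
             (trans (solve 3 (λ s t u → s :* ((t :* s) :* u) := (s :* s) :* (t :* u)) refl (sg ⟨ b , a ⟩) (χ b x) (g (x ⊕ a)))
               (trans (cong (_* (χ b x * g (x ⊕ a))) (sg² ⟨ b , a ⟩)) (*-identityˡ _)))) ⟩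
      ∑ (λ x → χ b x * g (x ⊕ a)) ∎
      where open ≡-Reasoning

  signed : ∀ {n} → (Cube n → Bool) → Distribution n → Cube n → Carrier
  signed f μ x = sg (f x) * mass μ x

  ∣∑∣≤ : ∀ {n} {g h : Cube n → Carrier} → (∀ x → g x ≤ h x) → (∀ x → - g x ≤ h x) → ∣ ∑ g ∣ ≤ ∑ h
  ∣∑∣≤ {g = g} p q = ∣x∣≤ (∑-mono p) (subst (_≤ _) (∑-neg g) (∑-mono q))

  -x≤x : ∀ {x} → 0# ≤ x → - x ≤ x
  -x≤x {x} p = ≤-by (x + x) (0≤+ p p) (solve 1 (λ x → x := (:- x) :+ (x :+ x)) refl x)

  bias≤1 : ∀ {n} (f : Cube n → Bool) (μ : Distribution n) S → bias f μ S ≤ 1#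
  bias≤1 f μ S = subst (bias f μ S ≤_) (total μ) (∣∑∣≤ upper lower)
    where
    upper : ∀ x → (S ∣ signed f μ) x ≤ mass μ x
    upper x with S x | f x
    ... | false | _     = nonNeg μ x
    ... | true  | false = ≤-reflexive (*-identityˡ _)
    ... | true  | true  = subst (_≤ mass μ x) (solve 1 (λ x → :- x := (:- con (ℤ.+ 1)) :* x) refl (mass μ x)) (-x≤x (nonNeg μ x))
    lower : ∀ x → - (S ∣ signed f μ) x ≤ mass μ x
    lower x with S x | f x
    ... | false | _     = subst (_≤ mass μ x) (solve 0 (con (ℤ.+ 0) := :- con (ℤ.+ 0)) refl) (nonNeg μ x)
    ... | true  | false = subst (_≤ mass μ x) (cong -_ (sym (*-identityˡ _))) (-x≤x (nonNeg μ x))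
    ... | true  | true  = ≤-reflexive (solve 1 (λ x → :- ((:- con (ℤ.+ 1)) :* x) := x) refl (mass μ x))

  module _ {n} (f : Cube n → Bool) (μ : Distribution n) where

    bias≤maxBias : ∀ S → IsAffineSubspace S → bias f μ S ≤ maxBias f μ
    bias≤maxBias S aff = sup-upper _ (_ , S , aff , refl) (1# , λ { _ (T , _ , refl) → bias≤1 f μ T }) _ (S , aff , refl)

    maxBias≤ : ∀ {M} → (∀ S → IsAffineSubspace S → bias f μ S ≤ M) → maxBias f μ ≤ M
    maxBias≤ {M} h = sup-least _ (_ , _ , everything-affine , refl) (M , ub) M ub
      where
      ub : IsUpperBound (λ b → ∃[ S ] IsAffineSubspace S × b ≡ bias f μ S) M
      ub _ (S , aff , refl) = h S aff

    maxBias≤1 : maxBias f μ ≤ 1#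
    maxBias≤1 = maxBias≤ (λ S _ → bias≤1 f μ S)

    0≤maxBias : 0# ≤ maxBias f μ
    0≤maxBias = ≤-trans (0≤∣x∣ _) (bias≤maxBias _ everything-affine)

    mass≤maxBias : ∀ x → mass μ x ≤ maxBias f μ
    mass≤maxBias x = ≤-trans (subst (mass μ x ≤_) (cong ∣_∣ (sym only)) mass≤) (bias≤maxBias _ (point-affine x))
      where
      only : ∑ (point x ∣ signed f μ) ≡ signed f μ x
      only = trans (∑-singleton x (point x ∣ signed f μ) (λ y y≢x → cong (λ s → if s then signed f μ y else 0#) (point-≢ x y y≢x)))
        (cong (λ s → if s then signed f μ x else 0#) (point-self x))
      mass≤ : mass μ x ≤ ∣ signed f μ x ∣
      mass≤ with f x
      ... | false = ≤-trans (≤-reflexive (sym (*-identityˡ _))) (x≤∣x∣ _)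
      ... | true  = ≤-trans (≤-reflexive (solve 1 (λ x → x := :- ((:- con (ℤ.+ 1)) :* x)) refl (mass μ x))) (-x≤∣x∣ _)

    -- A single point is an affine subspace, so no mass exceeds `maxBias`, and summing the masses
    -- gives the claim. It keeps the argument of `log₂` positive and yields the bound `n` on `disc`.
    1≤maxBias*2^n : 2^ 0 ≤ maxBias f μ * 2^ n
    1≤maxBias*2^n = subst₂ _≤_ (total μ) (trans (∑-const {n} (maxBias f μ)) (*-comm _ _)) (∑-mono mass≤maxBias)

    discUnder≤ : ∀ k → 1# ≤ maxBias f μ * 2^ k → discUnder f μ ≤ fromℕ k
    discUnder≤ k p = subst (discUnder f μ ≤_) (solve 1 (λ k → :- (con (ℤ.+ 0) :- k) := k) refl (fromℕ k))
      (neg-mono-≤ (log₂-≥ 0 0 0 k 0≤maxBias p (≤-trans (≤-reflexive (solve 1 (λ x → x :* con (ℤ.+ 1) := x) refl _)) maxBias≤1)))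

    ≤discUnder : ∀ m → maxBias f μ * 2^ m ≤ 1# → fromℕ m ≤ discUnder f μ
    ≤discUnder m p = subst (_≤ discUnder f μ) (solve 1 (λ k → :- (con (ℤ.+ 0) :- k) := k) refl (fromℕ m))
      (neg-mono-≤ (log₂-≤ m 0 0 n 0≤maxBias 1≤maxBias*2^n p))

    0≤discUnder : 0# ≤ discUnder f μ
    0≤discUnder = ≤discUnder 0 (≤-trans (≤-reflexive (solve 1 (λ x → x :* con (ℤ.+ 1) := x) refl _)) maxBias≤1)

  ½ : Carrier
  ½ = fromℕ 2 ⁻¹

  2*½ : fromℕ 2 * ½ ≡ 1#
  2*½ = n*n⁻¹≡1 1

  0≤½ : 0# ≤ ½
  0≤½ = 0≤n⁻¹ 1

  2*½x : ∀ x → fromℕ 2 * (½ * x) ≡ x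
  2*½x x = trans (sym (*-assoc _ _ _)) (trans (cong (_* x) 2*½) (*-identityˡ x))

  ½+½ : ½ + ½ ≡ 1#
  ½+½ = trans (solve 1 (λ h → h :+ h := con (ℤ.+ 2) :* h) refl ½) 2*½

  1-½ : 1# - ½ ≡ ½
  1-½ = trans (cong (_- ½) (sym ½+½)) (solve 1 (λ h → (h :+ h) :- h := h) refl ½)

  2^*½^ : ∀ n → 2^ n * ½ ^ n ≡ 1#
  2^*½^ zero    = *-identityˡ 1#
  2^*½^ (suc n) = trans (solve 4 (λ t p h q → (t :* p) :* (h :* q) := (t :* h) :* (p :* q)) refl (fromℕ 2) (2^ n) ½ (½ ^ n))
    (trans (cong₂ _*_ 2*½ (2^*½^ n)) (*-identityˡ 1#))

  uniform : ∀ n → Distribution n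
  uniform n = record { mass = λ _ → ½ ^ n ; nonNeg = λ _ → 0≤x^n 0≤½ n ; total = trans (∑-const {n} _) (2^*½^ n) }

  uniform-product : ∀ n → IsProduct (uniform n)
  uniform-product n = (λ _ → ½) , (λ _ → 0≤½ , ≤-by ½ 0≤½ (sym ½+½)) , factors n
    where
    factors : ∀ n (x : Cube n) → ½ ^ n ≡ product (λ i → if lookup x i then ½ else 1# - ½)
    factors zero    []          = refl
    factors (suc n) (false ∷ x) = cong₂ _*_ (sym 1-½) (factors n x)
    factors (suc n) (true ∷ x)  = cong (½ *_) (factors n x)

  module _ {n} (f : Cube n → Bool) where

    private
      Disc : Carrier → Set
      Disc d = Σ (Distribution n) λ μ → d ≡ discUnder f μ

      disc-bounded : IsUpperBound Disc (fromℕ n)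
      disc-bounded _ (μ , refl) = discUnder≤ f μ n (1≤maxBias*2^n f μ)

    disc≤n : disc f ≤ fromℕ n
    disc≤n = sup-least Disc (_ , uniform n , refl) (_ , disc-bounded) _ disc-bounded

    disc≤ : ∀ k → (∀ μ → 1# ≤ maxBias f μ * 2^ k) → disc f ≤ fromℕ k
    disc≤ k h = sup-least Disc (_ , uniform n , refl) (_ , disc-bounded) _ λ { _ (μ , refl) → discUnder≤ f μ k (h μ) }

    discUnder≤disc : ∀ μ → discUnder f μ ≤ disc f
    discUnder≤disc μ = sup-upper Disc (_ , μ , refl) (_ , disc-bounded) _ (μ , refl)

    0≤disc : 0# ≤ disc f
    0≤disc = ≤-trans (0≤discUnder f (uniform n)) (discUnder≤disc (uniform n))

    module _ {ε} (0≤ε : 0# ≤ ε) (μ : Distribution n) where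
      private
        Depths : Carrier → Set
        Depths d = Σ (ParityTree n) λ T → Pr μ (λ x → eval T x xor f x) ≤ ε × d ≡ fromℕ (depth T)

        neg-bounded : IsUpperBound (Depths ∘ -_) 0#
        neg-bounded y (T , _ , e) = ≤-by (- y) (subst (0# ≤_) (sym e) (0≤fromℕ (depth T)))
          (solve 1 (λ y → con (ℤ.+ 0) := y :+ (:- y)) refl y)

        neg-neg : ∀ x → - (- x) ≡ x
        neg-neg x = solve 1 (λ x → :- (:- x) := x) refl x

        exact : ∃ λ T → depth T ℕ.≤ n × Pr μ (λ x → eval T x xor f x) ≤ ε
        exact with fullTree f
        ... | T , d , e = T , d , ≤-trans (≤-reflexive (∑-0 λ x → cong (λ b → if b then mass μ x else 0#)
              (trans (cong (_xor f x) (e x)) (Boolₚ.xor-same (f x))))) 0≤ε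

        nonempty : ∃ (Depths ∘ -_)
        nonempty = - fromℕ (depth (proj₁ exact)) , proj₁ exact , proj₂ (proj₂ exact) , neg-neg _

      D≤depth : ∀ T → Pr μ (λ x → eval T x xor f x) ≤ ε → D ε f μ ≤ fromℕ (depth T)
      D≤depth T p = subst (D ε f μ ≤_) (neg-neg _)
        (neg-mono-≤ (sup-upper (Depths ∘ -_) nonempty (_ , neg-bounded) (- fromℕ (depth T)) (T , p , neg-neg _)))

      ≤D : ∀ {c} → (∀ T → Pr μ (λ x → eval T x xor f x) ≤ ε → c ≤ fromℕ (depth T)) → c ≤ D ε f μ
      ≤D {c} h = subst (_≤ D ε f μ) (neg-neg c) (neg-mono-≤ (sup-least (Depths ∘ -_) nonempty (_ , neg-bounded) (- c)
        λ { y (T , p , e) → subst (_≤ - c) (neg-neg y) (neg-mono-≤ (subst (c ≤_) (sym e) (h T p))) }))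

      0≤D : 0# ≤ D ε f μ
      0≤D = ≤D (λ T _ → 0≤fromℕ (depth T))

      D≤n : D ε f μ ≤ fromℕ n
      D≤n = ≤-trans (D≤depth (proj₁ exact) (proj₂ (proj₂ exact))) (fromℕ-mono-≤ (proj₁ (proj₂ exact)))

    private
      0≤⅓ : 0# ≤ fromℕ 3 ⁻¹
      0≤⅓ = 0≤n⁻¹ 2

      D×-set : Carrier → Set
      D×-set d = Σ (Distribution n) λ μ → IsProduct μ × d ≡ D (fromℕ 3 ⁻¹) f μ

      D×-bounded : IsUpperBound D×-set (fromℕ n)
      D×-bounded _ (μ , _ , refl) = D≤n 0≤⅓ μ

    D×≤ : ∀ {c} → (∀ μ → IsProduct μ → D (fromℕ 3 ⁻¹) f μ ≤ c) → D× f ≤ c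
    D×≤ h = sup-least D×-set (_ , uniform n , uniform-product n , refl) (_ , D×-bounded) _ λ { _ (μ , ip , refl) → h μ ip }

    ≤D× : ∀ μ → IsProduct μ → D (fromℕ 3 ⁻¹) f μ ≤ D× f
    ≤D× μ ip = sup-upper D×-set (_ , uniform n , uniform-product n , refl) (_ , D×-bounded) _ (μ , ip , refl)

    D×≤n : D× f ≤ fromℕ n
    D×≤n = D×≤ λ μ _ → D≤n 0≤⅓ μ

    0≤D× : 0# ≤ D× f
    0≤D× = ≤-trans (0≤D 0≤⅓ (uniform n)) (≤D× (uniform n) (uniform-product n))

-- Second family: the inner product guarded by a repetition test.

agree : Bool → Bool → Bool → Bool → Bool
agree p q p′ q′ = not (p xor p′) ∧ not (q xor q′)

agree⇒≡ : ∀ p q p′ q′ → agree p q p′ q′ ≡ true → p′ ≡ p × q′ ≡ q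
agree⇒≡ false false false false e = refl , refl
agree⇒≡ false true  false true  e = refl , refl
agree⇒≡ true  false true  false e = refl , refl
agree⇒≡ true  true  true  true  e = refl , refl

-- The second clause is reached with fewer than four bits left, which must vanish.
isRepeated : ∀ {n} → Cube n → Bool
isRepeated (p ∷ q ∷ p′ ∷ q′ ∷ x) = agree p q p′ q′ ∧ isRepeated x
isRepeated x                     = isZero x

-- The two copies are interleaved in blocks of four bits, so that one recursion step removes a
-- product term together with both occurrences of its factors.
innerProduct : ∀ {n} → Cube n → Bool
innerProduct (p ∷ q ∷ p′ ∷ q′ ∷ x) = (p ∧ q) xor innerProduct x
innerProduct x                     = false

repeatedIP : ∀ n → Cube n → Bool
repeatedIP n x = isRepeated x ∧ innerProduct x

quarter : ℕ → ℕ
quarter (suc (suc (suc (suc n)))) = suc (quarter n)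
quarter _                         = 0

n≤4*quarter+3 : ∀ n → n ℕ.≤ quarter n ℕ.* 4 ℕ.+ 3
n≤4*quarter+3 0 = z≤n
n≤4*quarter+3 1 = s≤s z≤n
n≤4*quarter+3 2 = s≤s (s≤s z≤n)
n≤4*quarter+3 3 = s≤s (s≤s (s≤s z≤n))
n≤4*quarter+3 (suc (suc (suc (suc n)))) = s≤s (s≤s (s≤s (s≤s (n≤4*quarter+3 n))))

module RepeatedInnerProduct (ℝ : CompleteOrderedField) where
  open DiscrepancyAndDepth ℝ public

  bern : Carrier → Bool → Carrier
  bern c b = if b then c else 1# - c

  Σ₂ : (Bool → Carrier) → Carrier
  Σ₂ φ = φ false + φ true

  Σ₂-cong : ∀ {φ ψ} → (∀ b → φ b ≡ ψ b) → Σ₂ φ ≡ Σ₂ ψ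
  Σ₂-cong e = cong₂ _+_ (e false) (e true)

  -- Four of the sixteen values of the leading block pass `agree`, and on them the summand factors.
  -- The same recursion serves for normalising `copy` and for its character sums.
  ∑-repeated : ∀ {n} (g : Cube (4 ℕ.+ n) → Carrier) (k : Bool → Bool → Carrier) (h : Cube n → Carrier) →
    (∀ p q p′ q′ x → g (p ∷ q ∷ p′ ∷ q′ ∷ x) ≡ (if agree p q p′ q′ then k p q * h x else 0#)) →
    ∑ g ≡ (k false false + k false true + k true false + k true true) * ∑ h
  ∑-repeated {n} g k h e = trans
    (Σ₂-cong λ p → Σ₂-cong λ q → Σ₂-cong λ p′ → Σ₂-cong λ q′ → trans (∑-cong (e p q p′ q′)) (pull (agree p q p′ q′) (k p q)))
    (solve 5 (λ a b c d s → let O = con (ℤ.+ 0) in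
        (((a :* s :+ O) :+ (O :+ O)) :+ ((O :+ b :* s) :+ (O :+ O)))
          :+ (((O :+ O) :+ (c :* s :+ O)) :+ ((O :+ O) :+ (O :+ d :* s)))
        := (a :+ b :+ c :+ d) :* s)
      refl (k false false) (k false true) (k true false) (k true true) (∑ h))
    where
    pull : ∀ b c → ∑ (λ x → if b then c * h x else 0#) ≡ (if b then c * ∑ h else 0#)
    pull true  c = ∑-*ˡ c h
    pull false c = ∑-0 {n} (λ _ → refl)

  -- The first argument selects the copy, the second the bit within the pair.
  pos : ∀ {n} → Bool → Bool → Fin (4 ℕ.+ n)
  pos false false = Fin.zero
  pos false true  = Fin.suc Fin.zero
  pos true  false = Fin.suc (Fin.suc Fin.zero)
  pos true  true  = Fin.suc (Fin.suc (Fin.suc Fin.zero))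

  shift : ∀ {n} → (Fin (4 ℕ.+ n) → Carrier) → Fin n → Carrier
  shift c = c ∘ Fin.suc ∘ Fin.suc ∘ Fin.suc ∘ Fin.suc

  -- The law of one of the two copies (the first for s = false), carried by the repeated points.
  copy : ∀ {n} → Bool → (Fin n → Carrier) → Cube n → Carrier
  copy s c (p ∷ q ∷ p′ ∷ q′ ∷ x) =
    if agree p q p′ q′ then bern (c (pos s false)) p * bern (c (pos s true)) q * copy s (shift c) x else 0#
  copy s c x = if isZero x then 1# else 0#

  ∑-copy : ∀ {n} s (c : Fin n → Carrier) → ∑ (copy s c) ≡ 1#
  ∑-copy {0} s c = refl
  ∑-copy {1} s c = solve 0 (con (ℤ.+ 1) :+ con (ℤ.+ 0) := con (ℤ.+ 1)) refl
  ∑-copy {2} s c = solve 0 ((con (ℤ.+ 1) :+ con (ℤ.+ 0)) :+ (con (ℤ.+ 0) :+ con (ℤ.+ 0)) := con (ℤ.+ 1)) refl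
  ∑-copy {3} s c = solve 0 (((con (ℤ.+ 1) :+ con (ℤ.+ 0)) :+ (con (ℤ.+ 0) :+ con (ℤ.+ 0))) :+
    ((con (ℤ.+ 0) :+ con (ℤ.+ 0)) :+ (con (ℤ.+ 0) :+ con (ℤ.+ 0))) := con (ℤ.+ 1)) refl
  ∑-copy {suc (suc (suc (suc n)))} s c = trans
    (∑-repeated (copy s c) k (copy s (shift c)) (λ _ _ _ _ _ → refl))
    (trans (cong ((k false false + k false true + k true false + k true true) *_) (∑-copy s (shift c)))
      (solve 2 (λ a b → ((con (ℤ.+ 1) :- a) :* (con (ℤ.+ 1) :- b) :+ (con (ℤ.+ 1) :- a) :* b :+ a :* (con (ℤ.+ 1) :- b) :+ a :* b) :* con (ℤ.+ 1) := con (ℤ.+ 1))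
        refl (c (pos s false)) (c (pos s true))))
    where
    k : Bool → Bool → Carrier
    k p q = bern (c (pos s false)) p * bern (c (pos s true)) q

  indicator-nonNeg : ∀ b → 0# ≤ (if b then 1# else 0#)
  indicator-nonNeg true  = 0≤1
  indicator-nonNeg false = ≤-refl

  Probabilities : ∀ {n} → (Fin n → Carrier) → Set
  Probabilities c = ∀ i → 0# ≤ c i × c i ≤ 1#

  bern-nonNeg : ∀ {c} → 0# ≤ c × c ≤ 1# → ∀ b → 0# ≤ bern c b
  bern-nonNeg (p , q) true  = p
  bern-nonNeg (p , q) false = x≤y⇒0≤y-x q

  bern-≤1 : ∀ {c} → 0# ≤ c × c ≤ 1# → ∀ b → bern c b ≤ 1#
  bern-≤1 (p , q) true = q
  bern-≤1 {c} (p , q) false = ≤-by c p (solve 1 (λ c → con (ℤ.+ 1) := (con (ℤ.+ 1) :- c) :+ c) refl c)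

  copy-nonNeg : ∀ {n} s {c : Fin n → Carrier} → Probabilities c → ∀ x → 0# ≤ copy s c x
  copy-nonNeg s pr []                  = 0≤1
  copy-nonNeg s pr x@(_ ∷ [])          = indicator-nonNeg (isZero x)
  copy-nonNeg s pr x@(_ ∷ _ ∷ [])      = indicator-nonNeg (isZero x)
  copy-nonNeg s pr x@(_ ∷ _ ∷ _ ∷ [])  = indicator-nonNeg (isZero x)
  copy-nonNeg s pr (p ∷ q ∷ p′ ∷ q′ ∷ x) with agree p q p′ q′
  ... | true  = *-nonNeg (*-nonNeg (bern-nonNeg (pr _) p) (bern-nonNeg (pr _) q)) (copy-nonNeg s (pr ∘ _) x)
  ... | false = ≤-refl

  copy-off-repeated : ∀ {n} s (c : Fin n → Carrier) x → isRepeated x ≡ false → copy s c x ≡ 0#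
  copy-off-repeated s c x@(_ ∷ [])         e rewrite e = refl
  copy-off-repeated s c x@(_ ∷ _ ∷ [])     e rewrite e = refl
  copy-off-repeated s c x@(_ ∷ _ ∷ _ ∷ []) e rewrite e = refl
  copy-off-repeated s c (p ∷ q ∷ p′ ∷ q′ ∷ x) e with agree p q p′ q′
  ... | true  = trans (cong (bern (c (pos s false)) p * bern (c (pos s true)) q *_) (copy-off-repeated s (shift c) x e)) (zeroʳ _)
  ... | false = refl

  productMass : ∀ {n} → (Fin n → Carrier) → Cube n → Carrier
  productMass c x = product (λ i → bern (c i) (lookup x i))

  productMass-bounds : ∀ {n} {c : Fin n → Carrier} → Probabilities c → ∀ x → 0# ≤ productMass c x × productMass c x ≤ 1#
  productMass-bounds pr []      = 0≤1 , ≤-refl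
  productMass-bounds {suc n} {c} pr (b ∷ x) with productMass-bounds (pr ∘ Fin.suc) x
  ... | p , q = *-nonNeg (bern-nonNeg (pr _) b) p
              , subst (productMass c (b ∷ x) ≤_) (*-identityˡ 1#) (*-mono-≤ (bern-nonNeg (pr _) b) 0≤1 (bern-≤1 (pr _) b) q)

  -- By independence of the coordinates the mass of a repeated block is exactly the product of the
  -- laws of its two pairs. The inequality comes from the fewer than four trailing bits, whose mass
  -- is only bounded by one.
  productMass≤copies : ∀ {n} {c : Fin n → Carrier} → Probabilities c → ∀ x →
    (isRepeated ∣ productMass c) x ≤ copy false c x * copy true c x
  productMass≤copies {n} {c} pr x = go x pr
    where
    base : ∀ {m} {c : Fin m → Carrier} → Probabilities c → ∀ x b →
      (if b then productMass c x else 0#) ≤ (if b then 1# else 0#) * (if b then 1# else 0#)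
    base {c = c} pr x true  = subst (productMass c x ≤_) (sym (*-identityˡ 1#)) (proj₂ (productMass-bounds pr x))
    base pr x false = ≤-reflexive (sym (zeroˡ _))

    go : ∀ {n} {c : Fin n → Carrier} (x : Cube n) → Probabilities c → (isRepeated ∣ productMass c) x ≤ copy false c x * copy true c x
    go x@[]                 pr = base pr x (isZero x)
    go x@(_ ∷ [])           pr = base pr x (isZero x)
    go x@(_ ∷ _ ∷ [])       pr = base pr x (isZero x)
    go x@(_ ∷ _ ∷ _ ∷ [])   pr = base pr x (isZero x)
    go {c = c} (p ∷ q ∷ p′ ∷ q′ ∷ x) pr with agree p q p′ q′ in e
    ... | false = ≤-reflexive (sym (zeroˡ _))
    ... | true with agree⇒≡ p q p′ q′ e
    ...   | refl , refl = ≤-trans (≤-reflexive regroup)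
      (≤-trans (*-monoˡ-≤ (*-nonNeg (*-nonNeg (bern-nonNeg (pr _) p) (bern-nonNeg (pr _) q)) (*-nonNeg (bern-nonNeg (pr _) p) (bern-nonNeg (pr _) q))) (go x (λ i → pr _)))
        (≤-reflexive (solve 4 (λ u v y z → (u :* v) :* (y :* z) := (u :* y) :* (v :* z)) refl u v (copy false (shift c) x) (copy true (shift c) x))))
      where
      u v : Carrier
      u = bern (c (pos false false)) p * bern (c (pos false true)) q
      v = bern (c (pos true false)) p * bern (c (pos true true)) q
      regroup : (if isRepeated x then productMass c (p ∷ q ∷ p ∷ q ∷ x) else 0#) ≡ (u * v) * (isRepeated ∣ productMass (shift c)) x
      regroup with isRepeated x
      ... | true  = solve 5 (λ a b c d e → a :* (b :* (c :* (d :* e))) := ((a :* b) :* (c :* d)) :* e) refl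
        (bern (c (pos false false)) p) (bern (c (pos false true)) q) (bern (c (pos true false)) p) (bern (c (pos true true)) q) (productMass (shift c) x)
      ... | false = sym (zeroʳ _)

  -- The coordinates of the query are chosen one at a time by the method of conditional expectations.
  half-query : ∀ {n} (z : Cube n) {h : Cube n → Carrier} → (∀ x → 0# ≤ h x) → h z ≡ 0# →
    ∃[ a ] fromℕ 2 * ∑ (λ x → if ⟨ a , x ⟩ xor ⟨ a , z ⟩ then 0# else h x) ≤ ∑ h
  half-query [] {h} nn e = [] , ≤-reflexive (trans (cong (fromℕ 2 *_) e) (trans (zeroʳ _) (sym e)))
  half-query (b ∷ z) {h} nn e with half-query z {h ∘ (b ∷_)} (nn ∘ (b ∷_)) e
  ... | a , p = α ∷ a , subst (λ s → fromℕ 2 * s ≤ ∑ h) (sym (by-slice b (λ x → if ⟨ α ∷ a , x ⟩ xor ⟨ α ∷ a , b ∷ z ⟩ then 0# else h x)))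
      (subst₂ _≤_ (sym (distribˡ _ _ _)) (sym (by-slice b h)) (+-mono-≤ (subst (λ s → fromℕ 2 * s ≤ ∑ (h ∘ (b ∷_))) (∑-cong same) p)
        (subst (λ s → fromℕ 2 * s ≤ ∑ g) (∑-cong other) (proj₂ choice))))
    where
    g : Cube _ → Carrier
    g = h ∘ (not b ∷_)

    by-slice : ∀ {n} b (h : Cube (suc n) → Carrier) → ∑ h ≡ ∑ (h ∘ (b ∷_)) + ∑ (h ∘ (not b ∷_))
    by-slice false h = refl
    by-slice true  h = +-comm _ _

    half : Bool → Carrier
    half α = ∑ (λ x → if α xor (⟨ a , x ⟩ xor ⟨ a , z ⟩) then 0# else g x)

    halves : half false + half true ≡ ∑ g
    halves = trans (sym (∑-+ (λ x → if ⟨ a , x ⟩ xor ⟨ a , z ⟩ then 0# else g x) (λ x → if not (⟨ a , x ⟩ xor ⟨ a , z ⟩) then 0# else g x))) (∑-cong λ x → either (⟨ a , x ⟩ xor ⟨ a , z ⟩) (g x))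
      where
      either : ∀ c y → (if c then 0# else y) + (if not c then 0# else y) ≡ y
      either false y = +-identityʳ y
      either true  y = +-identityˡ y

    -- Points that agree with `z` in this coordinate do not notice `α`. On the other slice the two
    -- values of `α` keep complementary parts of `g`, so one of them keeps at most half.
    choice : ∃[ α ] fromℕ 2 * half α ≤ ∑ g
    choice with ≤-total (half false) (half true)
    ... | inj₁ r = false , ≤-by (half true - half false) (x≤y⇒0≤y-x r)
      (trans (sym halves) (solve 2 (λ s t → s :+ t := con (ℤ.+ 2) :* s :+ (t :- s)) refl (half false) (half true)))
    ... | inj₂ r = true , ≤-by (half false - half true) (x≤y⇒0≤y-x r)
      (trans (sym halves) (solve 2 (λ s t → s :+ t := con (ℤ.+ 2) :* t :+ (s :- t)) refl (half false) (half true)))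

    α = proj₁ choice

    same : ∀ x → (if ⟨ a , x ⟩ xor ⟨ a , z ⟩ then 0# else h (b ∷ x)) ≡ (if ⟨ α ∷ a , b ∷ x ⟩ xor ⟨ α ∷ a , b ∷ z ⟩ then 0# else h (b ∷ x))
    same x = cong (λ c → if c then 0# else h (b ∷ x)) (lemma (α ∧ b) ⟨ a , x ⟩ ⟨ a , z ⟩)
      where
      lemma : ∀ c d e → d xor e ≡ (c xor d) xor (c xor e)
      lemma c d e = sym (trans (xor-interchange c d c e) (cong (_xor (d xor e)) (Boolₚ.xor-same c)))

    other : ∀ x → (if α xor (⟨ a , x ⟩ xor ⟨ a , z ⟩) then 0# else g x) ≡ (if ⟨ α ∷ a , not b ∷ x ⟩ xor ⟨ α ∷ a , b ∷ z ⟩ then 0# else g x)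
    other x = cong (λ c → if c then 0# else g x) (sym (trans (xor-interchange (α ∧ not b) ⟨ a , x ⟩ (α ∧ b) ⟨ a , z ⟩) (cong (_xor (⟨ a , x ⟩ xor ⟨ a , z ⟩)) (lemma α b))))
      where
      lemma : ∀ α b → (α ∧ not b) xor (α ∧ b) ≡ α
      lemma false b     = refl
      lemma true  false = refl
      lemma true  true  = refl

  -- Iterates `half-query` on the weight not yet separated from `z`, rejecting at the first answer
  -- that differs from that of `z`. No query separates `z` from itself, hence the condition
  -- `h z ≡ 0#`.
  point-test : ∀ {n} r (z : Cube n) {h : Cube n → Carrier} → (∀ x → 0# ≤ h x) → h z ≡ 0# →
    ∃[ T ] depth T ℕ.≤ r × eval T z ≡ true × 2^ r * ∑ (eval T ∣ h) ≤ ∑ h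
  point-test zero z {h} nn e = leaf true , z≤n , refl , ≤-reflexive (*-identityˡ _)
  point-test (suc r) z {h} nn e with half-query z nn e
  ... | a , p with point-test r z {λ x → if ⟨ a , x ⟩ xor ⟨ a , z ⟩ then 0# else h x} nn′ e′
    where
    nn′ : ∀ x → 0# ≤ (if ⟨ a , x ⟩ xor ⟨ a , z ⟩ then 0# else h x)
    nn′ x with ⟨ a , x ⟩ xor ⟨ a , z ⟩
    ... | true  = ≤-refl
    ... | false = nn x
    e′ : (if ⟨ a , z ⟩ xor ⟨ a , z ⟩ then 0# else h z) ≡ 0#
    e′ rewrite Boolₚ.xor-same ⟨ a , z ⟩ = e
  ...   | T , d , Tz , q = guarded ⟨ a , z ⟩ , shallow ⟨ a , z ⟩ , accepts ⟨ a , z ⟩ refl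
      , subst (_≤ ∑ h) (solve 3 (λ t p s → t :* (p :* s) := (t :* p) :* s) refl (fromℕ 2) (2^ r) _)
          (≤-trans (*-monoˡ-≤ (0≤fromℕ 2) (subst (λ s → 2^ r * s ≤ _) (∑-cong λ x → sym (restrict ⟨ a , z ⟩ x)) q)) p)
    where
    guarded : Bool → ParityTree _
    guarded false = query a T (leaf false)
    guarded true  = query a (leaf false) T

    shallow : ∀ c → depth (guarded c) ℕ.≤ suc r
    shallow false = s≤s (ℕₚ.⊔-lub d z≤n)
    shallow true  = s≤s d

    accepts : ∀ c → ⟨ a , z ⟩ ≡ c → eval (guarded c) z ≡ true
    accepts false e rewrite e = Tz
    accepts true  e rewrite e = Tz

    restrict : ∀ c x → (eval (guarded c) ∣ h) x ≡ (eval T ∣ (λ y → if ⟨ a , y ⟩ xor c then 0# else h y)) x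
    restrict false x with ⟨ a , x ⟩
    ... | false = refl
    ... | true with eval T x
    ...   | false = refl
    ...   | true  = refl
    restrict true x with ⟨ a , x ⟩
    ... | true  = refl
    ... | false with eval T x
    ...   | false = refl
    ...   | true  = refl

  away : ∀ {n} → Cube n → (Cube n → Carrier) → Cube n → Carrier
  away z = (not ∘ point z) ∣_

  ∑-away : ∀ {n} (z : Cube n) (g : Cube n → Carrier) → ∑ (away z g) ≡ ∑ g - g z
  ∑-away z g = begin
    ∑ (away z g)                    ≡⟨ solve 2 (λ s t → s := (s :+ t) :- t) refl _ (g z) ⟩
    (∑ (away z g) + g z) - g z      ≡⟨ cong (λ s → (∑ (away z g) + s) - g z) (sym only) ⟩
    (∑ (away z g) + ∑ (point z ∣ g)) - g z ≡⟨ cong (_- g z) (sym (∑-+ (away z g) (point z ∣ g))) ⟩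
    ∑ (λ x → away z g x + (point z ∣ g) x) - g z ≡⟨ cong (_- g z) (∑-cong λ x → either (point z x) (g x)) ⟩
    ∑ g - g z                       ∎
    where
    open ≡-Reasoning
    only : ∑ (point z ∣ g) ≡ g z
    only = trans (∑-singleton z (point z ∣ g) (λ y y≢z → cong (λ s → if s then g y else 0#) (point-≢ z y y≢z)))
      (cong (λ s → if s then g z else 0#) (point-self z))
    either : ∀ c y → (if not c then y else 0#) + (if c then y else 0#) ≡ y
    either false y = +-identityʳ y
    either true  y = +-identityˡ y

  away-self : ∀ {n} (z : Cube n) (g : Cube n → Carrier) → away z g z ≡ 0#
  away-self z g rewrite point-self z = refl

  -- If the two copies have laws P and Q then with R = (P + Q) / 2 the repeated point x has mass at
  -- most P x * Q x ≤ R x ², so removing the maximum s of R leaves at most s (1 - s) ≤ 1/4.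
  concentrated : ∀ {n} {c : Fin n → Carrier} → Probabilities c →
    ∃[ z ] fromℕ 4 * ∑ (away z (isRepeated ∣ productMass c)) ≤ 1#
  concentrated {n} {c} pr with argmax (λ x → ½ * (copy false c x + copy true c x))
  ... | z , max = z , ≤-trans (*-monoˡ-≤ (0≤fromℕ 4) (∑-mono pointwise)) (≤-trans (≤-reflexive total-bound)
      (≤-by ((1# - fromℕ 2 * s) * (1# - fromℕ 2 * s)) (0≤x² _)
        (solve 1 (λ s → con (ℤ.+ 1) := con (ℤ.+ 4) :* (s :* (con (ℤ.+ 1) :- s)) :+ (con (ℤ.+ 1) :- con (ℤ.+ 2) :* s) :* (con (ℤ.+ 1) :- con (ℤ.+ 2) :* s)) refl s)))
    where
    P Q R : Cube n → Carrier
    P = copy false c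
    Q = copy true c
    R x = ½ * (P x + Q x)

    s = R z

    R-nonNeg : ∀ x → 0# ≤ R x
    R-nonNeg x = *-nonNeg 0≤½ (0≤+ (copy-nonNeg false pr x) (copy-nonNeg true pr x))

    ∑R : ∑ R ≡ 1#
    ∑R = trans (∑-*ˡ ½ (λ x → P x + Q x)) (trans (cong (½ *_) (trans (∑-+ P Q) (cong₂ _+_ (∑-copy false c) (∑-copy true c))))
      (trans (solve 1 (λ h → h :* (con (ℤ.+ 1) :+ con (ℤ.+ 1)) := h :+ h) refl ½) ½+½))

    PQ≤R² : ∀ x → P x * Q x ≤ R x * R x
    PQ≤R² x = fromℕ-suc-cancelˡ-≤ 3 (≤-by ((P x - Q x) * (P x - Q x)) (0≤x² _) (begin
      fromℕ 4 * (R x * R x)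
        ≡⟨ solve 1 (λ r → con (ℤ.+ 4) :* (r :* r) := (con (ℤ.+ 2) :* r) :* (con (ℤ.+ 2) :* r)) refl (R x) ⟩
      (fromℕ 2 * R x) * (fromℕ 2 * R x)
        ≡⟨ cong₂ _*_ (2*½x _) (2*½x _) ⟩
      (P x + Q x) * (P x + Q x)
        ≡⟨ solve 2 (λ p q → (p :+ q) :* (p :+ q) := con (ℤ.+ 4) :* (p :* q) :+ (p :- q) :* (p :- q)) refl (P x) (Q x) ⟩
      fromℕ 4 * (P x * Q x) + (P x - Q x) * (P x - Q x) ∎))
      where open ≡-Reasoning

    pointwise : ∀ x → away z (isRepeated ∣ productMass c) x ≤ s * away z R x
    pointwise x with point z x
    ... | true  = ≤-reflexive (sym (zeroʳ s))
    ... | false = ≤-trans (productMass≤copies pr x) (≤-trans (PQ≤R² x)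
      (subst (R x * R x ≤_) (*-comm _ _) (*-monoˡ-≤ (R-nonNeg x) (max x))))

    total-bound : fromℕ 4 * ∑ (λ x → s * away z R x) ≡ fromℕ 4 * (s * (1# - s))
    total-bound = cong (fromℕ 4 *_) (trans (∑-*ˡ s (away z R)) (cong (s *_) (trans (∑-away z R) (cong (_- s) ∑R))))

  -- An input other than `z` on which the tree errs is either repeated, with total mass at most 1/4,
  -- or accepted by the tree, with total mass at most 1/16. Accuracy 1/8 for the test would give
  -- 3/8, above 1/3; this is why it uses four queries.
  test-accurate : ∀ {n} (μ : Distribution n) z T → eval T z ≡ repeatedIP n z →
    fromℕ 4 * ∑ (away z (isRepeated ∣ mass μ)) ≤ 1# → 2^ 4 * ∑ (eval T ∣ away z (mass μ)) ≤ 1# →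
    Pr μ (λ x → eval T x xor repeatedIP n x) ≤ fromℕ 3 ⁻¹
  test-accurate {n} μ z T Tz E-bound test = accurate
    where
    f = repeatedIP n
    m = mass μ
    h = away z m
    E Q : Carrier
    E = ∑ (away z (isRepeated ∣ m))
    Q = ∑ (eval T ∣ h)

    error : ∀ x → ((λ y → eval T y xor f y) ∣ m) x ≤ away z (isRepeated ∣ m) x + (eval T ∣ h) x
    error x with point z x in at
    ... | true rewrite point⇒≡ z x at | Tz | Boolₚ.xor-same (f z) with f z
    ...   | true  = ≤-reflexive (sym (+-identityˡ 0#))
    ...   | false = ≤-reflexive (sym (+-identityˡ 0#))
    error x | false with eval T x | isRepeated x | innerProduct x
    ... | true  | true  | true  = 0≤+ (nonNeg μ x) (nonNeg μ x)
    ... | true  | true  | false = ≤-by (m x) (nonNeg μ x) refl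
    ... | true  | false | _     = ≤-reflexive (sym (+-identityˡ _))
    ... | false | true  | true  = ≤-reflexive (sym (+-identityʳ _))
    ... | false | true  | false = ≤-by (m x) (nonNeg μ x) (solve 1 (λ m → m :+ con (ℤ.+ 0) := con (ℤ.+ 0) :+ m) refl (m x))
    ... | false | false | _     = ≤-reflexive (sym (+-identityˡ 0#))

    accurate : Pr μ (λ x → eval T x xor f x) ≤ fromℕ 3 ⁻¹
    accurate = ≤-trans (∑-mono error) (≤-trans (≤-reflexive (∑-+ (away z (isRepeated ∣ m)) (eval T ∣ h)))
      (fromℕ-suc-cancelˡ-≤ 2 (subst (fromℕ 3 * (E + Q) ≤_) (sym (n*n⁻¹≡1 2)) (fromℕ-suc-cancelˡ-≤ 3
        (≤-by (fromℕ 3 * (1# - fromℕ 4 * E) + (1# - fromℕ 4 * (fromℕ 4 * Q)) + fromℕ 4 * Q)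
          (0≤+ (0≤+ (*-nonNeg (0≤fromℕ 3) (x≤y⇒0≤y-x E-bound)) (x≤y⇒0≤y-x Q-bound)) (*-nonNeg (0≤fromℕ 4) 0≤Q))
          (solve 2 (λ e q → con (ℤ.+ 4) :* con (ℤ.+ 1) := con (ℤ.+ 4) :* (con (ℤ.+ 3) :* (e :+ q)) :+
            (con (ℤ.+ 3) :* (con (ℤ.+ 1) :- con (ℤ.+ 4) :* e) :+ (con (ℤ.+ 1) :- con (ℤ.+ 4) :* (con (ℤ.+ 4) :* q)) :+ con (ℤ.+ 4) :* q)) refl E Q))))))
      where
      0≤Q : 0# ≤ Q
      0≤Q = ∑-nonNeg (∣-nonNeg (eval T) (∣-nonNeg (not ∘ point z) (nonNeg μ)))
      Q-bound : fromℕ 4 * (fromℕ 4 * Q) ≤ 1#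
      Q-bound = subst (_≤ 1#) (solve 1 (λ q → (con (ℤ.+ 2) :* (con (ℤ.+ 2) :* (con (ℤ.+ 2) :* (con (ℤ.+ 2) :* con (ℤ.+ 1))))) :* q := con (ℤ.+ 4) :* (con (ℤ.+ 4) :* q)) refl Q)
        test

  -- Only the value at `z` has to be right: other repeated inputs are charged to the error. So the
  -- point test is used if the function is true at `z`, and the constant `false` otherwise.
  repeatedIP-tree : ∀ {n} (μ : Distribution n) z →
    ∃[ T ] depth T ℕ.≤ 4 × eval T z ≡ repeatedIP n z × 2^ 4 * ∑ (eval T ∣ away z (mass μ)) ≤ 1#
  repeatedIP-tree {n} μ z = by-value (repeatedIP n z) (point-test 4 z h-nonNeg (away-self z (mass μ)))
    where
    h = away z (mass μ)

    h-nonNeg : ∀ x → 0# ≤ h x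
    h-nonNeg = ∣-nonNeg (not ∘ point z) (nonNeg μ)

    ∑h≤1 : ∑ h ≤ 1#
    ∑h≤1 = subst (∑ h ≤_) (total μ) (∑-mono (∣-≤ (not ∘ point z) (nonNeg μ)))

    by-value : ∀ b → (∃[ T ] depth T ℕ.≤ 4 × eval T z ≡ true × 2^ 4 * ∑ (eval T ∣ h) ≤ ∑ h) →
      ∃[ T ] depth T ℕ.≤ 4 × eval T z ≡ b × 2^ 4 * ∑ (eval T ∣ h) ≤ 1#
    by-value true  (T , d , e , q) = T , d , e , ≤-trans q ∑h≤1
    by-value false _ = leaf false , z≤n , refl , ≤-trans (≤-reflexive (trans (cong (2^ 4 *_) (∑-0 {n} (λ _ → refl))) (zeroʳ _))) 0≤1

  D×-repeatedIP≤4 : ∀ n → D× (repeatedIP n) ≤ fromℕ 4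
  D×-repeatedIP≤4 n = D×≤ f shallow-tree
    where
    f = repeatedIP n

    conclude : ∀ μ {c} → (∀ x → mass μ x ≡ productMass c x) →
      ∃[ z ] (fromℕ 4 * ∑ (away z (isRepeated ∣ productMass c)) ≤ 1#) → D (fromℕ 3 ⁻¹) f μ ≤ fromℕ 4
    conclude μ mass≡ (z , conc) =
      ≤-trans (D≤depth f (0≤n⁻¹ 2) μ T (test-accurate μ z T (proj₁ (proj₂ (proj₂ tree))) conc′ (proj₂ (proj₂ (proj₂ tree)))))
        (fromℕ-mono-≤ {depth T} {4} (proj₁ (proj₂ tree)))
      where
      tree = repeatedIP-tree μ z
      T = proj₁ tree

      conc′ : fromℕ 4 * ∑ (away z (isRepeated ∣ mass μ)) ≤ 1#
      conc′ = subst (λ s → fromℕ 4 * s ≤ 1#)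
        (∑-cong λ x → cong (λ y → if not (point z x) then (if isRepeated x then y else 0#) else 0#) (sym (mass≡ x))) conc

    shallow-tree : ∀ μ → IsProduct μ → D (fromℕ 3 ⁻¹) f μ ≤ fromℕ 4
    shallow-tree μ (c , pr , mass≡) = conclude μ mass≡ (concentrated pr)

  half-copies : ∀ n → Fin n → Carrier
  half-copies n _ = ½

  repeatedUniform : ∀ n → Distribution n
  repeatedUniform n = record
    { mass   = copy false (half-copies n)
    ; nonNeg = copy-nonNeg false (proj₁ (proj₂ (uniform-product n)))
    ; total  = ∑-copy false (half-copies n)
    }

  signed-copy : ∀ {n} (c : Fin n → Carrier) x →
    sg (repeatedIP n x) * copy false c x ≡ sg (innerProduct x) * copy false c x
  signed-copy c x with isRepeated x in e
  ... | true  = refl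
  ... | false rewrite copy-off-repeated false c x e = trans (zeroʳ _) (sym (zeroʳ _))

  -- The Fourier transform of the sign of a conjunction of two bits: the left side is the sum of its
  -- four values against the character with frequencies `α` and `β`, and its modulus is always two.
  bent : ∀ α β → 1# + sg β + sg α - sg α * sg β ≡ fromℕ 2 * sg (α ∧ β)
  bent false false = solve 0 (con (ℤ.+ 1) :+ con (ℤ.+ 1) :+ con (ℤ.+ 1) :- con (ℤ.+ 1) :* con (ℤ.+ 1) := con (ℤ.+ 2) :* con (ℤ.+ 1)) refl
  bent false true  = solve 0 (con (ℤ.+ 1) :+ (:- con (ℤ.+ 1)) :+ con (ℤ.+ 1) :- con (ℤ.+ 1) :* (:- con (ℤ.+ 1)) := con (ℤ.+ 2) :* con (ℤ.+ 1)) refl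
  bent true  false = solve 0 (con (ℤ.+ 1) :+ con (ℤ.+ 1) :+ (:- con (ℤ.+ 1)) :- (:- con (ℤ.+ 1)) :* con (ℤ.+ 1) := con (ℤ.+ 2) :* con (ℤ.+ 1)) refl
  bent true  true  = solve 0 (con (ℤ.+ 1) :+ (:- con (ℤ.+ 1)) :+ (:- con (ℤ.+ 1)) :- (:- con (ℤ.+ 1)) :* (:- con (ℤ.+ 1)) := con (ℤ.+ 2) :* (:- con (ℤ.+ 1))) refl

  single-character : ∀ {n} (a : Cube n) (g : Cube n → Carrier) → (∀ x → g x ≡ (if isZero x then 1# else 0#)) →
    ∣ ∑ (λ x → χ a x * g x) ∣ ≤ 1#
  single-character {n} a g e = subst (λ s → ∣ s ∣ ≤ 1#) (sym at-zero) (≤-reflexive (0≤x⇒∣x∣≡x 0≤1))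
    where
    off-zero : ∀ x → x ≢ 𝟎 → χ a x * g x ≡ 0#
    off-zero x x≢𝟎 rewrite e x with isZero x in z
    ... | true  = ⊥-elim (x≢𝟎 (isZero⇒≡𝟎 x z))
    ... | false = zeroʳ _
    at-zero : ∑ (λ x → χ a x * g x) ≡ 1#
    at-zero = trans (∑-singleton 𝟎 _ off-zero) (trans (cong₂ (λ b y → sg b * y) ⟨ a ,𝟎⟩
      (trans (e 𝟎) (cong (λ b → if b then 1# else 0#) (isZero-𝟎 n)))) (*-identityˡ 1#))

  ∣½*sg*x∣ : ∀ b x {M} → ∣ x ∣ ≤ M → ∣ (½ * sg b) * x ∣ ≤ ½ * M
  ∣½*sg*x∣ b x {M} p = ∣x∣≤
    (subst (_≤ ½ * M) (sym (*-assoc _ _ _)) (*-monoˡ-≤ 0≤½ (≤-trans (x≤∣x∣ _) (∣sg*x∣ b x p))))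
    (subst (_≤ ½ * M) (solve 3 (λ h s x → h :* (:- (s :* x)) := :- ((h :* s) :* x)) refl ½ (sg b) x)
      (*-monoˡ-≤ 0≤½ (-∣_∣≤ (∣sg*x∣ b x p))))

  -- On a repeated block the frequencies `a`, `b`, `c`, `d` act as `a xor c` and `b xor d` on one
  -- pair. By `bent` and the weight 1/4 of each pair, every block contributes a factor of modulus
  -- 1/2, whatever the character.
  χ-repeatedIP : ∀ {n} (a : Cube n) →
    ∣ ∑ (λ x → χ a x * (sg (innerProduct x) * copy false (half-copies n) x)) ∣ ≤ ½ ^ quarter n
  χ-repeatedIP {0} a = single-character a (λ x → sg (innerProduct x) * copy false (half-copies _) x) λ { [] → *-identityˡ _ }
  χ-repeatedIP {1} a = single-character a (λ x → sg (innerProduct x) * copy false (half-copies _) x) λ { (_ ∷ []) → *-identityˡ _ }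
  χ-repeatedIP {2} a = single-character a (λ x → sg (innerProduct x) * copy false (half-copies _) x) λ { (_ ∷ _ ∷ []) → *-identityˡ _ }
  χ-repeatedIP {3} a = single-character a (λ x → sg (innerProduct x) * copy false (half-copies _) x) λ { (_ ∷ _ ∷ _ ∷ []) → *-identityˡ _ }
  χ-repeatedIP {suc (suc (suc (suc n)))} (a ∷ b ∷ c ∷ d ∷ as) = subst (λ s → ∣ s ∣ ≤ ½ * ½ ^ quarter n) (sym recursion)
    (∣½*sg*x∣ ((a xor c) ∧ (b xor d)) (∑ g) (χ-repeatedIP as))
    where
    g : Cube n → Carrier
    g x = χ as x * (sg (innerProduct x) * copy false (half-copies n) x)

    k : Bool → Bool → Carrier
    k p q = ((sg (a ∧ p) * sg (b ∧ q)) * (sg (c ∧ p) * sg (d ∧ q))) * (sg (p ∧ q) * (bern ½ p * bern ½ q))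

    G : Cube (4 ℕ.+ n) → Carrier
    G x = χ (a ∷ b ∷ c ∷ d ∷ as) x * (sg (innerProduct x) * copy false (half-copies (4 ℕ.+ n)) x)

    block : ∀ p q p′ q′ x → G (p ∷ q ∷ p′ ∷ q′ ∷ x) ≡ (if agree p q p′ q′ then k p q * g x else 0#)
    block p q p′ q′ x with agree p q p′ q′ in e
    ... | false = trans (cong (χ (a ∷ b ∷ c ∷ d ∷ as) (p ∷ q ∷ p′ ∷ q′ ∷ x) *_) (zeroʳ _)) (zeroʳ _)
    ... | true with agree⇒≡ p q p′ q′ e
    ...   | refl , refl = trans
      (cong₂ (λ s t → s * (t * ((bern ½ p * bern ½ q) * copy false (half-copies n) x))) expand (sg-xor (p ∧ q) (innerProduct x)))
      (solve 9 (λ a b c d χ pq i w y → (a :* (b :* (c :* (d :* χ)))) :* ((pq :* i) :* (w :* y)) :=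
          (((a :* b) :* (c :* d)) :* (pq :* w)) :* (χ :* (i :* y))) refl
        (sg (a ∧ p)) (sg (b ∧ q)) (sg (c ∧ p)) (sg (d ∧ q)) (χ as x) (sg (p ∧ q)) (sg (innerProduct x))
        (bern ½ p * bern ½ q) (copy false (half-copies n) x))
      where
      expand : χ (a ∷ b ∷ c ∷ d ∷ as) (p ∷ q ∷ p ∷ q ∷ x) ≡ sg (a ∧ p) * (sg (b ∧ q) * (sg (c ∧ p) * (sg (d ∧ q) * χ as x)))
      expand = trans (sg-xor (a ∧ p) _) (cong (sg (a ∧ p) *_) (trans (sg-xor (b ∧ q) _) (cong (sg (b ∧ q) *_)
        (trans (sg-xor (c ∧ p) _) (cong (sg (c ∧ p) *_) (sg-xor (d ∧ q) _))))))

    coefficients : k false false + k false true + k true false + k true true ≡ ½ * sg ((a xor c) ∧ (b xor d))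
    coefficients rewrite Boolₚ.∧-zeroʳ a | Boolₚ.∧-zeroʳ b | Boolₚ.∧-zeroʳ c | Boolₚ.∧-zeroʳ d
      | Boolₚ.∧-identityʳ a | Boolₚ.∧-identityʳ b | Boolₚ.∧-identityʳ c | Boolₚ.∧-identityʳ d | 1-½ = begin
      _ ≡⟨ solve 5 (λ h a b c d →
             ((con (ℤ.+ 1) :* con (ℤ.+ 1)) :* (con (ℤ.+ 1) :* con (ℤ.+ 1))) :* (con (ℤ.+ 1) :* (h :* h))
             :+ ((con (ℤ.+ 1) :* b) :* (con (ℤ.+ 1) :* d)) :* (con (ℤ.+ 1) :* (h :* h))
             :+ ((a :* con (ℤ.+ 1)) :* (c :* con (ℤ.+ 1))) :* (con (ℤ.+ 1) :* (h :* h))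
             :+ ((a :* b) :* (c :* d)) :* ((:- con (ℤ.+ 1)) :* (h :* h))
             := (h :* h) :* (con (ℤ.+ 1) :+ b :* d :+ a :* c :- (a :* c) :* (b :* d)))
             refl ½ (sg a) (sg b) (sg c) (sg d) ⟩
      (½ * ½) * (1# + sg b * sg d + sg a * sg c - (sg a * sg c) * (sg b * sg d))
        ≡⟨ cong₂ (λ s t → (½ * ½) * (1# + t + s - s * t)) (sym (sg-xor a c)) (sym (sg-xor b d)) ⟩
      (½ * ½) * (1# + sg (b xor d) + sg (a xor c) - sg (a xor c) * sg (b xor d))
        ≡⟨ cong ((½ * ½) *_) (bent (a xor c) (b xor d)) ⟩
      (½ * ½) * (fromℕ 2 * sg ((a xor c) ∧ (b xor d)))
        ≡⟨ solve 2 (λ h s → (h :* h) :* (con (ℤ.+ 2) :* s) := (con (ℤ.+ 2) :* h) :* (h :* s)) refl ½ (sg ((a xor c) ∧ (b xor d))) ⟩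
      (fromℕ 2 * ½) * (½ * sg ((a xor c) ∧ (b xor d)))
        ≡⟨ trans (cong (_* (½ * sg ((a xor c) ∧ (b xor d)))) 2*½) (*-identityˡ _) ⟩
      ½ * sg ((a xor c) ∧ (b xor d)) ∎
      where open ≡-Reasoning

    recursion : ∑ G ≡ (½ * sg ((a xor c) ∧ (b xor d))) * ∑ g
    recursion = trans (∑-repeated G k g block) (cong (_* ∑ g) coefficients)

  quarter≤disc-repeatedIP : ∀ n → fromℕ (quarter n) ≤ disc (repeatedIP n)
  quarter≤disc-repeatedIP n = ≤-trans
    (≤discUnder (repeatedIP n) (repeatedUniform n) (quarter n)
      (≤-trans (subst₂ _≤_ (*-comm _ _) (*-comm _ _) (*-monoˡ-≤ (0≤2^ (quarter n)) small))
        (≤-reflexive (trans (*-comm _ _) (2^*½^ (quarter n))))))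
    (discUnder≤disc (repeatedIP n) (repeatedUniform n))
    where
    small : maxBias (repeatedIP n) (repeatedUniform n) ≤ ½ ^ quarter n
    small = maxBias≤ (repeatedIP n) (repeatedUniform n) λ S aff →
      affine-sum-≤ S aff (signed (repeatedIP n) (repeatedUniform n)) λ a →
        subst (λ s → ∣ s ∣ ≤ ½ ^ quarter n) (∑-cong λ x → cong (χ a x *_) (sym (signed-copy (half-copies n) x))) (χ-repeatedIP a)

  disc-repeatedIP=Θ : (λ n → disc (repeatedIP n)) =Θ fromℕ
  disc-repeatedIP=Θ =
      (1# , 0 , λ n _ → subst₂ _≤_ (sym (0≤x⇒∣x∣≡x (0≤disc (repeatedIP n))))
        (sym (trans (*-identityˡ _) (0≤x⇒∣x∣≡x (0≤fromℕ n)))) (disc≤n (repeatedIP n)))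
    , (fromℕ 8 ⁻¹ , 0<n⁻¹ 7 , 6 , λ n n≥6 → subst₂ _≤_ (cong (fromℕ 8 ⁻¹ *_) (sym (0≤x⇒∣x∣≡x (0≤fromℕ n))))
        (sym (0≤x⇒∣x∣≡x (0≤disc (repeatedIP n)))) (≤-trans (linear n n≥6) (quarter≤disc-repeatedIP n)))
    where
    -- Doubling the bound `n ≤ 4 q + 3` gives `2 n ≤ 8 q + 6`; for `n ≥ 6` one of the two `n`
    -- absorbs the additive term.
    n≤8*quarter : ∀ n → 6 ℕ.≤ n → n ℕ.≤ 8 ℕ.* quarter n
    n≤8*quarter n n≥6 = ℕₚ.+-cancelʳ-≤ 6 n (8 ℕ.* quarter n) (begin
      n ℕ.+ 6                              ≤⟨ ℕₚ.+-monoʳ-≤ n n≥6 ⟩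
      n ℕ.+ n                              ≤⟨ ℕₚ.+-mono-≤ (n≤4*quarter+3 n) (n≤4*quarter+3 n) ⟩
      (quarter n ℕ.* 4 ℕ.+ 3) ℕ.+ (quarter n ℕ.* 4 ℕ.+ 3) ≡⟨ regroup (quarter n) ⟩
      8 ℕ.* quarter n ℕ.+ 6                ∎)
      where
      open ℕₚ.≤-Reasoning
      regroup : ∀ q → (q ℕ.* 4 ℕ.+ 3) ℕ.+ (q ℕ.* 4 ℕ.+ 3) ≡ 8 ℕ.* q ℕ.+ 6
      regroup = NatSolver.solve-∀
    linear : ∀ n → 6 ℕ.≤ n → fromℕ 8 ⁻¹ * fromℕ n ≤ fromℕ (quarter n)
    linear n n≥6 = n⁻¹*-≤ 7 (subst (fromℕ n ≤_) (fromℕ-* 8 (quarter n)) (fromℕ-mono-≤ (n≤8*quarter n n≥6)))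

  D×-repeatedIP=O : (λ n → D× (repeatedIP n)) =O (λ _ → 1#)
  D×-repeatedIP=O = fromℕ 4 , 0 , λ n _ → subst₂ _≤_ (sym (0≤x⇒∣x∣≡x (0≤D× (repeatedIP n))))
    (sym (trans (cong (fromℕ 4 *_) (0≤x⇒∣x∣≡x 0≤1)) (solve 1 (λ x → x :* con (ℤ.+ 1) := x) refl (fromℕ 4)))) (D×-repeatedIP≤4 n)

-- First family: majority of triple majorities, and its small discrepancy.

maj : Bool → Bool → Bool → Bool
maj a b c = if a xor b then c else a

up down : ℤ → ℤ
up (ℤ.+ n)      = ℤ.+ suc n
up -[1+ zero ]  = ℤ.+ 0
up -[1+ suc n ] = -[1+ n ]
down (ℤ.+ zero)  = -[1+ 0 ]
down (ℤ.+ suc n) = ℤ.+ n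
down -[1+ n ]    = -[1+ suc n ]

up-down : ∀ t → up (down t) ≡ t
up-down (ℤ.+ zero)  = refl
up-down (ℤ.+ suc n) = refl
up-down -[1+ n ]    = refl

down-up : ∀ t → down (up t) ≡ t
down-up (ℤ.+ n)      = refl
down-up -[1+ zero ]  = refl
down-up -[1+ suc n ] = refl

step : Bool → ℤ → ℤ
step true  = down
step false = up

step-comm : ∀ a b t → step a (step b t) ≡ step b (step a t)
step-comm true  true  t = refl
step-comm true  false t = trans (down-up t) (sym (up-down t))
step-comm false true  t = trans (up-down t) (sym (down-up t))
step-comm false false t = refl

isNegative : ℤ → Bool
isNegative (ℤ.+ _)  = false
isNegative -[1+ _ ] = true

tally : ∀ {n} → ℤ → Cube n → ℤ
tally t (a ∷ b ∷ c ∷ x) = tally (step (maj a b c) t) x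
tally t _               = t

-- Fewer than three trailing bits are ignored.
blockMajority : ∀ n → Cube n → Bool
blockMajority n x = isNegative (tally (ℤ.+ 0) x)

pad : ∀ {n} → Bool × Cube n → Bool × Cube (3 ℕ.+ n)
pad (s , a) = s , false ∷ false ∷ false ∷ a

-- The signed characters whose sum is twice the sum of the signs of the block majorities.
majorityTerms : ∀ n → List (Bool × Cube n)
majorityTerms (suc (suc (suc n))) =
    (false , true ∷ false ∷ false ∷ 𝟎) ∷ (false , false ∷ true ∷ false ∷ 𝟎) ∷ (false , false ∷ false ∷ true ∷ 𝟎)
  ∷ (true , true ∷ true ∷ true ∷ 𝟎)
  ∷ List.map pad (majorityTerms n)
majorityTerms _ = []

length-majorityTerms : ∀ n → length (majorityTerms n) ℕ.≤ 4 ℕ.* n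
length-majorityTerms 0 = z≤n
length-majorityTerms 1 = z≤n
length-majorityTerms 2 = z≤n
length-majorityTerms (suc (suc (suc n))) = begin
  4 ℕ.+ length (List.map _ (majorityTerms n)) ≡⟨ cong (4 ℕ.+_) (Listₚ.length-map _ (majorityTerms n)) ⟩
  4 ℕ.+ length (majorityTerms n)              ≤⟨ ℕₚ.+-mono-≤ {4} {12} (s≤s (s≤s (s≤s (s≤s z≤n)))) (length-majorityTerms n) ⟩
  12 ℕ.+ 4 ℕ.* n                              ≡⟨ sym (ℕₚ.*-distribˡ-+ 4 3 n) ⟩
  4 ℕ.* (3 ℕ.+ n)                             ∎
  where open ℕₚ.≤-Reasoning

floor-log₂ : ∀ n → 1 ℕ.≤ n → ∃[ e ] 2 ℕ.^ e ℕ.≤ n × n ℕ.< 2 ℕ.^ suc e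
floor-log₂ (suc zero)    _ = 0 , ℕₚ.≤-refl , s≤s (s≤s z≤n)
floor-log₂ (suc (suc n)) _ with floor-log₂ (suc n) (s≤s z≤n)
... | e , l , u with suc (suc n) ℕₚ.<? 2 ℕ.^ suc e
...   | yes p = e , ℕₚ.m≤n⇒m≤1+n l , p
...   | no ¬p = suc e , ℕₚ.≮⇒≥ ¬p , ℕₚ.<-≤-trans (s≤s u) (begin
  suc (2 ℕ.^ suc e)             ≤⟨ ℕₚ.+-monoˡ-≤ (2 ℕ.^ suc e) (ℕₚ.^-monoʳ-≤ 2 {0} {suc e} z≤n) ⟩
  2 ℕ.^ suc e ℕ.+ 2 ℕ.^ suc e   ≡⟨ cong (2 ℕ.^ suc e ℕ.+_) (sym (ℕₚ.+-identityʳ _)) ⟩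
  2 ℕ.^ suc (suc e)             ∎)
  where open ℕₚ.≤-Reasoning

module MajorityDiscrepancy (ℝ : CompleteOrderedField) where
  open DiscrepancyAndDepth ℝ public

  -- This is 2t + 1. It has the sign recorded by `isNegative`, also at the tie t = 0, and its
  -- absolute value is at least one.
  odd : ℤ → Carrier
  odd (ℤ.+ n)  = 1# + fromℕ 2 * fromℕ n
  odd -[1+ n ] = - (1# + fromℕ 2 * fromℕ n)

  odd-up : ∀ t → odd (up t) ≡ odd t + fromℕ 2
  odd-up (ℤ.+ n)      = solve 1 (λ n → con (ℤ.+ 1) :+ con (ℤ.+ 2) :* (con (ℤ.+ 1) :+ n) := (con (ℤ.+ 1) :+ con (ℤ.+ 2) :* n) :+ con (ℤ.+ 2)) refl (fromℕ n)
  odd-up -[1+ zero ]  = solve 0 (con (ℤ.+ 1) :+ con (ℤ.+ 2) :* con (ℤ.+ 0) := (:- (con (ℤ.+ 1) :+ con (ℤ.+ 2) :* con (ℤ.+ 0))) :+ con (ℤ.+ 2)) refl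
  odd-up -[1+ suc n ] = solve 1 (λ n → :- (con (ℤ.+ 1) :+ con (ℤ.+ 2) :* n) := (:- (con (ℤ.+ 1) :+ con (ℤ.+ 2) :* (con (ℤ.+ 1) :+ n))) :+ con (ℤ.+ 2)) refl (fromℕ n)

  odd-down : ∀ t → odd (down t) ≡ odd t - fromℕ 2
  odd-down t = trans (solve 2 (λ x y → x := (x :+ y) :- y) refl (odd (down t)) (fromℕ 2))
    (cong (_- fromℕ 2) (trans (sym (odd-up (down t))) (cong odd (up-down t))))

  odd-step : ∀ b t → odd (step b t) ≡ odd t + fromℕ 2 * sg b
  odd-step false t = trans (odd-up t) (cong (odd t +_) (solve 0 (con (ℤ.+ 2) := con (ℤ.+ 2) :* con (ℤ.+ 1)) refl))
  odd-step true  t = trans (odd-down t) (cong (odd t +_) (solve 0 (:- con (ℤ.+ 2) := con (ℤ.+ 2) :* (:- con (ℤ.+ 1))) refl))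

  1≤sign*odd : ∀ t → 1# ≤ sg (isNegative t) * odd t
  1≤sign*odd (ℤ.+ n)  = ≤-by (fromℕ 2 * fromℕ n) (*-nonNeg (0≤fromℕ 2) (0≤fromℕ n)) (*-identityˡ _)
  1≤sign*odd -[1+ n ] = ≤-by (fromℕ 2 * fromℕ n) (*-nonNeg (0≤fromℕ 2) (0≤fromℕ n))
    (solve 1 (λ x → (:- con (ℤ.+ 1)) :* (:- x) := x) refl _)

  combination : ∀ {n} → List (Bool × Cube n) → Cube n → Carrier
  combination []            x = 0#
  combination ((s , a) ∷ L) x = sg s * χ a x + combination L x

  combination-lift : ∀ {n} (L : List (Bool × Cube n)) a b c x →
    combination (List.map pad L) (a ∷ b ∷ c ∷ x) ≡ combination L x
  combination-lift []            a b c x = refl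
  combination-lift ((s , d) ∷ L) a b c x = cong (sg s * χ d x +_) (combination-lift L a b c x)

  -- The Fourier expansion of three-bit majority, doubled to clear its denominators. It is the
  -- source of the four terms per triple in `majorityTerms`.
  two-maj : ∀ a b c → fromℕ 2 * sg (maj a b c) ≡ sg a + (sg b + (sg c - sg (a xor (b xor c))))
  two-maj false false false = solve 0 (con (ℤ.+ 2) :* con (ℤ.+ 1) := con (ℤ.+ 1) :+ (con (ℤ.+ 1) :+ (con (ℤ.+ 1) :- con (ℤ.+ 1)))) refl
  two-maj false false true  = solve 0 (con (ℤ.+ 2) :* con (ℤ.+ 1) := con (ℤ.+ 1) :+ (con (ℤ.+ 1) :+ ((:- con (ℤ.+ 1)) :- (:- con (ℤ.+ 1))))) refl
  two-maj false true  false = solve 0 (con (ℤ.+ 2) :* con (ℤ.+ 1) := con (ℤ.+ 1) :+ ((:- con (ℤ.+ 1)) :+ (con (ℤ.+ 1) :- (:- con (ℤ.+ 1))))) refl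
  two-maj false true  true  = solve 0 (con (ℤ.+ 2) :* (:- con (ℤ.+ 1)) := con (ℤ.+ 1) :+ ((:- con (ℤ.+ 1)) :+ ((:- con (ℤ.+ 1)) :- con (ℤ.+ 1)))) refl
  two-maj true  false false = solve 0 (con (ℤ.+ 2) :* con (ℤ.+ 1) := (:- con (ℤ.+ 1)) :+ (con (ℤ.+ 1) :+ (con (ℤ.+ 1) :- (:- con (ℤ.+ 1))))) refl
  two-maj true  false true  = solve 0 (con (ℤ.+ 2) :* (:- con (ℤ.+ 1)) := (:- con (ℤ.+ 1)) :+ (con (ℤ.+ 1) :+ ((:- con (ℤ.+ 1)) :- con (ℤ.+ 1)))) refl
  two-maj true  true  false = solve 0 (con (ℤ.+ 2) :* (:- con (ℤ.+ 1)) := (:- con (ℤ.+ 1)) :+ ((:- con (ℤ.+ 1)) :+ (con (ℤ.+ 1) :- con (ℤ.+ 1)))) refl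
  two-maj true  true  true  = solve 0 (con (ℤ.+ 2) :* (:- con (ℤ.+ 1)) := (:- con (ℤ.+ 1)) :+ ((:- con (ℤ.+ 1)) :+ ((:- con (ℤ.+ 1)) :- (:- con (ℤ.+ 1))))) refl

  odd-tally : ∀ {n} t (x : Cube n) → odd (tally t x) ≡ odd t + combination (majorityTerms n) x
  odd-tally t []           = sym (+-identityʳ _)
  odd-tally t (_ ∷ [])     = sym (+-identityʳ _)
  odd-tally t (_ ∷ _ ∷ []) = sym (+-identityʳ _)
  odd-tally {suc (suc (suc n))} t (a ∷ b ∷ c ∷ x) rewrite ⟨𝟎, x ⟩
    | Boolₚ.xor-identityʳ a | Boolₚ.xor-identityʳ b | Boolₚ.xor-identityʳ c
    | combination-lift (majorityTerms n) a b c x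
    | odd-tally (step (maj a b c) t) x | odd-step (maj a b c) t | two-maj a b c =
    solve 6 (λ w a b c d z → (w :+ (a :+ (b :+ (c :- d)))) :+ z :=
      w :+ (con (ℤ.+ 1) :* a :+ (con (ℤ.+ 1) :* b :+ (con (ℤ.+ 1) :* c :+ ((:- con (ℤ.+ 1)) :* d :+ z))))) refl
      (odd t) (sg a) (sg b) (sg c) (sg (a xor (b xor c))) (combination (majorityTerms n) x)

  ∑-combination : ∀ {n} (L : List (Bool × Cube n)) (g : Cube n → Carrier) {B} → (∀ a → ∣ ∑ (λ x → χ a x * g x) ∣ ≤ B) →
    ∑ (λ x → combination L x * g x) ≤ fromℕ (length L) * B
  ∑-combination {n} [] g {B} h = ≤-reflexive (trans (∑-0 {n} (λ x → zeroˡ (g x))) (sym (zeroˡ B)))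
  ∑-combination {n} ((s , a) ∷ L) g {B} h = subst₂ _≤_ (sym separate)
    (solve 2 (λ b l → b :+ l :* b := (con (ℤ.+ 1) :+ l) :* b) refl B (fromℕ (length L)))
    (+-mono-≤ (≤-trans (x≤∣x∣ _) (∣sg*x∣ s _ (h a))) (∑-combination L g h))
    where
    separate : ∑ (λ x → (sg s * χ a x + combination L x) * g x) ≡ sg s * ∑ (λ x → χ a x * g x) + ∑ (λ x → combination L x * g x)
    separate = trans (∑-cong λ x → solve 4 (λ s c l g → (s :* c :+ l) :* g := s :* (c :* g) :+ l :* g) refl (sg s) (χ a x) (combination L x) (g x))
      (trans (∑-+ {n} _ _) (cong (_+ ∑ (λ x → combination L x * g x)) (∑-*ˡ {n} (sg s) _)))

  module _ {n} (f : Cube n → Bool) (μ : Distribution n) where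

    -- A character is twice the indicator of its kernel minus one.
    ∣∑χ∣≤3*maxBias : ∀ a → ∣ ∑ (λ x → χ a x * signed f μ x) ∣ ≤ fromℕ 3 * maxBias f μ
    ∣∑χ∣≤3*maxBias a = subst (λ s → ∣ s ∣ ≤ _) (sym decompose) (∣x∣≤
      (subst (fromℕ 2 * k - w ≤_) three (+-mono-≤ (*-monoˡ-≤ (0≤fromℕ 2) (≤-trans (x≤∣x∣ k) k≤)) (-∣_∣≤ w≤)))
      (subst₂ _≤_ (solve 2 (λ k w → con (ℤ.+ 2) :* (:- k) :+ w := :- (con (ℤ.+ 2) :* k :- w)) refl k w) three
        (+-mono-≤ (*-monoˡ-≤ (0≤fromℕ 2) (-∣_∣≤ k≤)) (≤-trans (x≤∣x∣ w) w≤))))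
      where
      k w : Carrier
      k = ∑ ((λ x → not ⟨ a , x ⟩) ∣ signed f μ)
      w = ∑ ((λ x → true) ∣ signed f μ)
      k≤ : ∣ k ∣ ≤ maxBias f μ
      k≤ = bias≤maxBias f μ _ (kernel-affine a)
      w≤ : ∣ w ∣ ≤ maxBias f μ
      w≤ = bias≤maxBias f μ _ everything-affine
      three : fromℕ 2 * maxBias f μ + maxBias f μ ≡ fromℕ 3 * maxBias f μ
      three = solve 1 (λ m → con (ℤ.+ 2) :* m :+ m := con (ℤ.+ 3) :* m) refl _
      indicator : ∀ b g → sg b * g ≡ fromℕ 2 * (if not b then g else 0#) - g
      indicator false g = solve 1 (λ g → con (ℤ.+ 1) :* g := con (ℤ.+ 2) :* g :- g) refl g
      indicator true  g = solve 1 (λ g → (:- con (ℤ.+ 1)) :* g := con (ℤ.+ 2) :* con (ℤ.+ 0) :- g) refl g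
      decompose : ∑ (λ x → χ a x * signed f μ x) ≡ fromℕ 2 * k - w
      decompose = trans (∑-cong λ x → indicator ⟨ a , x ⟩ (signed f μ x)) (trans (∑-+ {n} _ _)
        (cong₂ _+_ (∑-*ˡ {n} (fromℕ 2) _) (∑-neg {n} _)))

  -- `odd` of the tally represents the function in sign with margin one, so its correlation with the
  -- signed distribution is at least the total mass one. It is also a sum of at most 4n + 1 signed
  -- characters, each with correlation at most `3 * maxBias`.
  maxBias-blockMajority : ∀ n (μ : Distribution n) →
    1# ≤ fromℕ (suc (4 ℕ.* n)) * (fromℕ 3 * maxBias (blockMajority n) μ)
  maxBias-blockMajority n μ = ≤-trans (subst (_≤ ∑ (λ x → combination L x * signed f μ x)) (total μ) (∑-mono pointwise))
    (≤-trans (∑-combination L (signed f μ) (∣∑χ∣≤3*maxBias f μ))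
      (subst₂ _≤_ (*-comm _ _) (*-comm _ _) (*-monoˡ-≤ (*-nonNeg (0≤fromℕ 3) (0≤maxBias f μ)) (fromℕ-mono-≤ (s≤s (length-majorityTerms n))))))
    where
    f = blockMajority n
    -- The trivial character accounts for the 1 in 2t + 1.
    L = (false , 𝟎) ∷ majorityTerms n
    odd≡ : ∀ x → odd (tally (ℤ.+ 0) x) ≡ combination L x
    odd≡ x rewrite ⟨𝟎, x ⟩ = trans (odd-tally (ℤ.+ 0) x) (cong (_+ combination (majorityTerms n) x)
      (solve 0 (con (ℤ.+ 1) :+ con (ℤ.+ 2) :* con (ℤ.+ 0) := con (ℤ.+ 1) :* con (ℤ.+ 1)) refl))
    pointwise : ∀ x → mass μ x ≤ combination L x * signed f μ x
    pointwise x = subst₂ _≤_ (*-identityˡ _)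
      (trans (solve 3 (λ s o m → (s :* o) :* m := o :* (s :* m)) refl (sg (f x)) (odd (tally (ℤ.+ 0) x)) (mass μ x)) (cong (_* signed f μ x) (odd≡ x)))
      (*-mono-≤ 0≤1 (nonNeg μ x) (1≤sign*odd (tally (ℤ.+ 0) x)) ≤-refl)

  disc-blockMajority=O : (λ n → disc (blockMajority n)) =O (λ n → log₂ (fromℕ n))
  -- With `e` the integer part of the logarithm of `n`, 3 (4n + 1) ≤ 16n < 2^(5 + e). From `n ≥ 2`
  -- on, `e` is at least 1, hence 5 + e ≤ 6e.
  disc-blockMajority=O = fromℕ 6 , 2 , bound
    where
    bound : ∀ n → n ℕ.≥ 2 → ∣ disc (blockMajority n) ∣ ≤ fromℕ 6 * ∣ log₂ (fromℕ n) ∣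
    bound n n≥2 = subst (_≤ fromℕ 6 * ∣ log₂ (fromℕ n) ∣) (sym (0≤x⇒∣x∣≡x (0≤disc (blockMajority n))))
      (≤-trans (disc≤ (blockMajority n) (5 ℕ.+ e) large)
        (≤-trans (fromℕ-mono-≤ 5+e≤6e) (≤-trans (≤-reflexive (fromℕ-* 6 e))
          (*-monoˡ-≤ (0≤fromℕ 6) (≤-trans e≤log (x≤∣x∣ _))))))
      where
      n≥1 = ℕₚ.≤-trans (s≤s z≤n) n≥2
      e = proj₁ (floor-log₂ n n≥1)
      l = proj₁ (proj₂ (floor-log₂ n n≥1))
      u = proj₂ (proj₂ (floor-log₂ n n≥1))

      1≤exponent : ∀ e → n ℕ.< 2 ℕ.^ suc e → 1 ℕ.≤ e
      1≤exponent zero    n<2 = ⊥-elim (ℕₚ.<⇒≱ n<2 n≥2)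
      1≤exponent (suc e) _   = s≤s z≤n

      5+e≤6e : 5 ℕ.+ e ℕ.≤ 6 ℕ.* e
      5+e≤6e = ℕₚ.≤-trans (ℕₚ.+-monoˡ-≤ e (ℕₚ.*-monoʳ-≤ 5 (1≤exponent e u))) (ℕₚ.≤-reflexive (ℕₚ.+-comm (5 ℕ.* e) e))

      e≤log : fromℕ e ≤ log₂ (fromℕ n)
      e≤log = subst (_≤ log₂ (fromℕ n)) (solve 1 (λ e → e :- con (ℤ.+ 0) := e) refl (fromℕ e))
        (log₂-≥ 0 (suc e) e 0 (0≤fromℕ n)
          (subst₂ _≤_ (sym (2^-fromℕ e)) (solve 1 (λ n → n := n :* con (ℤ.+ 1)) refl (fromℕ n)) (fromℕ-mono-≤ l))
          (subst₂ _≤_ (solve 1 (λ n → n := n :* con (ℤ.+ 1)) refl (fromℕ n)) (sym (2^-fromℕ (suc e))) (fromℕ-mono-≤ (ℕₚ.<⇒≤ u))))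

      3*[1+4n]≤ : suc (4 ℕ.* n) ℕ.* 3 ℕ.≤ 2 ℕ.^ (5 ℕ.+ e)
      3*[1+4n]≤ = begin
        suc (4 ℕ.* n) ℕ.* 3         ≡⟨ regroup n ⟩
        3 ℕ.+ 12 ℕ.* n              ≤⟨ ℕₚ.+-monoˡ-≤ (12 ℕ.* n) (ℕₚ.≤-trans (ℕₚ.*-monoʳ-≤ 3 n≥1) (ℕₚ.*-monoˡ-≤ n {3} {4} (s≤s (s≤s (s≤s z≤n))))) ⟩
        4 ℕ.* n ℕ.+ 12 ℕ.* n        ≡⟨ regroup′ n ⟩
        16 ℕ.* n                    ≤⟨ ℕₚ.*-monoʳ-≤ 16 (ℕₚ.<⇒≤ u) ⟩
        16 ℕ.* 2 ℕ.^ suc e          ≡⟨ sym (ℕₚ.^-distribˡ-+-* 2 4 (suc e)) ⟩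
        2 ℕ.^ (4 ℕ.+ suc e)         ≡⟨ cong (2 ℕ.^_) (ℕₚ.+-suc 4 e) ⟩
        2 ℕ.^ (5 ℕ.+ e)             ∎
        where
        open ℕₚ.≤-Reasoning
        regroup : ∀ n → suc (4 ℕ.* n) ℕ.* 3 ≡ 3 ℕ.+ 12 ℕ.* n
        regroup = NatSolver.solve-∀
        regroup′ : ∀ n → 4 ℕ.* n ℕ.+ 12 ℕ.* n ≡ 16 ℕ.* n
        regroup′ = NatSolver.solve-∀

      large : ∀ μ → 1# ≤ maxBias (blockMajority n) μ * 2^ (5 ℕ.+ e)
      large μ = ≤-trans (maxBias-blockMajority n μ) (subst (_≤ m * 2^ (5 ℕ.+ e))
        (trans (cong (m *_) (fromℕ-* (suc (4 ℕ.* n)) 3)) (solve 3 (λ m a b → m :* (a :* b) := a :* (b :* m)) refl m (fromℕ (suc (4 ℕ.* n))) (fromℕ 3)))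
        (*-monoˡ-≤ (0≤maxBias (blockMajority n) μ) (subst (fromℕ (suc (4 ℕ.* n) ℕ.* 3) ≤_) (sym (2^-fromℕ (5 ℕ.+ e))) (fromℕ-mono-≤ 3*[1+4n]≤))))
        where m = maxBias (blockMajority n) μ

-- Inputs as vectors of triples, and decision trees with affine queries.

xor-swap : ∀ a b c → (a xor b) xor c ≡ (a xor c) xor b
xor-swap a b c = trans (Boolₚ.xor-assoc a b c) (trans (cong (a xor_) (Boolₚ.xor-comm b c)) (sym (Boolₚ.xor-assoc a c b)))

Blocks : ℕ → Set
Blocks = Vec (Cube 3)

dot : ∀ {j} → Blocks j → Blocks j → Bool
dot []       []       = false
dot (a ∷ as) (u ∷ us) = ⟨ a , u ⟩ xor dot as us

dot-insertAt : ∀ {j} (a : Blocks (suc j)) v i u → dot a (insertAt v i u) ≡ ⟨ lookup a i , u ⟩ xor dot (removeAt a i) v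
dot-insertAt (a ∷ as)     v        Fin.zero    u = refl
dot-insertAt (a ∷ b ∷ as) (w ∷ v) (Fin.suc i) u = trans
  (cong (⟨ a , w ⟩ xor_) (dot-insertAt (b ∷ as) v i u))
  (xor-interchange false ⟨ a , w ⟩ ⟨ lookup (b ∷ as) i , u ⟩ (dot (removeAt (b ∷ as) i) v))

⟨,⟩-⊕ˡ : ∀ {n} (a b x : Cube n) → ⟨ a ⊕ b , x ⟩ ≡ ⟨ a , x ⟩ xor ⟨ b , x ⟩
⟨,⟩-⊕ˡ []       []       []       = refl
⟨,⟩-⊕ˡ (a ∷ as) (b ∷ bs) (x ∷ xs) = trans
  (cong₂ _xor_ (Boolₚ.∧-distribʳ-xor x a b) (⟨,⟩-⊕ˡ as bs xs))
  (xor-interchange (a ∧ x) (b ∧ x) ⟨ as , xs ⟩ ⟨ bs , xs ⟩)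

dot-⊕ˡ : ∀ {j} (a b v : Blocks j) → dot (zipWith _⊕_ a b) v ≡ dot a v xor dot b v
dot-⊕ˡ []       []       []       = refl
dot-⊕ˡ (a ∷ as) (b ∷ bs) (u ∷ us) = trans
  (cong₂ _xor_ (⟨,⟩-⊕ˡ a b u) (dot-⊕ˡ as bs us)) (xor-interchange ⟨ a , u ⟩ ⟨ b , u ⟩ (dot as us) (dot bs us))

dot-zeroˡ : ∀ {j} (v : Blocks j) → dot (replicate j 𝟎) v ≡ false
dot-zeroˡ []       = refl
dot-zeroˡ (u ∷ us) = cong₂ _xor_ ⟨𝟎, u ⟩ (dot-zeroˡ us)

Affine : ℕ → Set
Affine j = Blocks j × Bool

⟪_,_⟫ : ∀ {j} → Affine j → Blocks j → Bool
⟪ (a , c) , v ⟫ = dot a v xor c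

constant : ∀ {j} → Bool → Affine j
constant c = replicate _ 𝟎 , c

⟪constant⟫ : ∀ {j} c (v : Blocks j) → ⟪ constant c , v ⟫ ≡ c
⟪constant⟫ c v = cong (_xor c) (dot-zeroˡ v)

_⊞_ : ∀ {j} → Affine j → Affine j → Affine j
(a , c) ⊞ (b , d) = zipWith _⊕_ a b , c xor d

⟪⊞⟫ : ∀ {j} (p q : Affine j) v → ⟪ p ⊞ q , v ⟫ ≡ ⟪ p , v ⟫ xor ⟪ q , v ⟫
⟪⊞⟫ (a , c) (b , d) v = trans (cong (_xor (c xor d)) (dot-⊕ˡ a b v)) (xor-interchange (dot a v) (dot b v) c d)

-- Revealing bits leaves constant terms in the queries, and eliminating a bit replaces it by an
-- affine form in the others. Affine labels are closed under both operations.
data AffineTree (j : ℕ) : Set where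
  leaf  : Bool → AffineTree j
  query : Affine j → AffineTree j → AffineTree j → AffineTree j

evalᵃ : ∀ {j} → AffineTree j → Blocks j → Bool
evalᵃ (leaf b)        v = b
evalᵃ (query q t₀ t₁) v = if ⟪ q , v ⟫ then evalᵃ t₁ v else evalᵃ t₀ v

depthᵃ : ∀ {j} → AffineTree j → ℕ
depthᵃ (leaf b)        = 0
depthᵃ (query q t₀ t₁) = suc (depthᵃ t₀ ℕ.⊔ depthᵃ t₁)

mapTree : ∀ {j k} → (Affine j → Affine k) → AffineTree j → AffineTree k
mapTree φ (leaf b)        = leaf b
mapTree φ (query q t₀ t₁) = query (φ q) (mapTree φ t₀) (mapTree φ t₁)

depth-mapTree : ∀ {j k} (φ : Affine j → Affine k) t → depthᵃ (mapTree φ t) ≡ depthᵃ t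
depth-mapTree φ (leaf b)        = refl
depth-mapTree φ (query q t₀ t₁) = cong₂ (λ k l → suc (k ℕ.⊔ l)) (depth-mapTree φ t₀) (depth-mapTree φ t₁)

eval-mapTree : ∀ {j k} (φ : Affine j → Affine k) {v w} → (∀ q → ⟪ φ q , v ⟫ ≡ ⟪ q , w ⟫) → ∀ t → evalᵃ (mapTree φ t) v ≡ evalᵃ t w
eval-mapTree φ e (leaf b)        = refl
eval-mapTree φ e (query q t₀ t₁) rewrite e q | eval-mapTree φ e t₀ | eval-mapTree φ e t₁ = refl

-- `k` is the position occurring in the query and `y` its bit; `o₁` and `o₂` are the two bits of the
-- triple that are revealed first.
spread : Fin 3 → Bool → Bool → Bool → Cube 3
spread Fin.zero                      o₁ o₂ y = y ∷ o₁ ∷ o₂ ∷ []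
spread (Fin.suc Fin.zero)            o₁ o₂ y = o₁ ∷ y ∷ o₂ ∷ []
spread (Fin.suc (Fin.suc Fin.zero))  o₁ o₂ y = o₁ ∷ o₂ ∷ y ∷ []

majᵇ : Cube 3 → Bool
majᵇ (a ∷ b ∷ c ∷ []) = maj a b c

maj-pinned : ∀ k o y → majᵇ (spread k o o y) ≡ o
maj-pinned Fin.zero                     false false = refl
maj-pinned Fin.zero                     false true  = refl
maj-pinned Fin.zero                     true  false = refl
maj-pinned Fin.zero                     true  true  = refl
maj-pinned (Fin.suc Fin.zero)           false false = refl
maj-pinned (Fin.suc Fin.zero)           false true  = refl
maj-pinned (Fin.suc Fin.zero)           true  false = refl
maj-pinned (Fin.suc Fin.zero)           true  true  = refl
maj-pinned (Fin.suc (Fin.suc Fin.zero)) false y     = refl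
maj-pinned (Fin.suc (Fin.suc Fin.zero)) true  y     = refl

maj-free : ∀ k o y → majᵇ (spread k o (not o) y) ≡ y
maj-free Fin.zero                     false false = refl
maj-free Fin.zero                     false true  = refl
maj-free Fin.zero                     true  false = refl
maj-free Fin.zero                     true  true  = refl
maj-free (Fin.suc Fin.zero)           false false = refl
maj-free (Fin.suc Fin.zero)           false true  = refl
maj-free (Fin.suc Fin.zero)           true  false = refl
maj-free (Fin.suc Fin.zero)           true  true  = refl
maj-free (Fin.suc (Fin.suc Fin.zero)) false y     = refl
maj-free (Fin.suc (Fin.suc Fin.zero)) true  y     = refl

⟨,spread⟩ : ∀ α k o₁ o₂ y → ⟨ α , spread k o₁ o₂ y ⟩ ≡ ⟨ α , spread k o₁ o₂ false ⟩ xor (lookup α k ∧ y)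
⟨,spread⟩ α                k o₁ o₂ false = sym (trans (cong (⟨ α , spread k o₁ o₂ false ⟩ xor_) (Boolₚ.∧-zeroʳ (lookup α k))) (Boolₚ.xor-identityʳ _))
⟨,spread⟩ (a ∷ b ∷ c ∷ []) Fin.zero                     o₁ o₂ true rewrite Boolₚ.∧-zeroʳ a | Boolₚ.∧-identityʳ a = Boolₚ.xor-comm a _
⟨,spread⟩ (a ∷ b ∷ c ∷ []) (Fin.suc Fin.zero)           o₁ o₂ true rewrite Boolₚ.∧-zeroʳ b | Boolₚ.∧-identityʳ b =
  trans (cong (a ∧ o₁ xor_) (Boolₚ.xor-comm b _)) (sym (Boolₚ.xor-assoc (a ∧ o₁) _ b))
⟨,spread⟩ (a ∷ b ∷ c ∷ []) (Fin.suc (Fin.suc Fin.zero)) o₁ o₂ true rewrite Boolₚ.∧-zeroʳ c | Boolₚ.∧-identityʳ c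
  | Boolₚ.xor-identityʳ c | Boolₚ.xor-identityʳ (b ∧ o₂) = sym (Boolₚ.xor-assoc (a ∧ o₁) _ c)

module _ {j} (i : Fin (suc j)) (k : Fin 3) (o₁ o₂ : Bool) (A : Affine j) where

  -- Letting the bit at position `k` be an affine form covers both cases of the lower bound: a
  -- constant form when this bit is revealed as well, and the solution of the query for this bit
  -- when it is irrelevant.
  plug : Blocks j → Blocks (suc j)
  plug v = insertAt v i (spread k o₁ o₂ ⟪ A , v ⟫)

  substitute : Affine (suc j) → Affine j
  substitute (a , c) = (removeAt a i , ⟨ lookup a i , spread k o₁ o₂ false ⟩ xor c) ⊞ (if lookup (lookup a i) k then A else constant false)

  ⟪substitute⟫ : ∀ q v → ⟪ substitute q , v ⟫ ≡ ⟪ q , plug v ⟫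
  ⟪substitute⟫ (a , c) v = begin
    ⟪ substitute (a , c) , v ⟫
      ≡⟨ ⟪⊞⟫ (removeAt a i , S xor c) (if κ then A else constant false) v ⟩
    (d xor (S xor c)) xor ⟪ (if κ then A else constant false) , v ⟫
      ≡⟨ cong ((d xor (S xor c)) xor_) (selected κ) ⟩
    (d xor (S xor c)) xor (κ ∧ y)
      ≡⟨ shuffle d S c (κ ∧ y) ⟩
    ((S xor (κ ∧ y)) xor d) xor c
      ≡⟨ cong (λ s → (s xor d) xor c) (sym (⟨,spread⟩ (lookup a i) k o₁ o₂ y)) ⟩
    (⟨ lookup a i , spread k o₁ o₂ y ⟩ xor d) xor c
      ≡⟨ cong (_xor c) (sym (dot-insertAt a v i (spread k o₁ o₂ y))) ⟩
    ⟪ (a , c) , plug v ⟫ ∎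
    where
    open ≡-Reasoning
    κ = lookup (lookup a i) k
    y = ⟪ A , v ⟫
    d = dot (removeAt a i) v
    S = ⟨ lookup a i , spread k o₁ o₂ false ⟩
    selected : ∀ κ → ⟪ (if κ then A else constant false) , v ⟫ ≡ κ ∧ y
    selected true  = refl
    selected false = ⟪constant⟫ false v
    shuffle : ∀ d s c z → (d xor (s xor c)) xor z ≡ ((s xor z) xor d) xor c
    shuffle d s c z = trans (cong (_xor z) (sym (Boolₚ.xor-assoc d s c))) (trans (xor-swap (d xor s) c z)
      (cong (_xor c) (trans (cong (_xor z) (Boolₚ.xor-comm d s)) (xor-swap s d z))))

  eval-substitute : ∀ t v → evalᵃ (mapTree substitute t) v ≡ evalᵃ t (plug v)
  eval-substitute t v = eval-mapTree substitute (λ q → ⟪substitute⟫ q v) t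

tallyᵇ : ∀ {j} → ℤ → Blocks j → ℤ
tallyᵇ t []      = t
tallyᵇ t (u ∷ v) = tallyᵇ (step (majᵇ u) t) v

tally-insertAt : ∀ {j} t (v : Blocks j) i u → tallyᵇ t (insertAt v i u) ≡ tallyᵇ (step (majᵇ u) t) v
tally-insertAt t v       Fin.zero    u = refl
tally-insertAt t (w ∷ v) (Fin.suc i) u = trans (tally-insertAt _ v i u) (cong (λ s → tallyᵇ s v) (step-comm (majᵇ u) (majᵇ w) t))

support : ∀ {j} (a : Blocks j) → (∃[ i ] ∃[ k ] lookup (lookup a i) k ≡ true) ⊎ (∀ v → dot a v ≡ false)
support []      = inj₂ λ { [] → refl }
support ((true ∷ b ∷ c ∷ []) ∷ a)         = inj₁ (Fin.zero , Fin.zero , refl)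
support ((false ∷ true ∷ c ∷ []) ∷ a)     = inj₁ (Fin.zero , Fin.suc Fin.zero , refl)
support ((false ∷ false ∷ true ∷ []) ∷ a) = inj₁ (Fin.zero , Fin.suc (Fin.suc Fin.zero) , refl)
support ((false ∷ false ∷ false ∷ []) ∷ a) with support a
... | inj₁ (i , k , e) = inj₁ (Fin.suc i , k , e)
... | inj₂ z           = inj₂ λ { ((_ ∷ _ ∷ _ ∷ []) ∷ v) → z v }

blocks rest : ℕ → ℕ
blocks (suc (suc (suc n))) = suc (blocks n)
blocks _                   = 0
rest (suc (suc (suc n))) = rest n
rest n                   = n

n≤3*blocks+2 : ∀ n → n ℕ.≤ blocks n ℕ.* 3 ℕ.+ 2
n≤3*blocks+2 0 = z≤n
n≤3*blocks+2 1 = s≤s z≤n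
n≤3*blocks+2 2 = s≤s (s≤s z≤n)
n≤3*blocks+2 (suc (suc (suc n))) = s≤s (s≤s (s≤s (n≤3*blocks+2 n)))

join : ∀ n → Blocks (blocks n) → Cube (rest n) → Cube n
join 0 v ℓ = ℓ
join 1 v ℓ = ℓ
join 2 v ℓ = ℓ
join (suc (suc (suc n))) ((a ∷ b ∷ c ∷ []) ∷ v) ℓ = a ∷ b ∷ c ∷ join n v ℓ

blockPart : ∀ n → Cube n → Blocks (blocks n)
blockPart 0 x = []
blockPart 1 x = []
blockPart 2 x = []
blockPart (suc (suc (suc n))) (a ∷ b ∷ c ∷ x) = (a ∷ b ∷ c ∷ []) ∷ blockPart n x

restPart : ∀ n → Cube n → Cube (rest n)
restPart 0 x = x
restPart 1 x = x
restPart 2 x = x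
restPart (suc (suc (suc n))) (a ∷ b ∷ c ∷ x) = restPart n x

⟨,join⟩ : ∀ n a v ℓ → ⟨ a , join n v ℓ ⟩ ≡ dot (blockPart n a) v xor ⟨ restPart n a , ℓ ⟩
⟨,join⟩ 0 a [] ℓ = refl
⟨,join⟩ 1 a [] ℓ = refl
⟨,join⟩ 2 a [] ℓ = refl
⟨,join⟩ (suc (suc (suc n))) (a ∷ b ∷ c ∷ as) ((x ∷ y ∷ z ∷ []) ∷ v) ℓ = trans
  (cong (λ r → (a ∧ x) xor ((b ∧ y) xor ((c ∧ z) xor r))) (⟨,join⟩ n as v ℓ))
  (assoc₄ (a ∧ x) (b ∧ y) (c ∧ z) (dot (blockPart n as) v) ⟨ restPart n as , ℓ ⟩)
  where
  assoc₄ : ∀ p q r s t → p xor (q xor (r xor (s xor t))) ≡ ((p xor (q xor (r xor false))) xor s) xor t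
  assoc₄ p q r s t = begin
    p xor (q xor (r xor (s xor t)))             ≡⟨ cong (p xor_) (cong (q xor_) (sym (Boolₚ.xor-assoc r s t))) ⟩
    p xor (q xor ((r xor s) xor t))             ≡⟨ cong (p xor_) (sym (Boolₚ.xor-assoc q (r xor s) t)) ⟩
    p xor ((q xor (r xor s)) xor t)             ≡⟨ sym (Boolₚ.xor-assoc p (q xor (r xor s)) t) ⟩
    (p xor (q xor (r xor s))) xor t             ≡⟨ cong (λ e → (p xor e) xor t) (sym (Boolₚ.xor-assoc q r s)) ⟩
    (p xor ((q xor r) xor s)) xor t             ≡⟨ cong (_xor t) (sym (Boolₚ.xor-assoc p (q xor r) s)) ⟩
    ((p xor (q xor r)) xor s) xor t             ≡⟨ cong (λ e → ((p xor (q xor e)) xor s) xor t) (sym (Boolₚ.xor-identityʳ r)) ⟩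
    ((p xor (q xor (r xor false))) xor s) xor t ∎
    where open ≡-Reasoning

tally-join : ∀ n t v ℓ → tally t (join n v ℓ) ≡ tallyᵇ t v
tally-join 0 t [] []           = refl
tally-join 1 t [] (_ ∷ [])     = refl
tally-join 2 t [] (_ ∷ _ ∷ []) = refl
tally-join (suc (suc (suc n))) t ((a ∷ b ∷ c ∷ []) ∷ v) ℓ = tally-join n _ v ℓ

-- The function ignores the trailing bits, so they can be fixed to `ℓ`; their share of each query
-- becomes its constant term.
restrictTree : ∀ {n} → Cube (rest n) → ParityTree n → AffineTree (blocks n)
restrictTree     ℓ (leaf b)        = leaf b
restrictTree {n} ℓ (query a t₀ t₁) = query (blockPart n a , ⟨ restPart n a , ℓ ⟩) (restrictTree ℓ t₀) (restrictTree ℓ t₁)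

eval-restrictTree : ∀ {n} ℓ (t : ParityTree n) v → evalᵃ (restrictTree ℓ t) v ≡ eval t (join n v ℓ)
eval-restrictTree     ℓ (leaf b)        v = refl
eval-restrictTree {n} ℓ (query a t₀ t₁) v rewrite ⟨,join⟩ n a v ℓ | eval-restrictTree ℓ t₀ v | eval-restrictTree ℓ t₁ v = refl

depth-restrictTree : ∀ {n} ℓ (t : ParityTree n) → depthᵃ (restrictTree ℓ t) ≡ depth t
depth-restrictTree ℓ (leaf b)        = refl
depth-restrictTree ℓ (query a t₀ t₁) = cong₂ (λ k l → suc (k ℕ.⊔ l)) (depth-restrictTree ℓ t₀) (depth-restrictTree ℓ t₁)

floor-sqrt : ∀ m → ∃[ h ] h ℕ.* h ℕ.≤ m × m ℕ.< suc h ℕ.* suc h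
floor-sqrt zero = 0 , z≤n , s≤s z≤n
floor-sqrt (suc m) with floor-sqrt m
... | h , l , u with suc m ℕₚ.<? suc h ℕ.* suc h
...   | yes p = h , ℕₚ.m≤n⇒m≤1+n l , p
...   | no ¬p = suc h , ℕₚ.≮⇒≥ ¬p , ℕₚ.≤-<-trans u (ℕₚ.*-mono-< {suc h} {suc (suc h)} ℕₚ.≤-refl ℕₚ.≤-refl)

-- Depth lower bound for the first family: uniform averages.

module MajorityDepth (ℝ : CompleteOrderedField) where
  open MajorityDiscrepancy ℝ public

  -- Expectations are iterated averages of two values, so that fixing or exchanging coordinates
  -- brings in no normalising powers; `avg-∑` relates them to sums.
  avg₂ : (Bool → Carrier) → Carrier
  avg₂ φ = ½ * (φ false + φ true)

  avg : ∀ {n} → (Cube n → Carrier) → Carrier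
  avg {zero}  g = g []
  avg {suc n} g = avg₂ (λ b → avg (g ∘ (b ∷_)))

  𝔼 : ∀ {j} → (Blocks j → Carrier) → Carrier
  𝔼 {zero}  g = g []
  𝔼 {suc j} g = avg (λ u → 𝔼 (g ∘ (u ∷_)))

  avg₂-cong : ∀ {φ ψ} → (∀ b → φ b ≡ ψ b) → avg₂ φ ≡ avg₂ ψ
  avg₂-cong e = cong (½ *_) (cong₂ _+_ (e false) (e true))

  avg-cong : ∀ {n} {g h : Cube n → Carrier} → (∀ x → g x ≡ h x) → avg g ≡ avg h
  avg-cong {zero}  e = e []
  avg-cong {suc n} e = avg₂-cong (λ b → avg-cong (e ∘ (b ∷_)))

  𝔼-cong : ∀ {j} {g h : Blocks j → Carrier} → (∀ v → g v ≡ h v) → 𝔼 g ≡ 𝔼 h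
  𝔼-cong {zero}  e = e []
  𝔼-cong {suc j} e = avg-cong (λ u → 𝔼-cong (e ∘ (u ∷_)))

  avg₂-avg₂ : ∀ (F : Bool → Bool → Carrier) → avg₂ (λ a → avg₂ (F a)) ≡ avg₂ (λ b → avg₂ (λ a → F a b))
  avg₂-avg₂ F = solve 5 (λ h p q r s → h :* (h :* (p :+ q) :+ h :* (r :+ s)) := h :* (h :* (p :+ r) :+ h :* (q :+ s))) refl
    ½ (F false false) (F false true) (F true false) (F true true)

  avg-avg₂ : ∀ {n} (F : Cube n → Bool → Carrier) → avg (λ u → avg₂ (F u)) ≡ avg₂ (λ b → avg (λ u → F u b))
  avg-avg₂ {zero}  F = refl
  avg-avg₂ {suc n} F = trans (avg₂-cong (λ a → avg-avg₂ (F ∘ (a ∷_)))) (avg₂-avg₂ (λ a b → avg (λ u → F (a ∷ u) b)))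

  avg-avg : ∀ {m n} (F : Cube m → Cube n → Carrier) → avg (λ u → avg (F u)) ≡ avg (λ w → avg (λ u → F u w))
  avg-avg {n = zero}  F = refl
  avg-avg {n = suc n} F = trans (avg-avg₂ (λ u b → avg (λ w → F u (b ∷ w)))) (avg₂-cong (λ b → avg-avg (λ u w → F u (b ∷ w))))

  𝔼-avg₂ : ∀ {j} (F : Blocks j → Bool → Carrier) → 𝔼 (λ v → avg₂ (F v)) ≡ avg₂ (λ b → 𝔼 (λ v → F v b))
  𝔼-avg₂ {zero}  F = refl
  𝔼-avg₂ {suc j} F = trans (avg-cong (λ u → 𝔼-avg₂ (F ∘ (u ∷_)))) (avg-avg₂ (λ u b → 𝔼 (λ v → F (u ∷ v) b)))

  𝔼-avg : ∀ {j n} (F : Blocks j → Cube n → Carrier) → 𝔼 (λ v → avg (F v)) ≡ avg (λ ℓ → 𝔼 (λ v → F v ℓ))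
  𝔼-avg {n = zero}  F = refl
  𝔼-avg {n = suc n} F = trans (𝔼-avg₂ (λ v b → avg (F v ∘ (b ∷_)))) (avg₂-cong (λ b → 𝔼-avg (λ v ℓ → F v (b ∷ ℓ))))

  𝔼-insertAt : ∀ {j} (i : Fin (suc j)) (g : Blocks (suc j) → Carrier) → 𝔼 g ≡ avg (λ u → 𝔼 (λ v → g (insertAt v i u)))
  𝔼-insertAt         Fin.zero    g = refl
  𝔼-insertAt {suc j} (Fin.suc i) g = trans (avg-cong (λ w → 𝔼-insertAt i (g ∘ (w ∷_))))
    (avg-avg (λ w u → 𝔼 (λ v → g (w ∷ insertAt v i u))))

  avg-spread : ∀ k (g : Cube 3 → Carrier) → avg g ≡ avg₂ (λ o₁ → avg₂ (λ o₂ → avg₂ (λ y → g (spread k o₁ o₂ y))))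
  avg-spread Fin.zero g = trans (avg₂-avg₂ (λ y o₁ → avg₂ (λ o₂ → g (y ∷ o₁ ∷ o₂ ∷ [])))) (avg₂-cong (λ o₁ → avg₂-avg₂ (λ y o₂ → g (y ∷ o₁ ∷ o₂ ∷ []))))
  avg-spread (Fin.suc Fin.zero) g = avg₂-cong (λ o₁ → avg₂-avg₂ (λ y o₂ → g (o₁ ∷ y ∷ o₂ ∷ [])))
  avg-spread (Fin.suc (Fin.suc Fin.zero)) g = refl

  avg-*ˡ : ∀ {n} c (g : Cube n → Carrier) → avg (λ x → c * g x) ≡ c * avg g
  avg-*ˡ {zero}  c g = refl
  avg-*ˡ {suc n} c g = trans (avg₂-cong (λ b → avg-*ˡ c (g ∘ (b ∷_))))
    (solve 4 (λ h c x y → h :* (c :* x :+ c :* y) := c :* (h :* (x :+ y))) refl ½ c (avg (g ∘ (false ∷_))) (avg (g ∘ (true ∷_))))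

  𝔼-*ˡ : ∀ {j} c (g : Blocks j → Carrier) → 𝔼 (λ x → c * g x) ≡ c * 𝔼 g
  𝔼-*ˡ {zero}  c g = refl
  𝔼-*ˡ {suc n} c g = trans (avg-cong (λ u → 𝔼-*ˡ c (g ∘ (u ∷_)))) (avg-*ˡ c (λ u → 𝔼 (g ∘ (u ∷_))))

  avg₂-≤ : ∀ {φ c} → (∀ b → φ b ≤ c) → avg₂ φ ≤ c
  avg₂-≤ {φ} {c} p = ≤-trans (*-monoˡ-≤ 0≤½ (+-mono-≤ (p false) (p true)))
    (≤-reflexive (trans (solve 2 (λ h c → h :* (c :+ c) := con (ℤ.+ 2) :* (h :* c)) refl ½ c) (2*½x c)))

  avg-≤ : ∀ {n} {g : Cube n → Carrier} {c} → (∀ x → g x ≤ c) → avg g ≤ c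
  avg-≤ {zero}  p = p []
  avg-≤ {suc n} p = avg₂-≤ (λ b → avg-≤ (p ∘ (b ∷_)))

  avg-∑ : ∀ {n} (g : Cube n → Carrier) → avg g ≡ ½ ^ n * ∑ g
  avg-∑ {zero}  g = sym (*-identityˡ _)
  avg-∑ {suc n} g = trans (avg₂-cong (λ b → avg-∑ (g ∘ (b ∷_))))
    (solve 4 (λ h p x y → h :* (p :* x :+ p :* y) := (h :* p) :* (x :+ y)) refl ½ (½ ^ n) (∑ (g ∘ (false ∷_))) (∑ (g ∘ (true ∷_))))

  avg-join : ∀ n (g : Cube n → Carrier) → avg g ≡ 𝔼 (λ v → avg (λ ℓ → g (join n v ℓ)))
  avg-join 0 g = refl
  avg-join 1 g = refl
  avg-join 2 g = refl
  avg-join (suc (suc (suc n))) g = avg₂-cong λ a → avg₂-cong λ b → avg₂-cong λ c → avg-join n (λ x → g (a ∷ b ∷ c ∷ x))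

  avg-majᵇ : ∀ (φ : Bool → Carrier) → avg (φ ∘ majᵇ) ≡ avg₂ φ
  avg-majᵇ φ = begin
    avg (φ ∘ majᵇ)
      ≡⟨ solve 3 (λ h f t → h :* (h :* (h :* (f :+ f) :+ h :* (f :+ t)) :+ h :* (h :* (f :+ t) :+ h :* (t :+ t)))
           := (con (ℤ.+ 2) :* h) :* ((con (ℤ.+ 2) :* h) :* (h :* (f :+ t)))) refl ½ (φ false) (φ true) ⟩
    (fromℕ 2 * ½) * ((fromℕ 2 * ½) * avg₂ φ)
      ≡⟨ cong₂ (λ s t → s * (t * avg₂ φ)) 2*½ 2*½ ⟩
    1# * (1# * avg₂ φ)
      ≡⟨ trans (*-identityˡ _) (*-identityˡ _) ⟩
    avg₂ φ ∎
    where open ≡-Reasoning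

  -- The simple random walk performed by the tally.

  walk : ℕ → ℤ → Carrier
  walk zero    t = sg (isNegative t)
  walk (suc j) t = avg₂ (λ b → walk j (step b t))

  -- The unrevealed triples are independent, and by `avg-majᵇ` each majority is a fair bit. So
  -- `walk` is the expected final sign of a simple random walk.
  𝔼-walk : ∀ j t → 𝔼 {j} (λ v → sg (isNegative (tallyᵇ t v))) ≡ walk j t
  𝔼-walk zero    t = refl
  𝔼-walk (suc j) t = trans (avg-cong (λ u → 𝔼-walk j (step (majᵇ u) t))) (avg-majᵇ (λ b → walk j (step b t)))

  -- Reflection at -1/2 exchanges t with -1 - t, preserves the law of the steps and flips the final
  -- sign.
  walk-odd : ∀ j n → walk j -[1+ n ] ≡ - walk j (ℤ.+ n)
  walk-odd zero    n       = refl
  walk-odd (suc j) zero    = trans (avg₂-cong e) (solve 3 (λ h x y → h :* ((:- y) :+ (:- x)) := :- (h :* (x :+ y))) refl ½ (walk j (ℤ.+ 1)) (walk j -[1+ 0 ]))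
    where
    e : ∀ b → walk j (step b -[1+ 0 ]) ≡ (if b then - walk j (ℤ.+ 1) else - walk j -[1+ 0 ])
    e true  = walk-odd j 1
    e false = trans (solve 1 (λ x → x := :- (:- x)) refl _) (cong -_ (sym (walk-odd j 0)))
  walk-odd (suc j) (suc n) = trans (cong (½ *_) (cong₂ _+_ (walk-odd j n) (walk-odd j (suc (suc n)))))
    (solve 3 (λ h x y → h :* ((:- y) :+ (:- x)) := :- (h :* (x :+ y))) refl ½ (walk j (ℤ.+ suc (suc n))) (walk j (ℤ.+ n)))

  walk-zero : ∀ j → walk (suc j) (ℤ.+ 0) ≡ ½ * (walk j (ℤ.+ 1) - walk j (ℤ.+ 0))
  walk-zero j = cong (λ z → ½ * (walk j (ℤ.+ 1) + z)) (walk-odd j 0)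

  -- The two claims need each other: after reflection the value at 0 is half the increment from 0 to
  -- 1 one step earlier, nonnegative by monotonicity, and the first increment of the new function is
  -- bounded using nonnegativity at 0.
  walk-monotone : ∀ j → 0# ≤ walk j (ℤ.+ 0) × (∀ n → walk j (ℤ.+ n) ≤ walk j (ℤ.+ suc n))
  walk-monotone zero = 0≤1 , λ _ → ≤-refl
  walk-monotone (suc j) with walk-monotone j
  ... | p , m = subst (0# ≤_) (sym (walk-zero j)) (*-nonNeg 0≤½ (x≤y⇒0≤y-x (m 0))) , λ
    { zero → subst (_≤ walk (suc j) (ℤ.+ 1)) (sym (walk-zero j)) (*-monoˡ-≤ 0≤½
        (≤-by ((walk j (ℤ.+ 2) - walk j (ℤ.+ 1)) + (walk j (ℤ.+ 0) + walk j (ℤ.+ 0))) (0≤+ (x≤y⇒0≤y-x (m 1)) (0≤+ p p))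
          (solve 3 (λ a b c → c :+ a := (b :- a) :+ ((c :- b) :+ (a :+ a))) refl (walk j (ℤ.+ 0)) (walk j (ℤ.+ 1)) (walk j (ℤ.+ 2)))))
    ; (suc n) → *-monoˡ-≤ 0≤½ (+-mono-≤ (m (suc (suc n))) (m n)) }

  walk-≤1 : ∀ j t → walk j t ≤ 1#
  walk-≤1 zero (ℤ.+ n)   = ≤-refl
  walk-≤1 zero -[1+ n ]  = -x≤x 0≤1
  walk-≤1 (suc j) t      = avg₂-≤ (λ b → walk-≤1 j (step b t))

  walk-nonNeg : ∀ j n → 0# ≤ walk j (ℤ.+ n)
  walk-nonNeg j zero    = proj₁ (walk-monotone j)
  walk-nonNeg j (suc n) = ≤-trans (walk-nonNeg j n) (proj₂ (walk-monotone j) n)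

  _² : Carrier → Carrier
  x ² = x * x

  -- The survival estimate, and the potential argument over affine trees.

  module Survival (h : ℕ) where
    H : ℕ
    H = h ℕ.* h

    -- Before it leaves (-1, h) the walk has positive sign only if it survives j steps (probability
    -- at most the mean exit time over j) or exits at h; this is the corresponding supersolution.
    walk-survival : ∀ j n → suc n ℕ.≤ h →
      fromℕ H * walk j (ℤ.+ n) + (fromℕ h - fromℕ (suc n)) ² ≤ fromℕ H + fromℕ (H ℕ.∸ j)
    walk-survival zero n n<h = +-mono-≤ (≤-reflexive (solve 1 (λ x → x :* con (ℤ.+ 1) := x) refl (fromℕ H)))
      (subst ((fromℕ h - fromℕ (suc n)) ² ≤_) (sym (fromℕ-* h h)) (*-mono-≤ nn (0≤fromℕ h) le le))
      where
      nn = x≤y⇒0≤y-x (fromℕ-mono-≤ n<h)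
      le : fromℕ h - fromℕ (suc n) ≤ fromℕ h
      le = ≤-by (fromℕ (suc n)) (0≤fromℕ (suc n)) (solve 2 (λ h x → h := (h :- x) :+ x) refl (fromℕ h) (fromℕ (suc n)))
    walk-survival (suc j) n n<h with ℕₚ.m≤n⇒m<n∨m≡n n<h
    -- At the upper end of the interval the square vanishes and `walk-≤1` suffices.
    ... | inj₂ refl = ≤-by (fromℕ H * (1# - w) + fromℕ (H ℕ.∸ suc j))
        (0≤+ (*-nonNeg (0≤fromℕ H) (x≤y⇒0≤y-x (walk-≤1 (suc j) (ℤ.+ n)))) (0≤fromℕ (H ℕ.∸ suc j)))
        (solve 4 (λ H w m x → H :+ m := (H :* w :+ (x :- x) :* (x :- x)) :+ (H :* (con (ℤ.+ 1) :- w) :+ m)) refl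
          (fromℕ H) w (fromℕ (H ℕ.∸ suc j)) (fromℕ (suc n)))
      where w = walk (suc j) (ℤ.+ n)
    ... | inj₁ n+1<h = inner n n+1<h
      where
      M M′ hh : Carrier
      M  = fromℕ (H ℕ.∸ j)
      M′ = fromℕ (H ℕ.∸ suc j)
      hh = fromℕ h

      M≤1+M′ : M ≤ 1# + M′
      M≤1+M′ = fromℕ-mono-≤ {H ℕ.∸ j} {suc (H ℕ.∸ suc j)} (ℕₚ.≤-trans (ℕₚ.m≤n+m∸n (H ℕ.∸ j) 1)
        (ℕₚ.≤-reflexive (cong suc (trans (ℕₚ.∸-+-assoc H j 1) (cong (H ℕ.∸_) (ℕₚ.+-comm j 1))))))

      inner : ∀ n → suc (suc n) ℕ.≤ h → fromℕ H * walk (suc j) (ℤ.+ n) + (hh - fromℕ (suc n)) ² ≤ fromℕ H + M′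
      inner zero 2≤h = subst (λ w → fromℕ H * w + (hh - fromℕ 1) ² ≤ fromℕ H + M′) (sym (walk-zero j))
        (fromℕ-suc-cancelˡ-≤ 1 (≤-by
          (((fromℕ H + M) - (fromℕ H * w₁ + (hh - fromℕ 2) ²)) + (((1# + M′) - M) + M′ + 1# + fromℕ H * w₀))
          (0≤+ (x≤y⇒0≤y-x (walk-survival j 1 2≤h)) (0≤+ (0≤+ (0≤+ (x≤y⇒0≤y-x M≤1+M′) (0≤fromℕ (H ℕ.∸ suc j))) 0≤1) (*-nonNeg (0≤fromℕ H) (walk-nonNeg j 0))))
          (identity (fromℕ H) (fromℕ-* h h))))
        where
        w₀ = walk j (ℤ.+ 0)
        w₁ = walk j (ℤ.+ 1)
        identity : ∀ X → X ≡ hh * hh → fromℕ 2 * (X + M′) ≡ fromℕ 2 * (X * (½ * (w₁ - w₀)) + (hh - fromℕ 1) ²) +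
          (((X + M) - (X * w₁ + (hh - fromℕ 2) ²)) + (((1# + M′) - M) + M′ + 1# + X * w₀))
        identity _ refl = begin
          fromℕ 2 * (hh * hh + M′)
            ≡⟨ solve 5 (λ h m m′ w₀ w₁ → con (ℤ.+ 2) :* (h :* h :+ m′) :=
                 (con (ℤ.+ 1) :* ((h :* h) :* (w₁ :- w₀)) :+ con (ℤ.+ 2) :* ((h :- (con (ℤ.+ 1) :+ con (ℤ.+ 0))) :* (h :- (con (ℤ.+ 1) :+ con (ℤ.+ 0))))) :+
                 (((h :* h :+ m) :- ((h :* h) :* w₁ :+ (h :- con (ℤ.+ 2)) :* (h :- con (ℤ.+ 2)))) :+ (((con (ℤ.+ 1) :+ m′) :- m) :+ m′ :+ con (ℤ.+ 1) :+ (h :* h) :* w₀)))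
                 refl hh M M′ w₀ w₁ ⟩
          (1# * ((hh * hh) * (w₁ - w₀)) + fromℕ 2 * (hh - fromℕ 1) ²) + slack
            ≡⟨ cong (λ z → (z * ((hh * hh) * (w₁ - w₀)) + fromℕ 2 * (hh - fromℕ 1) ²) + slack) (sym 2*½) ⟩
          ((fromℕ 2 * ½) * ((hh * hh) * (w₁ - w₀)) + fromℕ 2 * (hh - fromℕ 1) ²) + slack
            ≡⟨ cong (_+ slack) (solve 4 (λ η x w y → (con (ℤ.+ 2) :* η) :* (x :* w) :+ con (ℤ.+ 2) :* y := con (ℤ.+ 2) :* (x :* (η :* w) :+ y)) refl ½ (hh * hh) (w₁ - w₀) ((hh - fromℕ 1) ²)) ⟩
          fromℕ 2 * ((hh * hh) * (½ * (w₁ - w₀)) + (hh - fromℕ 1) ²) + slack ∎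
          where
          open ≡-Reasoning
          slack = (((hh * hh + M) - ((hh * hh) * w₁ + (hh - fromℕ 2) ²)) + (((1# + M′) - M) + M′ + 1# + (hh * hh) * w₀))
      -- The squares at the two neighbours add up to twice the middle square plus two, and this two
      -- pays for replacing both `M` by `M′`.
      inner (suc n) 3+n≤h = fromℕ-suc-cancelˡ-≤ 1 (≤-by
          ((((fromℕ H + M) - (fromℕ H * a + (hh - fromℕ (3 ℕ.+ n)) ²)) + ((fromℕ H + M) - (fromℕ H * b + (hh - fromℕ (suc n)) ²))) + fromℕ 2 * ((1# + M′) - M))
          (0≤+ (0≤+ (x≤y⇒0≤y-x (walk-survival j (2 ℕ.+ n) 3+n≤h)) (x≤y⇒0≤y-x (walk-survival j n (ℕₚ.≤-trans (ℕₚ.m≤n+m (suc n) 2) 3+n≤h))))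
            (*-nonNeg (0≤fromℕ 2) (x≤y⇒0≤y-x M≤1+M′)))
          (begin
            fromℕ 2 * (X + M′)
              ≡⟨ solve 7 (λ X h m m′ a b y → con (ℤ.+ 2) :* (X :+ m′) :=
                   (con (ℤ.+ 1) :* (X :* (a :+ b)) :+ con (ℤ.+ 2) :* ((h :- (con (ℤ.+ 1) :+ (con (ℤ.+ 1) :+ y))) :* (h :- (con (ℤ.+ 1) :+ (con (ℤ.+ 1) :+ y))))) :+
                   ((((X :+ m) :- (X :* a :+ (h :- (con (ℤ.+ 1) :+ (con (ℤ.+ 1) :+ (con (ℤ.+ 1) :+ y)))) :* (h :- (con (ℤ.+ 1) :+ (con (ℤ.+ 1) :+ (con (ℤ.+ 1) :+ y))))))
                     :+ ((X :+ m) :- (X :* b :+ (h :- (con (ℤ.+ 1) :+ y)) :* (h :- (con (ℤ.+ 1) :+ y))))) :+ con (ℤ.+ 2) :* ((con (ℤ.+ 1) :+ m′) :- m)))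
                   refl X hh M M′ a b (fromℕ n) ⟩
            (1# * (X * (a + b)) + fromℕ 2 * (hh - fromℕ (2 ℕ.+ n)) ²) + slack
              ≡⟨ cong (λ z → (z * (X * (a + b)) + fromℕ 2 * (hh - fromℕ (2 ℕ.+ n)) ²) + slack) (sym 2*½) ⟩
            ((fromℕ 2 * ½) * (X * (a + b)) + fromℕ 2 * (hh - fromℕ (2 ℕ.+ n)) ²) + slack
              ≡⟨ cong (_+ slack) (solve 4 (λ η x w y → (con (ℤ.+ 2) :* η) :* (x :* w) :+ con (ℤ.+ 2) :* y := con (ℤ.+ 2) :* (x :* (η :* w) :+ y)) refl ½ X (a + b) ((hh - fromℕ (2 ℕ.+ n)) ²)) ⟩
            fromℕ 2 * (X * (½ * (a + b)) + (hh - fromℕ (2 ℕ.+ n)) ²) + slack ∎))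
        where
        open ≡-Reasoning
        X a b slack : Carrier
        X = fromℕ H
        a = walk j (ℤ.+ suc (suc n))
        b = walk j (ℤ.+ n)
        slack = (((X + M) - (X * a + (hh - fromℕ (3 ℕ.+ n)) ²)) + ((X + M) - (X * b + (hh - fromℕ (suc n)) ²))) + fromℕ 2 * ((1# + M′) - M)

    -- AM-GM: 8 h x ≤ h² + 16 x².
    walk-bound⁺ : ∀ j r n → H ℕ.≤ r ℕ.+ j →
      fromℕ 4 * (fromℕ H * walk j (ℤ.+ n)) ≤ fromℕ H + fromℕ 4 * (fromℕ 4 * fromℕ (suc n) ² + fromℕ r)
    walk-bound⁺ j r n H≤r+j with suc n ℕₚ.≤? h
    ... | yes n<h = ≤-by ((hh - fromℕ 4 * x) ² + fromℕ 4 * (((X + fromℕ (H ℕ.∸ j)) - (X * w + (hh - x) ²)) + (fromℕ r - fromℕ (H ℕ.∸ j))) + fromℕ 4 * x ²)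
        (0≤+ (0≤+ (0≤x² _) (*-nonNeg (0≤fromℕ 4) (0≤+ (x≤y⇒0≤y-x (walk-survival j n n<h)) (x≤y⇒0≤y-x (fromℕ-mono-≤ H∸j≤r))))) (*-nonNeg (0≤fromℕ 4) (0≤x² x)))
        (identity X (fromℕ-* h h))
      where
      X hh x w : Carrier
      X = fromℕ H
      hh = fromℕ h
      x = fromℕ (suc n)
      w = walk j (ℤ.+ n)
      identity : ∀ X → X ≡ hh * hh → X + fromℕ 4 * (fromℕ 4 * x ² + fromℕ r) ≡ fromℕ 4 * (X * w) +
        ((hh - fromℕ 4 * x) ² + fromℕ 4 * (((X + fromℕ (H ℕ.∸ j)) - (X * w + (hh - x) ²)) + (fromℕ r - fromℕ (H ℕ.∸ j))) + fromℕ 4 * x ²)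
      identity _ refl = solve 5 (λ h x w r m → h :* h :+ con (ℤ.+ 4) :* (con (ℤ.+ 4) :* (x :* x) :+ r) := con (ℤ.+ 4) :* ((h :* h) :* w) :+
        ((h :- con (ℤ.+ 4) :* x) :* (h :- con (ℤ.+ 4) :* x) :+ con (ℤ.+ 4) :* (((h :* h :+ m) :- ((h :* h) :* w :+ (h :- x) :* (h :- x))) :+ (r :- m)) :+ con (ℤ.+ 4) :* (x :* x)))
        refl hh x w (fromℕ r) (fromℕ (H ℕ.∸ j))
      H∸j≤r : H ℕ.∸ j ℕ.≤ r
      H∸j≤r = ℕₚ.m≤n+o⇒m∸n≤o H j (subst (H ℕ.≤_) (ℕₚ.+-comm r j) H≤r+j)
    -- Beyond the barrier `h` the term 16 x² alone exceeds 4 `H`, and `walk` is at most one.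
    ... | no n≮h = ≤-by (fromℕ 4 * (X * (1# - w)) + (fromℕ 4 * (x ² - X) + (X + fromℕ 12 * x ² + fromℕ 4 * fromℕ r)))
        (0≤+ (*-nonNeg (0≤fromℕ 4) (*-nonNeg (0≤fromℕ H) (x≤y⇒0≤y-x (walk-≤1 j (ℤ.+ n)))))
          (0≤+ (*-nonNeg (0≤fromℕ 4) (x≤y⇒0≤y-x H≤x²)) (0≤+ (0≤+ (0≤fromℕ H) (*-nonNeg (0≤fromℕ 12) (0≤x² x))) (*-nonNeg (0≤fromℕ 4) (0≤fromℕ r)))))
        (solve 4 (λ X x w r → X :+ con (ℤ.+ 4) :* (con (ℤ.+ 4) :* (x :* x) :+ r) := con (ℤ.+ 4) :* (X :* w) :+
          (con (ℤ.+ 4) :* (X :* (con (ℤ.+ 1) :- w)) :+ (con (ℤ.+ 4) :* (x :* x :- X) :+ (X :+ con (ℤ.+ 12) :* (x :* x) :+ con (ℤ.+ 4) :* r))))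
          refl X x w (fromℕ r))
      where
      X x w : Carrier
      X = fromℕ H
      x = fromℕ (suc n)
      w = walk j (ℤ.+ n)
      h≤x : fromℕ h ≤ x
      h≤x = fromℕ-mono-≤ (ℕₚ.<⇒≤ (ℕₚ.≰⇒> n≮h))
      H≤x² : X ≤ x ²
      H≤x² = subst (_≤ x ²) (sym (fromℕ-* h h)) (*-mono-≤ (0≤fromℕ h) (0≤fromℕ (suc n)) h≤x h≤x)

    -- With r triples revealed, running sum t and d queries left.  A revealed triple raises
    -- 4 (2 t + 1)² + r by 17 on average, and a query reveals two triples on average.
    Φ : ℕ → ℤ → ℕ → Carrier
    Φ r t d = fromℕ H + fromℕ 4 * (fromℕ 4 * odd t ² + (fromℕ r + fromℕ 34 * fromℕ d))

    sg*≤ : ∀ b {x} → 0# ≤ x → sg b * x ≤ x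
    sg*≤ false {x} p = ≤-reflexive (*-identityˡ x)
    sg*≤ true  {x} p = subst (_≤ x) (solve 1 (λ x → :- x := (:- con (ℤ.+ 1)) :* x) refl x) (-x≤x p)

    -- This is the bound at a leaf with label `b`. A negative tally is reflected to a nonnegative
    -- one, which flips the label and preserves `odd t ²`.
    walk-bound : ∀ b j r t → H ℕ.≤ r ℕ.+ j → fromℕ 4 * (fromℕ H * (sg b * walk j t)) ≤ Φ r t 0
    walk-bound b j r (ℤ.+ n) e = ≤-trans (*-monoˡ-≤ (0≤fromℕ 4) (*-monoˡ-≤ (0≤fromℕ H) (sg*≤ b (walk-nonNeg j n)))) (≤-trans (walk-bound⁺ j r n e)
      (≤-by (fromℕ 4 * (fromℕ 4 * (odd (ℤ.+ n) ² - fromℕ (suc n) ²))) (*-nonNeg (0≤fromℕ 4) (*-nonNeg (0≤fromℕ 4) (x≤y⇒0≤y-x x²≤odd²)))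
        (solve 4 (λ H w x r → H :+ con (ℤ.+ 4) :* (con (ℤ.+ 4) :* w :+ (r :+ con (ℤ.+ 34) :* con (ℤ.+ 0))) :=
          (H :+ con (ℤ.+ 4) :* (con (ℤ.+ 4) :* x :+ r)) :+ con (ℤ.+ 4) :* (con (ℤ.+ 4) :* (w :- x))) refl (fromℕ H) (odd (ℤ.+ n) ²) (fromℕ (suc n) ²) (fromℕ r))))
      where
      x≤odd : fromℕ (suc n) ≤ odd (ℤ.+ n)
      x≤odd = ≤-by (fromℕ n) (0≤fromℕ n) (solve 1 (λ n → con (ℤ.+ 1) :+ con (ℤ.+ 2) :* n := (con (ℤ.+ 1) :+ n) :+ n) refl (fromℕ n))
      x²≤odd² : fromℕ (suc n) ² ≤ odd (ℤ.+ n) ²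
      x²≤odd² = *-mono-≤ (0≤fromℕ (suc n)) (≤-trans (0≤fromℕ (suc n)) x≤odd) x≤odd x≤odd
    walk-bound b j r -[1+ n ] e = subst₂ _≤_
      (cong (λ z → fromℕ 4 * (fromℕ H * z)) (trans (cong (_* walk j (ℤ.+ n)) (sg-not b))
        (trans (solve 2 (λ s w → (:- s) :* w := s :* (:- w)) refl (sg b) (walk j (ℤ.+ n))) (cong (sg b *_) (sym (walk-odd j n))))))
      (cong (λ z → fromℕ H + fromℕ 4 * (fromℕ 4 * z + (fromℕ r + fromℕ 34 * fromℕ 0))) (solve 1 (λ x → x :* x := (:- x) :* (:- x)) refl (odd (ℤ.+ n))))
      (walk-bound (not b) j r (ℤ.+ n) e)

    advantage : ∀ {j} → AffineTree j → ℤ → Carrier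
    advantage T t = 𝔼 (λ v → sg (evalᵃ T v) * sg (isNegative (tallyᵇ t v)))

    Φ-mono : ∀ {r t d d′} → d ℕ.≤ d′ → Φ r t d ≤ Φ r t d′
    Φ-mono {r} {t} {d} {d′} p = +-mono-≤ ≤-refl (*-monoˡ-≤ (0≤fromℕ 4) (+-mono-≤ ≤-refl (+-mono-≤ ≤-refl (*-monoˡ-≤ (0≤fromℕ 34) (fromℕ-mono-≤ p)))))

    -- Revealing one triple preserves the potential on average. Within the inner bracket the square
    -- contributes 4 · 4 and the count 1, in total 17; with probability 1/2 the two revealed bits
    -- agree and a query worth 34 is saved.
    Φ-step : ∀ r t d → let U = Φ (suc r) (up t) d ; W = Φ (suc r) (down t) d in
      U + fromℕ 2 * (½ * (Φ (suc r) (up t) (suc d) + Φ (suc r) (down t) (suc d))) + W ≡ fromℕ 4 * Φ r t (suc d)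
    Φ-step r t d = trans (cong (λ z → Φ (suc r) (up t) d + z + Φ (suc r) (down t) d) (2*½x _)) (identity (odd (up t)) (odd (down t)) (odd-up t) (odd-down t))
      where
      identity : ∀ x y → x ≡ odd t + fromℕ 2 → y ≡ odd t - fromℕ 2 →
        (fromℕ H + fromℕ 4 * (fromℕ 4 * x ² + (fromℕ (suc r) + fromℕ 34 * fromℕ d)))
        + ((fromℕ H + fromℕ 4 * (fromℕ 4 * x ² + (fromℕ (suc r) + fromℕ 34 * fromℕ (suc d))))
           + (fromℕ H + fromℕ 4 * (fromℕ 4 * y ² + (fromℕ (suc r) + fromℕ 34 * fromℕ (suc d)))))
        + (fromℕ H + fromℕ 4 * (fromℕ 4 * y ² + (fromℕ (suc r) + fromℕ 34 * fromℕ d)))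
        ≡ fromℕ 4 * (fromℕ H + fromℕ 4 * (fromℕ 4 * odd t ² + (fromℕ r + fromℕ 34 * fromℕ (suc d))))
      identity _ _ refl refl = solve 4 (λ H w r d → let
            x² = (w :+ con (ℤ.+ 2)) :* (w :+ con (ℤ.+ 2))
            y² = (w :- con (ℤ.+ 2)) :* (w :- con (ℤ.+ 2))
            φ = λ s r d → H :+ con (ℤ.+ 4) :* (con (ℤ.+ 4) :* s :+ (r :+ con (ℤ.+ 34) :* d))
            r′ = con (ℤ.+ 1) :+ r
            d′ = con (ℤ.+ 1) :+ d
          in φ x² r′ d :+ (φ x² r′ d′ :+ φ y² r′ d′) :+ φ y² r′ d := con (ℤ.+ 4) :* φ (w :* w) r d′)
        refl (fromℕ H) (odd t) (fromℕ r) (fromℕ d)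

    scaled : Carrier → Carrier
    scaled x = fromℕ 4 * (fromℕ H * x)

    scaled-avg₂ : ∀ φ → scaled (avg₂ φ) ≡ avg₂ (scaled ∘ φ)
    scaled-avg₂ φ = solve 4 (λ h H x y → con (ℤ.+ 4) :* (H :* (h :* (x :+ y))) := h :* (con (ℤ.+ 4) :* (H :* x) :+ con (ℤ.+ 4) :* (H :* y)))
      refl ½ (fromℕ H) (φ false) (φ true)

    avg₂-mono : ∀ {φ ψ} → (∀ b → φ b ≤ ψ b) → avg₂ φ ≤ avg₂ ψ
    avg₂-mono p = *-monoˡ-≤ 0≤½ (+-mono-≤ (p false) (p true))

    module Reveal {j} (a : Blocks (suc j)) (c : Bool) (t₀ t₁ : AffineTree (suc j)) (i : Fin (suc j)) (k : Fin 3)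
                  (occurs : lookup (lookup a i) k ≡ true) (t : ℤ) where

      q : Affine (suc j)
      q = a , c

      T : AffineTree (suc j)
      T = query q t₀ t₁

      branch : Bool → AffineTree (suc j)
      branch false = t₀
      branch true  = t₁

      at : Bool → Bool → Bool → Blocks j → Blocks (suc j)
      at o₁ o₂ y v = insertAt v i (spread k o₁ o₂ y)

      value : Bool → Bool → Bool → Blocks j → Carrier
      value o₁ o₂ y v = sg (evalᵃ T (at o₁ o₂ y v)) * sg (isNegative (tallyᵇ t (at o₁ o₂ y v)))

      split : advantage T t ≡ avg₂ (λ o₁ → avg₂ (λ o₂ → avg₂ (λ y → 𝔼 (value o₁ o₂ y))))
      split = trans (𝔼-insertAt i (λ v → sg (evalᵃ T v) * sg (isNegative (tallyᵇ t v))))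
        (avg-spread k (λ u → 𝔼 (λ v → sg (evalᵃ T (insertAt v i u)) * sg (isNegative (tallyᵇ t (insertAt v i u))))))

      freeTree : Bool → Bool → Bool → AffineTree j
      freeTree o₁ o₂ y = mapTree (substitute i k o₁ o₂ (constant y)) T

      -- If the two revealed bits differ, the third one decides the triple and is revealed too. The
      -- tree keeps its depth, but has one triple fewer.
      free : ∀ o y → 𝔼 (value o (not o) y) ≡ advantage (freeTree o (not o) y) (step y t)
      free o y = 𝔼-cong λ v → cong₂ (λ p s → sg p * sg (isNegative s))
        (sym (trans (eval-substitute i k o (not o) (constant y) T v) (cong (λ z → evalᵃ T (at o (not o) z v)) (⟪constant⟫ y v))))
        (trans (tally-insertAt t v i (spread k o (not o) y)) (cong (λ b → tallyᵇ (step b t) v) (maj-free k o y)))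

      -- The value of the free coordinate for which the query answers b.
      pivot : Bool → Bool → Affine j
      pivot o b = substitute i k o o (constant false) q ⊞ constant b

      pinnedTree : Bool → Bool → AffineTree j
      pinnedTree o b = mapTree (substitute i k o o (pivot o b)) (branch b)

      -- If the two revealed bits agree, the tally does not depend on the third bit `y`. For fixed
      -- remaining triples the answer is `ρ xor y`, a bijection in `y`, so the average over `y` is
      -- an average over answers `b`. Given `b`, substituting the affine form `pivot o b` for the
      -- bit into the branch for `b` removes the triple and the query at once.
      pinned : ∀ o → avg₂ (λ y → 𝔼 (value o o y)) ≡ avg₂ (λ b → advantage (pinnedTree o b) (step o t))
      pinned o = trans (sym (𝔼-avg₂ (λ v y → value o o y v))) (trans (𝔼-cong pointwise)
        (𝔼-avg₂ (λ v b → sg (evalᵃ (pinnedTree o b) v) * sg (isNegative (tallyᵇ (step o t) v)))))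
        where
        module _ (v : Blocks j) where
          ρ : Bool
          ρ = ⟪ substitute i k o o (constant false) q , v ⟫

          ⟪q⟫ : ∀ y → ⟪ q , at o o y v ⟫ ≡ ρ xor y
          ⟪q⟫ y = begin
            dot a (at o o y v) xor c
              ≡⟨ cong (_xor c) (dot-insertAt a v i (spread k o o y)) ⟩
            (⟨ lookup a i , spread k o o y ⟩ xor d) xor c
              ≡⟨ cong (λ z → (z xor d) xor c) (trans (⟨,spread⟩ (lookup a i) k o o y) (cong (λ κ → S xor (κ ∧ y)) occurs)) ⟩
            ((S xor y) xor d) xor c
              ≡⟨ move S y d c ⟩
            ((S xor d) xor c) xor y
              ≡⟨ cong (λ z → (z xor c) xor y) (sym (dot-insertAt a v i (spread k o o false))) ⟩
            ⟪ q , at o o false v ⟫ xor y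
              ≡⟨ cong (λ z → ⟪ q , at o o z v ⟫ xor y) (sym (⟪constant⟫ false v)) ⟩
            ⟪ q , plug i k o o (constant false) v ⟫ xor y
              ≡⟨ cong (_xor y) (sym (⟪substitute⟫ i k o o (constant false) q v)) ⟩
            ρ xor y ∎
            where
            open ≡-Reasoning
            d = dot (removeAt a i) v
            S = ⟨ lookup a i , spread k o o false ⟩
            move : ∀ s y d c → ((s xor y) xor d) xor c ≡ ((s xor d) xor c) xor y
            move s y d c = trans (cong (_xor c) (xor-swap s y d)) (xor-swap (s xor d) y c)

          F : Carrier
          F = sg (isNegative (tallyᵇ (step o t) v))

          tally-pinned : ∀ y → tallyᵇ t (at o o y v) ≡ tallyᵇ (step o t) v
          tally-pinned y = trans (tally-insertAt t v i (spread k o o y)) (cong (λ b → tallyᵇ (step b t) v) (maj-pinned k o y))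

          pinned-value : ∀ y → value o o y v ≡ sg (evalᵃ (branch (ρ xor y)) (at o o y v)) * F
          pinned-value y = cong₂ _*_ (cong sg (trans (cong (λ z → if z then evalᵃ t₁ (at o o y v) else evalᵃ t₀ (at o o y v)) (⟪q⟫ y)) (select (ρ xor y) y)))
            (cong (sg ∘ isNegative) (tally-pinned y))
            where
            select : ∀ z y → (if z then evalᵃ t₁ (at o o y v) else evalᵃ t₀ (at o o y v)) ≡ evalᵃ (branch z) (at o o y v)
            select true  y = refl
            select false y = refl

          tree-value : ∀ b → evalᵃ (pinnedTree o b) v ≡ evalᵃ (branch b) (at o o (ρ xor b) v)
          tree-value b = trans (eval-substitute i k o o (pivot o b) (branch b) v)
            (cong (λ z → evalᵃ (branch b) (at o o z v)) (trans (⟪⊞⟫ (substitute i k o o (constant false) q) (constant b) v) (cong (ρ xor_) (⟪constant⟫ b v))))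

          pointwise : avg₂ (λ y → value o o y v) ≡ avg₂ (λ b → sg (evalᵃ (pinnedTree o b) v) * F)
          pointwise = trans (avg₂-cong pinned-value) (trans (reindex ρ) (avg₂-cong (λ b → cong (λ z → sg z * F) (sym (tree-value b)))))
            where
            reindex : ∀ ρ → avg₂ (λ y → sg (evalᵃ (branch (ρ xor y)) (at o o y v)) * F) ≡ avg₂ (λ b → sg (evalᵃ (branch b) (at o o (ρ xor b) v)) * F)
            reindex false = refl
            reindex true  = cong (½ *_) (+-comm _ _)

    -- Every step either passes to a subtree or removes a triple. The invariant `H ≤ r + j` says
    -- that revealed and unrevealed triples together number at least `H`, so at a leaf with few
    -- revealed triples enough random steps remain for `walk-bound`.
    potential : ∀ j (T : AffineTree j) r t → H ℕ.≤ r ℕ.+ j → scaled (advantage T t) ≤ Φ r t (depthᵃ T)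
    potential j (leaf b) r t e = subst (λ z → scaled z ≤ Φ r t 0)
      (sym (trans (𝔼-*ˡ {j} (sg b) (λ v → sg (isNegative (tallyᵇ t v)))) (cong (sg b *_) (𝔼-walk j t)))) (walk-bound b j r t e)
    potential j (query (a , c) t₀ t₁) r t e with support a
    -- The query involves no unrevealed bit, so its answer is the constant `c`; passing to that
    -- branch costs no triple, and the potential is monotone in the depth.
    ... | inj₂ z = answered c refl
      where
      answered : ∀ b → c ≡ b → scaled (advantage (query (a , c) t₀ t₁) t) ≤ Φ r t (suc (depthᵃ t₀ ℕ.⊔ depthᵃ t₁))
      answered true  refl = ≤-trans
        (≤-reflexive (cong scaled (𝔼-cong λ v → cong (λ b → sg (if b xor true then evalᵃ t₁ v else evalᵃ t₀ v) * sg (isNegative (tallyᵇ t v))) (z v))))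
        (≤-trans (potential j t₁ r t e) (Φ-mono {r} {t} (ℕₚ.m≤n⇒m≤1+n (ℕₚ.m≤n⊔m (depthᵃ t₀) (depthᵃ t₁)))))
      answered false refl = ≤-trans
        (≤-reflexive (cong scaled (𝔼-cong λ v → cong (λ b → sg (if b xor false then evalᵃ t₁ v else evalᵃ t₀ v) * sg (isNegative (tallyᵇ t v))) (z v))))
        (≤-trans (potential j t₀ r t e) (Φ-mono {r} {t} (ℕₚ.m≤n⇒m≤1+n (ℕₚ.m≤m⊔n (depthᵃ t₀) (depthᵃ t₁)))))
    potential (suc j) (query (a , c) t₀ t₁) r t e | inj₁ (i , k , occurs) = fromℕ-suc-cancelˡ-≤ 3 (subst₂ _≤_
        (cong (fromℕ 4 *_) (sym scaled-split)) collect
        (*-monoˡ-≤ (0≤fromℕ 4) (avg₂-mono λ o₁ → avg₂-mono λ o₂ → bound o₁ o₂)))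
      where
      open Reveal a c t₀ t₁ i k occurs t
      d = depthᵃ t₀ ℕ.⊔ depthᵃ t₁
      X Y : Bool → Bool → Carrier
      X o₁ o₂ = avg₂ (λ y → 𝔼 (value o₁ o₂ y))
      Y false false = Φ (suc r) (up t) d
      Y true  true  = Φ (suc r) (down t) d
      Y _     _     = avg₂ (λ y → Φ (suc r) (step y t) (suc d))

      e′ : H ℕ.≤ suc r ℕ.+ j
      e′ = subst (H ℕ.≤_) (ℕₚ.+-suc r j) e

      scaled-split : scaled (advantage T t) ≡ avg₂ (λ o₁ → avg₂ (λ o₂ → scaled (X o₁ o₂)))
      scaled-split = trans (cong scaled split) (trans (scaled-avg₂ (λ o₁ → avg₂ (X o₁))) (avg₂-cong (λ o₁ → scaled-avg₂ (X o₁))))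

      branch-depth : ∀ b → depthᵃ (branch b) ℕ.≤ d
      branch-depth false = ℕₚ.m≤m⊔n (depthᵃ t₀) (depthᵃ t₁)
      branch-depth true  = ℕₚ.m≤n⊔m (depthᵃ t₀) (depthᵃ t₁)

      pinned-bound : ∀ o → scaled (X o o) ≤ Φ (suc r) (step o t) d
      pinned-bound o = ≤-trans (≤-reflexive (trans (cong scaled (pinned o)) (scaled-avg₂ (λ b → advantage (pinnedTree o b) (step o t)))))
        (avg₂-≤ λ b → ≤-trans (potential j (pinnedTree o b) (suc r) (step o t) e′)
          (Φ-mono {suc r} {step o t} (ℕₚ.≤-trans (ℕₚ.≤-reflexive (depth-mapTree _ (branch b))) (branch-depth b))))

      free-bound : ∀ o → scaled (X o (not o)) ≤ avg₂ (λ y → Φ (suc r) (step y t) (suc d))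
      free-bound o = ≤-trans (≤-reflexive (trans (scaled-avg₂ (λ y → 𝔼 (value o (not o) y))) (avg₂-cong (λ y → cong scaled (free o y)))))
        (avg₂-mono λ y → ≤-trans (potential j (freeTree o (not o) y) (suc r) (step y t) e′)
          (Φ-mono {suc r} {step y t} (ℕₚ.≤-reflexive (depth-mapTree (substitute i k o (not o) (constant y)) T))))

      bound : ∀ o₁ o₂ → scaled (X o₁ o₂) ≤ Y o₁ o₂
      bound false false = pinned-bound false
      bound true  true  = pinned-bound true
      bound false true  = free-bound false
      bound true  false = free-bound true

      collect : fromℕ 4 * avg₂ (λ o₁ → avg₂ (Y o₁)) ≡ fromℕ 4 * Φ r t (suc d)
      collect = trans (gather (Y false false) (Y false true) (Y true true)) (Φ-step r t d)
        where
        gather : ∀ U M W → fromℕ 4 * (½ * (½ * (U + M) + ½ * (M + W))) ≡ U + fromℕ 2 * M + W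
        gather U M W = trans (solve 4 (λ h U M W → con (ℤ.+ 4) :* (h :* (h :* (U :+ M) :+ h :* (M :+ W))) :=
            (con (ℤ.+ 2) :* h) :* ((con (ℤ.+ 2) :* h) :* (U :+ con (ℤ.+ 2) :* M :+ W))) refl ½ U M W)
          (trans (cong₂ (λ p q → p * (q * (U + fromℕ 2 * M + W))) 2*½ 2*½) (trans (*-identityˡ _) (*-identityˡ _)))

  -- From correlation to linear depth.

  module _ (n : ℕ) (T : ParityTree n) (accurate : Pr (uniform n) (λ x → eval T x xor blockMajority n x) ≤ fromℕ 3 ⁻¹) where

    correlation : Carrier
    correlation = avg (λ x → sg (eval T x) * sg (blockMajority n x))

    -- Correlation is one minus twice the error probability, hence at least 1 - 2/3.
    correlation-large : 1# ≤ fromℕ 3 * correlation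
    correlation-large = ≤-by (fromℕ 6 * (fromℕ 3 ⁻¹ - P)) (*-nonNeg (0≤fromℕ 6) (x≤y⇒0≤y-x accurate)) (begin
      fromℕ 3 * correlation
        ≡⟨ cong (fromℕ 3 *_) (trans (avg-∑ {n} _) (trans (sym (∑-*ˡ {n} (½ ^ n) _)) (trans (∑-cong pointwise) (trans (∑-+ {n} _ _)
             (cong₂ _+_ (trans (∑-const {n} (½ ^ n)) (2^*½^ n)) (∑-*ˡ {n} (- fromℕ 2) _)))))) ⟩
      fromℕ 3 * (1# + (- fromℕ 2) * P)
        ≡⟨ solve 2 (λ p z → con (ℤ.+ 3) :* (con (ℤ.+ 1) :+ (:- con (ℤ.+ 2)) :* p) :=
             (con (ℤ.+ 3) :- con (ℤ.+ 2) :* (con (ℤ.+ 3) :* z)) :+ con (ℤ.+ 6) :* (z :- p)) refl P (fromℕ 3 ⁻¹) ⟩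
      (fromℕ 3 - fromℕ 2 * (fromℕ 3 * fromℕ 3 ⁻¹)) + fromℕ 6 * (fromℕ 3 ⁻¹ - P)
        ≡⟨ cong (λ z → (fromℕ 3 - fromℕ 2 * z) + fromℕ 6 * (fromℕ 3 ⁻¹ - P)) (n*n⁻¹≡1 2) ⟩
      (fromℕ 3 - fromℕ 2 * 1#) + fromℕ 6 * (fromℕ 3 ⁻¹ - P)
        ≡⟨ cong (_+ fromℕ 6 * (fromℕ 3 ⁻¹ - P)) (solve 0 (con (ℤ.+ 3) :- con (ℤ.+ 2) :* con (ℤ.+ 1) := con (ℤ.+ 1)) refl) ⟩
      1# + fromℕ 6 * (fromℕ 3 ⁻¹ - P) ∎)
      where
      open ≡-Reasoning
      P = Pr (uniform n) (λ x → eval T x xor blockMajority n x)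
      signs : ∀ b m → m * sg b ≡ m + (- fromℕ 2) * (if b then m else 0#)
      signs true  m = solve 1 (λ m → m :* (:- con (ℤ.+ 1)) := m :+ (:- con (ℤ.+ 2)) :* m) refl m
      signs false m = solve 1 (λ m → m :* con (ℤ.+ 1) := m :+ (:- con (ℤ.+ 2)) :* con (ℤ.+ 0)) refl m
      pointwise : ∀ x → ½ ^ n * (sg (eval T x) * sg (blockMajority n x)) ≡
        ½ ^ n + (- fromℕ 2) * (if eval T x xor blockMajority n x then ½ ^ n else 0#)
      pointwise x = trans (cong (½ ^ n *_) (sym (sg-xor (eval T x) (blockMajority n x)))) (signs (eval T x xor blockMajority n x) (½ ^ n))

    module _ (h : ℕ) (h²≤blocks : h ℕ.* h ℕ.≤ blocks n) where
      open Survival h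

      correlation-small : scaled correlation ≤ Φ 0 (ℤ.+ 0) (depth T)
      correlation-small = subst (_≤ Φ 0 (ℤ.+ 0) (depth T)) (sym (trans (cong scaled by-rest) scaled-avg))
        (avg-≤ λ ℓ → subst (λ k → scaled (advantage (restrictTree ℓ T) (ℤ.+ 0)) ≤ Φ 0 (ℤ.+ 0) k) (depth-restrictTree ℓ T)
          (potential (blocks n) (restrictTree ℓ T) 0 (ℤ.+ 0) h²≤blocks))
        where
        by-rest : correlation ≡ avg (λ ℓ → advantage (restrictTree {n} ℓ T) (ℤ.+ 0))
        by-rest = trans (avg-join n _) (trans (𝔼-avg (λ v ℓ → sg (eval T (join n v ℓ)) * sg (blockMajority n (join n v ℓ))))
          (avg-cong λ ℓ → 𝔼-cong λ v → cong₂ (λ b t → sg b * sg (isNegative t)) (sym (eval-restrictTree ℓ T v)) (tally-join n (ℤ.+ 0) v ℓ)))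
        g : Cube (rest n) → Carrier
        g ℓ = advantage (restrictTree {n} ℓ T) (ℤ.+ 0)
        scaled-avg : scaled (avg g) ≡ avg (scaled ∘ g)
        scaled-avg = sym (trans (avg-*ˡ (fromℕ 4) (λ ℓ → fromℕ H * g ℓ)) (cong (fromℕ 4 *_) (avg-*ˡ (fromℕ H) g)))

      -- Initially no triple is revealed and `odd` is one, so four times `H` times the correlation
      -- is at most H + 4 (4 + 34 d), `d` being the depth. Since it is also at least 4H/3, the
      -- remaining H/3 is at most 4 (4 + 34 d).
      h²≤depth : h ℕ.* h ℕ.≤ 12 ℕ.* (4 ℕ.+ 34 ℕ.* depth T)
      h²≤depth = fromℕ-cancel-≤ (subst (fromℕ H ≤_) (sym homomorphic)
        (≤-by (fromℕ 3 * (Φ 0 (ℤ.+ 0) (depth T) - scaled correlation) + fromℕ 4 * (fromℕ H * (fromℕ 3 * correlation - 1#)))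
          (0≤+ (*-nonNeg (0≤fromℕ 3) (x≤y⇒0≤y-x correlation-small)) (*-nonNeg (0≤fromℕ 4) (*-nonNeg (0≤fromℕ H) (x≤y⇒0≤y-x correlation-large))))
          (solve 3 (λ H d c → con (ℤ.+ 12) :* (con (ℤ.+ 4) :+ con (ℤ.+ 34) :* d) := H :+
            (con (ℤ.+ 3) :* ((H :+ con (ℤ.+ 4) :* (con (ℤ.+ 4) :* ((con (ℤ.+ 1) :+ con (ℤ.+ 2) :* con (ℤ.+ 0)) :* (con (ℤ.+ 1) :+ con (ℤ.+ 2) :* con (ℤ.+ 0)))
                :+ (con (ℤ.+ 0) :+ con (ℤ.+ 34) :* d))) :- con (ℤ.+ 4) :* (H :* c))
              :+ con (ℤ.+ 4) :* (H :* (con (ℤ.+ 3) :* c :- con (ℤ.+ 1)))))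
            refl (fromℕ H) (fromℕ (depth T)) correlation)))
        where
        homomorphic : fromℕ (12 ℕ.* (4 ℕ.+ 34 ℕ.* depth T)) ≡ fromℕ 12 * (fromℕ 4 + fromℕ 34 * fromℕ (depth T))
        homomorphic = trans (fromℕ-* 12 (4 ℕ.+ 34 ℕ.* depth T)) (cong (fromℕ 12 *_) (trans (fromℕ-+ 4 (34 ℕ.* depth T)) (cong (fromℕ 4 +_) (fromℕ-* 34 (depth T)))))

  blockMajority-depth : ∀ n → 300 ℕ.≤ n → (T : ParityTree n) →
    Pr (uniform n) (λ x → eval T x xor blockMajority n x) ≤ fromℕ 3 ⁻¹ → n ℕ.≤ 3264 ℕ.* depth T
  blockMajority-depth n n≥300 T accurate = conclude (floor-sqrt (blocks n))
    where
    arithmetic : ∀ h d → 10 ℕ.≤ h → blocks n ℕ.< suc h ℕ.* suc h → h ℕ.* h ℕ.≤ 12 ℕ.* (4 ℕ.+ 34 ℕ.* d) → n ℕ.≤ 3264 ℕ.* d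
    -- For h ≥ 10, 96 ≤ h² turns h² ≤ 48 + 408 d into h² ≤ 816 d, and n ≤ 3 (h² + 2h) + 2 is at most
    -- 4 h². The constant is 3264 = 4 · 816.
    arithmetic h d h≥10 u p = begin
      n                                     ≤⟨ n≤3*blocks+2 n ⟩
      blocks n ℕ.* 3 ℕ.+ 2                  ≤⟨ ℕₚ.+-monoˡ-≤ 2 (ℕₚ.*-monoˡ-≤ 3 blocks≤) ⟩
      (2 ℕ.* h ℕ.+ h ℕ.* h) ℕ.* 3 ℕ.+ 2     ≡⟨ e₁ h ⟩
      (6 ℕ.* h ℕ.+ 2) ℕ.+ 3 ℕ.* (h ℕ.* h)   ≤⟨ ℕₚ.+-monoˡ-≤ (3 ℕ.* (h ℕ.* h)) (ℕₚ.≤-trans (ℕₚ.+-monoʳ-≤ (6 ℕ.* h) 2≤4h) (ℕₚ.≤-reflexive (e₂ h))) ⟩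
      10 ℕ.* h ℕ.+ 3 ℕ.* (h ℕ.* h)          ≤⟨ ℕₚ.+-monoˡ-≤ (3 ℕ.* (h ℕ.* h)) (ℕₚ.*-monoˡ-≤ h h≥10) ⟩
      h ℕ.* h ℕ.+ 3 ℕ.* (h ℕ.* h)           ≡⟨⟩
      4 ℕ.* (h ℕ.* h)                       ≤⟨ ℕₚ.*-monoʳ-≤ 4 h²≤816d ⟩
      4 ℕ.* (816 ℕ.* d)                     ≡⟨ sym (ℕₚ.*-assoc 4 816 d) ⟩
      3264 ℕ.* d                            ∎
      where
      open ℕₚ.≤-Reasoning
      e₀ : ∀ h → suc h ℕ.* suc h ≡ suc (2 ℕ.* h ℕ.+ h ℕ.* h)
      e₀ = NatSolver.solve-∀
      e₁ : ∀ h → (2 ℕ.* h ℕ.+ h ℕ.* h) ℕ.* 3 ℕ.+ 2 ≡ (6 ℕ.* h ℕ.+ 2) ℕ.+ 3 ℕ.* (h ℕ.* h)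
      e₁ = NatSolver.solve-∀
      e₂ : ∀ h → 6 ℕ.* h ℕ.+ 4 ℕ.* h ≡ 10 ℕ.* h
      e₂ = NatSolver.solve-∀
      e₃ : ∀ d → 2 ℕ.* (12 ℕ.* (4 ℕ.+ 34 ℕ.* d)) ≡ 96 ℕ.+ 816 ℕ.* d
      e₃ = NatSolver.solve-∀
      2≤4h : 2 ℕ.≤ 4 ℕ.* h
      2≤4h = ℕₚ.≤-trans (s≤s (s≤s z≤n)) (ℕₚ.*-monoʳ-≤ 4 h≥10)
      blocks≤ : blocks n ℕ.≤ 2 ℕ.* h ℕ.+ h ℕ.* h
      blocks≤ = ℕₚ.≤-pred (subst (blocks n ℕ.<_) (e₀ h) u)
      96≤h² : 96 ℕ.≤ h ℕ.* h
      96≤h² = ℕₚ.≤-trans (ℕₚ.m≤m+n 96 4) (ℕₚ.*-mono-≤ h≥10 h≥10)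
      h²≤816d : h ℕ.* h ℕ.≤ 816 ℕ.* d
      h²≤816d = ℕₚ.+-cancelˡ-≤ 96 (h ℕ.* h) (816 ℕ.* d) (begin
        96 ℕ.+ h ℕ.* h                   ≤⟨ ℕₚ.+-monoˡ-≤ (h ℕ.* h) 96≤h² ⟩
        h ℕ.* h ℕ.+ h ℕ.* h              ≡⟨ cong (h ℕ.* h ℕ.+_) (sym (ℕₚ.+-identityʳ _)) ⟩
        2 ℕ.* (h ℕ.* h)                  ≤⟨ ℕₚ.*-monoʳ-≤ 2 p ⟩
        2 ℕ.* (12 ℕ.* (4 ℕ.+ 34 ℕ.* d))  ≡⟨ e₃ d ⟩
        96 ℕ.+ 816 ℕ.* d                 ∎)

    -- If h ≤ 9 there are at most 99 triples, hence at most 299 bits; this is the origin of the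
    -- threshold 300.
    large : ∀ h → blocks n ℕ.< suc h ℕ.* suc h → 10 ℕ.≤ h
    large h u with 10 ℕₚ.≤? h
    ... | yes p = p
    ... | no ¬p = ⊥-elim (ℕₚ.<⇒≱ (ℕₚ.<-≤-trans (s≤s (n≤3*blocks+2 n)) (s≤s (ℕₚ.+-monoˡ-≤ 2 (ℕₚ.*-monoˡ-≤ 3 {blocks n} {99}
      (ℕₚ.≤-pred (ℕₚ.≤-trans u (ℕₚ.*-mono-≤ (ℕₚ.≰⇒> ¬p) (ℕₚ.≰⇒> ¬p)))))))) n≥300)

    conclude : (∃[ h ] h ℕ.* h ℕ.≤ blocks n × blocks n ℕ.< suc h ℕ.* suc h) → n ℕ.≤ 3264 ℕ.* depth T
    conclude (h , l , u) = arithmetic h (depth T) (large h u) u (h²≤depth n T accurate h l)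

  D×-blockMajority=Θ : (λ n → D× (blockMajority n)) =Θ fromℕ
  D×-blockMajority=Θ =
      (1# , 0 , λ n _ → subst₂ _≤_ (sym (0≤x⇒∣x∣≡x (0≤D× (blockMajority n))))
        (sym (trans (*-identityˡ _) (0≤x⇒∣x∣≡x (0≤fromℕ n)))) (D×≤n (blockMajority n)))
    , (fromℕ 3264 ⁻¹ , 0<n⁻¹ 3263 , 300 , λ n n≥300 → subst₂ _≤_ (cong (fromℕ 3264 ⁻¹ *_) (sym (0≤x⇒∣x∣≡x (0≤fromℕ n))))
        (sym (0≤x⇒∣x∣≡x (0≤D× (blockMajority n))))
        (≤-trans (≤D (blockMajority n) (0≤n⁻¹ 2) (uniform n) (linear n n≥300)) (≤D× (blockMajority n) (uniform n) (uniform-product n))))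
    where
    linear : ∀ n → 300 ℕ.≤ n → (T : ParityTree n) → Pr (uniform n) (λ x → eval T x xor blockMajority n x) ≤ fromℕ 3 ⁻¹ →
      fromℕ 3264 ⁻¹ * fromℕ n ≤ fromℕ (depth T)
    linear n n≥300 T accurate = n⁻¹*-≤ 3263 (subst (fromℕ n ≤_) (fromℕ-* 3264 (depth T)) (fromℕ-mono-≤ (blockMajority-depth n n≥300 T accurate)))

lemma3 : (ℝ : CompleteOrderedField) → let open Measures ℝ in
    (Σ ((n : ℕ) → Cube n → Bool) λ f →
    ((λ n → disc (f n)) =O (λ n → log₂ (fromℕ n))) ×
    ((λ n → D× (f n)) =Θ fromℕ))
    ×
    (Σ ((n : ℕ) → Cube n → Bool) λ f →
    ((λ n → disc (f n)) =Θ fromℕ) ×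
    ((λ n → D× (f n)) =O (λ n → 1#)))
lemma3 ℝ =
    (blockMajority , Majority.disc-blockMajority=O , Majority.D×-blockMajority=Θ)
  , (repeatedIP , Repeated.disc-repeatedIP=Θ , Repeated.D×-repeatedIP=O)
  where
  module Majority = MajorityDepth ℝ
  module Repeated = RepeatedInnerProduct ℝ
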